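{- $(\mathfrak D,\diamond)$ and $(\mathfrak D,\sqcup\!\sqcup)$ are commutative $\mathbb F_q$-algebras (associative, with unit the empty word $1$).
   Context: Let $q$ be a prime power, $\mathbb F_q$ the field with $q$ elements, $\mathbb N=\{1,2,\dots\}$. Let $\Gamma=\{x_{n,\varepsilon}: n\in\mathbb N,\ \varepsilon\in\mathbb F_q^*\}$ be an alphabet; $x_{n,\varepsilon}$ has weight $n$. A word is a finite string of letters; the empty word is $1$. Let $\mathfrak D$ be the $\mathbb F_q$-vector space with basis the set $\langle\Gamma\rangle$ of words, with concatenation extended bilinearly. A nonempty word is written $\mathfrak a=x_{a,\alpha}\mathfrak a_-$ with $x_{a,\alpha}$ its first letter. For positive integers $r,s,j$ put $\Delta^j_{r,s}=(-1)^{r-1}\binom{j-1}{r-1}+(-1)^{s-1}\binom{j-1}{s-1}\in\mathbb F_q$ if $(q-1)\mid j$ and $0$ otherwise. The diamond product $\diamond$ and shuffle product $\sqcup\!\sqcup$ are the $\mathbb F_q$-bilinear maps $\mathfrak D\times\mathfrak D\to\mathfrak D$ defined recursively by $1\diamond\mathfrak a=\mathfrak a\diamond 1=\mathfrak a$, $1\sqcup\!\sqcup\mathfrak a=\mathfrak a\sqcup\!\sqcup 1=\mathfrak a$, and for nonempty $\mathfrak a=x_{a,\alpha}\mathfrak a_-$, $\mathfrak b=x_{b,\beta}\mathfrak b_-$: $\mathfrak a\diamond\mathfrak b=x_{a+b,\alpha\beta}(\mathfrak a_-\sqcup\!\sqcup\mathfrak b_-)+\sum_{i+j=a+b}\Delta^j_{a,b}\,x_{i,\alpha\beta}\big(x_{j,1}\sqcup\!\sqcup(\mathfrak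 a_-\sqcup\!\sqcup\mathfrak b_-)\big)$ (sum over positive integers $i,j$), and $\mathfrak a\sqcup\!\sqcup\mathfrak b=x_{a,\alpha}(\mathfrak a_-\sqcup\!\sqcup\mathfrak b)+x_{b,\beta}(\mathfrak a\sqcup\!\sqcup\mathfrak b_-)+\mathfrak a\diamond\mathfrak b$. -}

module Defs where

open import Data.Nat as ℕ using (ℕ; zero; suc; _∸_)
open import Data.Nat.Primality using (Prime)
open import Data.Nat.Divisibility using (_∣?_)
open import Data.Nat.Combinatorics using (_C_)
open import Data.Fin using (Fin)
open import Data.List using (List; []; _∷_; _++_; map; concat; concatMap; upTo)
open import Data.Product using (Σ; ∃; ∃₂; _×_; _,_)
open import Relation.Nullary using (¬_; yes; no)
open import Relation.Nullary.Decidable using (does)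
open import Relation.Binary.Definitions using (DecidableEquality)
open import Relation.Binary.PropositionalEquality using (_≡_; _≢_; refl; cong; sym; trans)
open import Algebra.Structures using (IsCommutativeRing)
open import Function.Bundles using (_↔_)
open import Data.Bool using (if_then_else_)

IsPrimePower : ℕ → Set
IsPrimePower q = ∃₂ λ p k → Prime p × q ≡ p ℕ.^ suc k

-- A finite field with exactly q elements (equality is propositional;
-- every finite field is isomorphic to one of this form).
record FiniteField (q : ℕ) : Set₁ where
  field
    Carrier : Set
    _+_ _*_ : Carrier → Carrier → Carrier
    -_      : Carrier → Carrier
    0# 1#   : Carrier
    isCommutativeRing : IsCommutativeRing _≡_ _+_ _*_ -_ 0# 1#
    1≢0     : 1# ≢ 0#
    inverse : ∀ x → x ≢ 0# → Σ Carrier λ y → y * x ≡ 1#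
    _≟_     : DecidableEquality Carrier
    card    : Carrier ↔ Fin q

module _ {q : ℕ} (F : FiniteField q) where
  open FiniteField F
  open IsCommutativeRing isCommutativeRing using (*-assoc; *-identityˡ; zeroʳ)

  private
    nzd : ∀ {α β} → α ≢ 0# → β ≢ 0# → α * β ≢ 0#
    nzd {α} {β} α≢0 β≢0 αβ≡0 with inverse α α≢0
    ... | (a , aα≡1) = β≢0 (trans (sym (*-identityˡ β))
                            (trans (cong (_* β) (sym aα≡1))
                            (trans (*-assoc a α β)
                            (trans (cong (a *_) αβ≡0) (zeroʳ a)))))

  -- The letter x_{n,ε}; the field 'pw' stores n - 1, so the weight is n = suc pw ≥ 1,
  -- and ε ∈ 𝔽_q^* (the nonzero-proof is irrelevant).
  record Letter : Set where
    constructor mkLetter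
    field
      pw  : ℕ
      ε   : Carrier
      .ε≢0 : ε ≢ 0#

  weight : Letter → ℕ
  weight x = suc (Letter.pw x)

  Word : Set
  Word = List Letter

  -- Elements of 𝔇: finite formal 𝔽_q-linear combinations of words.
  Lin : Set
  Lin = List (Carrier × Word)

  _≟L_ : DecidableEquality Letter
  mkLetter n ε _ ≟L mkLetter m δ _ with n ℕ.≟ m | ε ≟ δ
  ... | yes refl | yes refl = yes refl
  ... | no n≢m   | _        = no λ { refl → n≢m refl }
  ... | yes _    | no ε≢δ   = no λ { refl → ε≢δ refl }

  _≟W_ : DecidableEquality Word
  [] ≟W [] = yes refl
  [] ≟W (_ ∷ _) = no λ ()
  (_ ∷ _) ≟W [] = no λ ()
  (x ∷ u) ≟W (y ∷ v) with x ≟L y | u ≟W v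
  ... | yes refl | yes refl = yes refl
  ... | no x≢y   | _        = no λ { refl → x≢y refl }
  ... | yes _    | no u≢v   = no λ { refl → u≢v refl }

  coeff : Word → Lin → Carrier
  coeff w [] = 0#
  coeff w ((c , u) ∷ xs) = if does (u ≟W w) then c + coeff w xs else coeff w xs

  infix 4 _≈_
  _≈_ : Lin → Lin → Set
  x ≈ y = ∀ w → coeff w x ≡ coeff w y

  0D : Lin
  0D = []

  1D : Lin
  1D = (1# , []) ∷ []

  infixr 5 _⊕_
  infixr 7 _•_
  infixl 7 _⋄_ _⧢_
  _⊕_ : Lin → Lin → Lin
  _⊕_ = _++_

  _•_ : Carrier → Lin → Lin
  c • x = map (λ { (d , w) → (c * d , w) }) x

  ⊖_ : Lin → Lin
  ⊖ x = (- 1#) • x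

  pre : Letter → Lin → Lin
  pre ℓ x = map (λ { (d , w) → (d , ℓ ∷ w) }) x

  bilin : (Word → Word → Lin) → Lin → Lin → Lin
  bilin f x y = concatMap (λ { (c , u) → concatMap (λ { (d , v) → (c * d) • f u v }) y }) x

  lin : (Word → Lin) → Lin → Lin
  lin f x = concatMap (λ { (c , u) → c • f u }) x

  ι : ℕ → Carrier
  ι zero = 0#
  ι (suc n) = 1# + ι n

  sgn : ℕ → Carrier
  sgn zero = 1#
  sgn (suc k) = - sgn k

  -- Δ^j_{r,s}, for positive r, s, j
  Δ : (j r s : ℕ) → Carrier
  Δ j r s with (q ∸ 1) ∣? j
  ... | yes _ = (sgn (r ∸ 1) * ι ((j ∸ 1) C (r ∸ 1))) + (sgn (s ∸ 1) * ι ((j ∸ 1) C (s ∸ 1)))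
  ... | no _  = 0#

  -- Common shape of a ⋄ b for a = x_{a,α} a₋, b = x_{b,β} b₋, given
  -- L = a₋ ⧢ b₋ and I j = x_{j,1} ⧢ (a₋ ⧢ b₋) (j given as j - 1):
  --   x_{a+b,αβ} L + Σ_{i+j=a+b, i,j ≥ 1} Δ^j_{a,b} x_{i,αβ} (I j)
  diaCore : Letter → Letter → Lin → (ℕ → Lin) → Lin
  diaCore (mkLetter a' α α≢0) (mkLetter b' β β≢0) L I =
    pre (mkLetter (a' ℕ.+ suc b') (α * β) (nzd α≢0 β≢0)) L
    ⊕ concat (map (λ i' → Δ (suc (a' ℕ.+ b' ∸ i')) (suc a') (suc b')
                          • pre (mkLetter i' (α * β) (nzd α≢0 β≢0)) (I (a' ℕ.+ b' ∸ i')))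
                  (upTo (suc (a' ℕ.+ b'))))

  -- x_{j,1}, j given as j - 1
  xj1 : ℕ → Letter
  xj1 j' = mkLetter j' 1# 1≢0

  -- ins x w = x ⧢ w for a single letter x (the defining recursion of ⧢
  -- specialised to a = x, a₋ = 1, using 1 ⧢ c = c)
  ins : Letter → Word → Lin
  ins x [] = (1# , x ∷ []) ∷ []
  ins x (y ∷ w) = ((1# , x ∷ y ∷ w) ∷ [])
                ⊕ pre y (ins x w)
                ⊕ diaCore x y ((1# , w) ∷ []) (λ j' → ins (xj1 j') w)

  sh : Word → Word → Lin
  sh [] v = (1# , v) ∷ []
  sh (x ∷ u) [] = (1# , x ∷ u) ∷ []
  sh (x ∷ u) (y ∷ v) = pre x (sh u (y ∷ v))
                     ⊕ pre y (sh (x ∷ u) v)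
                     ⊕ diaCore x y (sh u v) (λ j' → lin (ins (xj1 j')) (sh u v))

  dia : Word → Word → Lin
  dia [] v = (1# , v) ∷ []
  dia (x ∷ u) [] = (1# , x ∷ u) ∷ []
  dia (x ∷ u) (y ∷ v) = diaCore x y (sh u v) (λ j' → lin (ins (xj1 j')) (sh u v))

  _⋄_ : Lin → Lin → Lin
  _⋄_ = bilin dia

  _⧢_ : Lin → Lin → Lin
  _⧢_ = bilin sh

  IsCommAlgebra : (Lin → Lin → Lin) → Set
  IsCommAlgebra _·_ =
    IsCommutativeRing _≈_ _⊕_ _·_ ⊖_ 0D 1D
    × (∀ c x y → (c • (x · y)) ≈ ((c • x) · y))
    × (∀ c x y → (c • (x · y)) ≈ (x · (c • y)))

module Submission where

-- For the letter series X(S) = Σ xₙ Sⁿ⁻¹, the defining recursion reads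
-- X(S) ⋄ X(T) = (X(S) − X(T)) P(S − T), where P(U) = 1/U + Σ xⱼ Uʲ⁻¹ over the
-- multiples j of q − 1 acts on the remaining word by ⧢.  Associativity of three
-- letters then amounts to P(u) P(v) = P(u + v) (P(u) + P(v)).  Formally P is the
-- reciprocal of an additive function; the coefficients of the identity at single
-- letters follow from Frobenius, those at pairs of letters from the translation
-- invariance in v of Σ_{ε ∈ 𝔽_q} (v + ε u)ⁿ.  Words follow by induction on length.

open import Algebra.Bundles using (CommutativeRing; CommutativeMonoid; RawRing)
open import Data.Bool using (true; false; if_then_else_)
open import Data.Empty using (⊥-elim)
open import Data.Fin as Fin using (Fin)
open import Data.Fin.Permutation using (Permutation; permutation)
open import Data.List using (List; []; _∷_; _++_; map; concat; concatMap; upTo; applyUpTo; length)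
import Data.List.Properties as List
open import Data.Maybe using (Maybe; just; nothing)
open import Data.Nat as ℕ using (ℕ; zero; suc; z≤n; s≤s; _∸_)
import Data.Nat.Properties as ℕ
import Data.Nat.Solver
open import Data.Nat.Combinatorics using (_C_; nCn≡1; nCk+nC[k+1]≡[n+1]C[k+1])
open import Data.Nat.Divisibility using (_∣_; divides; _∣?_; _∣0; ∣m+n∣m⇒∣n; ∣m∣n⇒∣m+n; ∣⇒≤; ∣-refl; m%n≡0⇒n∣m)
open import Data.Nat.DivMod using (_%_; _/_; m≡m%n+[m/n]*n; m%n<n)
open import Data.Product using (_×_; _,_; proj₁; proj₂)
import Data.Product.Properties as Product
open import Function using (_∘_; flip; id; Injective)
open import Function.Bundles using (Inverse)
open import Level using (0ℓ)
open import Relation.Nullary using (¬_; Dec; yes; no; does)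
open import Relation.Nullary.Decidable using (dec-true; dec-false)
open import Relation.Binary.PropositionalEquality as ≡ using (_≡_; _≢_; cong; cong₂; subst)
open import Defs using (FiniteField; Δ; sgn; ι)

-- P has a pole, so no identity is stated for P itself. What is proved, degree by degree, is the
-- form obtained on multiplying by u v (u + v). The product of three letter series likewise carries
-- the factor (S - T)(S - R)(T - R), which is cancelled at the end in a ring of power series.
--
-- Inner letters act on the remaining word M, and rewriting x_l ⧢ (x_j ⧢ M) as (x_l ⧢ x_j) ⧢ M is
-- itself an instance of associativity. There is no circle: three first letters have been removed
-- and only two inner letters inserted, so this instance has smaller total length. After the
-- rewriting, a functional sees M only through its values on M, on one letter ⧢ M and on two letters
-- ⧢ M. These values enter linearly, so they are treated as arbitrary field elements and the words
-- drop out of the identity.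
--
-- Given commutativity, associativity is invariance of (u ⧢ v) ⧢ w under rotation. On first letters,
-- rotation is composed of the swap of the first two arguments, visible from the symmetry of `Δ`,
-- and the swap of the last two, which is what the generating functions provide.

module IntegerCoefficientSolver (K : CommutativeRing 0ℓ 0ℓ) where
  open CommutativeRing K hiding (zero)
  open import Algebra.Properties.Semiring.Mult.TCOptimised semiring
    using (×-homo-+; ×1-homo-*; 1+×) renaming (_×_ to _·_)
  open import Algebra.Properties.Ring ring
    using (-‿distribˡ-*; -‿distribʳ-*; -‿involutive; -0#≈0#; -‿+-comm)
  open import Algebra.Properties.CommutativeSemigroup +-commutativeSemigroup
    using (interchange)
  open import Relation.Binary.Reasoning.Setoid setoid
  open import Algebra.Solver.Ring.AlmostCommutativeRing
    using (fromCommutativeRing; _-Raw-AlmostCommutative⟶_)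

  -- A pair (a , b) stands for the integer a − b; only pairs with a zero entry
  -- occur, so that equal coefficients are syntactically equal.
  reduce : ℕ → ℕ → ℕ × ℕ
  reduce (suc a) (suc b) = reduce a b
  reduce a       b       = a , b

  coefficients : RawRing 0ℓ 0ℓ
  coefficients = record
    { Carrier = ℕ × ℕ
    ; _≈_     = _≡_
    ; _+_     = λ { (a , b) (c , d) → reduce (a ℕ.+ c) (b ℕ.+ d) }
    ; _*_     = λ { (a , b) (c , d) → reduce (a ℕ.* c ℕ.+ b ℕ.* d) (a ℕ.* d ℕ.+ b ℕ.* c) }
    ; -_      = λ { (a , b) → b , a }
    ; 0#      = 0 , 0
    ; 1#      = 1 , 0
    }

  diff : ℕ → ℕ → Carrier
  diff a b = a · 1# + - (b · 1#)

  -- The clause for `zero` makes the constants `:0` and `:1` evaluate to `0#` and `1#` by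
  -- computation, so that solved equations match goals that mention them.
  ⟦_⟧ : ℕ × ℕ → Carrier
  ⟦ a , zero ⟧  = a · 1#
  ⟦ a , suc b ⟧ = diff a (suc b)

  ⟦⟧≈diff : ∀ a b → ⟦ a , b ⟧ ≈ diff a b
  ⟦⟧≈diff a zero    = sym (trans (+-congˡ -0#≈0#) (+-identityʳ _))
  ⟦⟧≈diff a (suc b) = refl

  diff-suc : ∀ a b → diff (suc a) (suc b) ≈ diff a b
  diff-suc a b = begin
    suc a · 1# + - (suc b · 1#)         ≈⟨ +-cong (1+× a 1#) (-‿cong (1+× b 1#)) ⟩
    (1# + a · 1#) + - (1# + b · 1#)     ≈⟨ +-congˡ (-‿+-comm 1# (b · 1#)) ⟨
    (1# + a · 1#) + (- 1# + - (b · 1#)) ≈⟨ interchange _ _ _ _ ⟩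
    (1# + - 1#) + diff a b              ≈⟨ +-congʳ (-‿inverseʳ 1#) ⟩
    0# + diff a b                       ≈⟨ +-identityˡ _ ⟩
    diff a b                            ∎

  ⟦reduce⟧ : ∀ a b → ⟦ reduce a b ⟧ ≈ diff a b
  ⟦reduce⟧ zero    b       = ⟦⟧≈diff zero b
  ⟦reduce⟧ (suc a) zero    = ⟦⟧≈diff (suc a) zero
  ⟦reduce⟧ (suc a) (suc b) = trans (⟦reduce⟧ a b) (sym (diff-suc a b))

  diff-homo-+ : ∀ a b c d → diff (a ℕ.+ c) (b ℕ.+ d) ≈ diff a b + diff c d
  diff-homo-+ a b c d = begin
    (a ℕ.+ c) · 1# + - ((b ℕ.+ d) · 1#)
      ≈⟨ +-cong (×-homo-+ 1# a c) (-‿cong (×-homo-+ 1# b d)) ⟩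
    (a · 1# + c · 1#) + - (b · 1# + d · 1#)
      ≈⟨ +-congˡ (-‿+-comm (b · 1#) (d · 1#)) ⟨
    (a · 1# + c · 1#) + (- (b · 1#) + - (d · 1#))
      ≈⟨ interchange _ _ _ _ ⟩
    diff a b + diff c d ∎

  *-diff : ∀ x y z w → (x + - y) * (z + - w) ≈ (x * z + y * w) + - (x * w + y * z)
  *-diff x y z w = begin
    (x + - y) * (z + - w)
      ≈⟨ distribʳ _ x (- y) ⟩
    x * (z + - w) + - y * (z + - w)
      ≈⟨ +-cong (distribˡ x z (- w)) (trans (distribˡ (- y) z (- w)) (+-comm _ _)) ⟩
    (x * z + x * - w) + (- y * - w + - y * z)
      ≈⟨ +-cong (+-congˡ (sym (-‿distribʳ-* x w)))
                (+-cong (trans (sym (-‿distribˡ-* y (- w)))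
                        (trans (-‿cong (sym (-‿distribʳ-* y w))) (-‿involutive _)))
                        (sym (-‿distribˡ-* y z))) ⟩
    (x * z + - (x * w)) + (y * w + - (y * z))
      ≈⟨ interchange _ _ _ _ ⟩
    (x * z + y * w) + (- (x * w) + - (y * z))
      ≈⟨ +-congˡ (-‿+-comm _ _) ⟩
    (x * z + y * w) + - (x * w + y * z) ∎

  ·1-sum-of-products : ∀ a b c d → (a ℕ.* c ℕ.+ b ℕ.* d) · 1# ≈ a · 1# * c · 1# + b · 1# * d · 1#
  ·1-sum-of-products a b c d =
    trans (×-homo-+ 1# (a ℕ.* c) (b ℕ.* d)) (+-cong (×1-homo-* a c) (×1-homo-* b d))

  morphism : coefficients -Raw-AlmostCommutative⟶ fromCommutativeRing K
  morphism = record
    { ⟦_⟧    = ⟦_⟧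
    ; +-homo = λ { (a , b) (c , d) →
        trans (⟦reduce⟧ (a ℕ.+ c) (b ℕ.+ d))
        (trans (diff-homo-+ a b c d)
        (+-cong (sym (⟦⟧≈diff a b)) (sym (⟦⟧≈diff c d)))) }
    ; *-homo = λ { (a , b) (c , d) →
        trans (⟦reduce⟧ (a ℕ.* c ℕ.+ b ℕ.* d) (a ℕ.* d ℕ.+ b ℕ.* c))
        (trans (+-cong (·1-sum-of-products a b c d) (-‿cong (·1-sum-of-products a b d c)))
        (trans (sym (*-diff _ _ _ _))
        (*-cong (sym (⟦⟧≈diff a b)) (sym (⟦⟧≈diff c d))))) }
    ; -‿homo = λ { (a , b) →
        trans (⟦⟧≈diff b a)
        (trans (+-comm _ _)
        (trans (+-congˡ (sym (-‿involutive _)))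
        (trans (-‿+-comm _ _) (-‿cong (sym (⟦⟧≈diff a b)))))) }
    ; 0-homo = refl
    ; 1-homo = refl
    }

  coefficient-≟ : ∀ p q → Maybe (⟦ p ⟧ ≈ ⟦ q ⟧)
  coefficient-≟ p q with Product.≡-dec ℕ._≟_ ℕ._≟_ p q
  ... | yes ≡.refl = just refl
  ... | no _       = nothing

  open import Algebra.Solver.Ring coefficients (fromCommutativeRing K) morphism coefficient-≟ public
    using (solve; _:=_; _:+_; _:*_; :-_; _:-_; con; Polynomial)

  :0 :1 : ∀ {n} → Polynomial n
  :0 = con (0 , 0)
  :1 = con (1 , 0)

-- Sums over the antidiagonal i + j = n

module AntidiagonalSums (K : CommutativeRing 0ℓ 0ℓ) where
  open CommutativeRing K hiding (zero)
  open import Algebra.Properties.Semiring.Exp semiring using (_^_)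
  open import Algebra.Properties.Semiring.Mult semiring using (×-homo-+; ×-congˡ) renaming (_×_ to _·_)
  open import Algebra.Properties.Semiring.Sum semiring using (sum; ∑-distrib-+)
  open import Algebra.Properties.CommutativeSemigroup +-commutativeSemigroup
    using (interchange; x∙yz≈y∙xz)
  open import Relation.Binary.Reasoning.Setoid setoid
  open IntegerCoefficientSolver K

  -- Both indices are arguments of the summand, so no truncated subtraction n ∸ i occurs.
  AD : ℕ → (ℕ → ℕ → Carrier) → Carrier
  AD zero    f = f 0 0
  AD (suc n) f = f 0 (suc n) + AD n (λ i j → f (suc i) j)

  AD-cong : ∀ n {f g} → (∀ i j → i ℕ.+ j ≡ n → f i j ≈ g i j) → AD n f ≈ AD n g
  AD-cong zero    f≈g = f≈g 0 0 ≡.refl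
  AD-cong (suc n) f≈g =
    +-cong (f≈g 0 (suc n) ≡.refl) (AD-cong n λ i j eq → f≈g (suc i) j (≡.cong suc eq))

  AD-cong′ : ∀ n {f g} → (∀ i j → f i j ≈ g i j) → AD n f ≈ AD n g
  AD-cong′ n f≈g = AD-cong n λ i j _ → f≈g i j

  AD-+ : ∀ n f g → AD n (λ i j → f i j + g i j) ≈ AD n f + AD n g
  AD-+ zero    f g = refl
  AD-+ (suc n) f g = trans (+-congˡ (AD-+ n _ _)) (interchange _ _ _ _)

  AD-*ˡ : ∀ n c f → c * AD n f ≈ AD n (λ i j → c * f i j)
  AD-*ˡ zero    c f = refl
  AD-*ˡ (suc n) c f = trans (distribˡ _ _ _) (+-congˡ (AD-*ˡ n c _))

  AD-*ʳ : ∀ n c f → AD n f * c ≈ AD n (λ i j → f i j * c)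
  AD-*ʳ zero    c f = refl
  AD-*ʳ (suc n) c f = trans (distribʳ _ _ _) (+-congˡ (AD-*ʳ n c _))

  AD-0 : ∀ n {f} → (∀ i j → i ℕ.+ j ≡ n → f i j ≈ 0#) → AD n f ≈ 0#
  AD-0 zero    f≈0 = f≈0 0 0 ≡.refl
  AD-0 (suc n) f≈0 =
    trans (+-cong (f≈0 0 (suc n) ≡.refl) (AD-0 n λ i j eq → f≈0 (suc i) j (≡.cong suc eq))) (+-identityˡ 0#)

  AD-last : ∀ n f → AD (suc n) f ≈ AD n (λ i j → f i (suc j)) + f (suc n) 0
  AD-last zero    f = refl
  AD-last (suc n) f = trans (+-congˡ (AD-last n λ i j → f (suc i) j)) (sym (+-assoc _ _ _))

  AD-comm : ∀ n f → AD n f ≈ AD n (flip f)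
  AD-comm zero    f = refl
  AD-comm (suc n) f = begin
    f 0 (suc n) + AD n (λ i j → f (suc i) j)        ≈⟨ +-comm _ _ ⟩
    AD n (λ i j → f (suc i) j) + f 0 (suc n)        ≈⟨ +-congʳ (AD-comm n _) ⟩
    AD n (λ i j → flip f i (suc j)) + f 0 (suc n)   ≈⟨ AD-last n (flip f) ⟨
    AD (suc n) (flip f)                             ∎

  -- Both sides run over the triples with i + j + k = n.
  AD-assoc : ∀ n (f : ℕ → ℕ → ℕ → Carrier) →
             AD n (λ m k → AD m (λ i j → f i j k)) ≈ AD n (λ i m → AD m (f i))
  AD-assoc zero    f = refl
  AD-assoc (suc n) f = begin
    f 0 0 (suc n) + AD n (λ m k → f 0 (suc m) k + AD m (λ i j → f (suc i) j k))
      ≈⟨ +-congˡ (AD-+ n _ _) ⟩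
    f 0 0 (suc n) + (AD n (λ m k → f 0 (suc m) k) + AD n (λ m k → AD m (λ i j → f (suc i) j k)))
      ≈⟨ +-assoc _ _ _ ⟨
    AD (suc n) (f 0) + AD n (λ m k → AD m (λ i j → f (suc i) j k))
      ≈⟨ +-congˡ (AD-assoc n (λ i → f (suc i))) ⟩
    AD (suc n) (f 0) + AD n (λ i m → AD m (f (suc i))) ∎

  AD-swap : ∀ m n (f : ℕ → ℕ → ℕ → ℕ → Carrier) →
            AD m (λ i j → AD n (f i j)) ≈ AD n (λ k l → AD m (λ i j → f i j k l))
  AD-swap zero    n f = refl
  AD-swap (suc m) n f = begin
    AD n (f 0 (suc m)) + AD m (λ i j → AD n (f (suc i) j))
      ≈⟨ +-congˡ (AD-swap m n _) ⟩
    AD n (f 0 (suc m)) + AD n (λ k l → AD m (λ i j → f (suc i) j k l))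
      ≈⟨ AD-+ n _ _ ⟨
    AD n (λ k l → f 0 (suc m) k l + AD m (λ i j → f (suc i) j k l)) ∎

  AD-exchange : ∀ n (f : ℕ → ℕ → ℕ → Carrier) →
                AD n (λ i m → AD m (λ j k → f i j k)) ≈ AD n (λ j m → AD m (λ i k → f i j k))
  AD-exchange n f = begin
    AD n (λ i m → AD m (λ j k → f i j k)) ≈⟨ AD-assoc n f ⟨
    AD n (λ m k → AD m (λ i j → f i j k)) ≈⟨ AD-cong′ n (λ m k → AD-comm m _) ⟩
    AD n (λ m k → AD m (λ j i → f i j k)) ≈⟨ AD-assoc n (λ j i → f i j) ⟩
    AD n (λ j m → AD m (λ i k → f i j k)) ∎

  AD-ends : ∀ n f → AD (suc (suc n)) f ≈ f 0 (suc (suc n)) + AD n (λ i j → f (suc i) (suc j)) + f (suc (suc n)) 0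
  AD-ends n f = trans (+-congˡ (AD-last n (λ i j → f (suc i) j))) (sym (+-assoc _ _ _))

  AD-skip : ∀ e n f → (∀ i j → i ℕ.< e → f i j ≈ 0#) → AD (e ℕ.+ n) f ≈ AD n (λ i j → f (e ℕ.+ i) j)
  AD-skip zero    n f f≈0 = refl
  AD-skip (suc e) n f f≈0 = trans (+-congʳ (f≈0 0 _ (ℕ.s≤s ℕ.z≤n)))
    (trans (+-identityˡ _) (AD-skip e n (λ i j → f (suc i) j) λ i j i<e → f≈0 (suc i) j (ℕ.s≤s i<e)))

  sum-AD : ∀ {q} n (f : ℕ → ℕ → Fin q → Carrier) →
           sum (λ e → AD n (λ i j → f i j e)) ≈ AD n (λ i j → sum (f i j))
  sum-AD zero    f = refl
  sum-AD (suc n) f = trans (∑-distrib-+ (f 0 (suc n)) (λ e → AD n (λ i j → f (suc i) j e)))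
                           (+-congˡ (sum-AD n λ i j → f (suc i) j))

  geometric-AD : ∀ n x y → (x - y) * AD n (λ i j → x ^ i * y ^ j) ≈ x ^ suc n - y ^ suc n
  geometric-AD zero    x y = solve 2 (λ x y → (x :- y) :* (:1 :* :1) := x :* :1 :- y :* :1) refl x y
  geometric-AD (suc n) x y = begin
    (x - y) * (1# * y ^ suc n + AD n (λ i j → x ^ suc i * y ^ j))
      ≈⟨ *-congˡ (+-congˡ (trans (AD-cong′ n (λ i j → *-assoc x _ _)) (sym (AD-*ˡ n x _)))) ⟩
    (x - y) * (1# * y ^ suc n + x * AD n (λ i j → x ^ i * y ^ j))
      ≈⟨ solve 4 (λ x y z w → (x :- y) :* (:1 :* z :+ x :* w) := (x :- y) :* z :+ x :* ((x :- y) :* w)) refl _ _ _ _ ⟩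
    (x - y) * y ^ suc n + x * ((x - y) * AD n (λ i j → x ^ i * y ^ j))
      ≈⟨ +-congˡ (*-congˡ (geometric-AD n x y)) ⟩
    (x - y) * y ^ suc n + x * (x ^ suc n - y ^ suc n)
      ≈⟨ solve 4 (λ x y z w → (x :- y) :* z :+ x :* (w :- z) := x :* w :- y :* z) refl _ _ _ _ ⟩
    x ^ suc (suc n) - y ^ suc (suc n) ∎

  -- The summation range may exceed the exponent n; the extra binomial
  -- coefficients vanish.
  binomial-AD : ∀ m n x y → AD (m ℕ.+ n) (λ i j → (n C i) · 1# * (x ^ i * y ^ j)) ≈ y ^ m * (x + y) ^ n
  binomial-AD m zero x y = trans (lemma (m ℕ.+ 0)) (trans (reflexive (≡.cong (y ^_) (ℕ.+-identityʳ m))) (sym (*-identityʳ _)))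
    where
    first : ∀ k → (0 C 0) · 1# * (x ^ 0 * y ^ k) ≈ y ^ k
    first k = solve 1 (λ z → (:1 :+ :0) :* (:1 :* z) := z) refl (y ^ k)
    lemma : ∀ k → AD k (λ i j → (0 C i) · 1# * (x ^ i * y ^ j)) ≈ y ^ k
    lemma zero    = first 0
    lemma (suc k) = trans (+-cong (first (suc k)) (AD-0 k (λ i j _ → zeroˡ _))) (+-identityʳ _)
  binomial-AD m (suc n) x y = begin
    AD (m ℕ.+ suc n) (λ i j → (suc n C i) · 1# * (x ^ i * y ^ j))
      ≈⟨ reflexive (≡.cong (λ k → AD k (λ i j → (suc n C i) · 1# * (x ^ i * y ^ j))) (ℕ.+-suc m n)) ⟩
    (suc n C 0) · 1# * (1# * y ^ suc N) + AD N (λ i j → (suc n C suc i) · 1# * (x ^ suc i * y ^ j))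
      ≈⟨ +-congˡ (AD-cong′ N λ i j → trans (*-congʳ (pascal i))
           (solve 5 (λ a b x z w → (a :+ b) :* (x :* z :* w) := x :* (a :* (z :* w)) :+ b :* (x :* z :* w)) refl _ _ x _ _)) ⟩
    (suc n C 0) · 1# * (1# * y ^ suc N) + AD N (λ i j → x * ((n C i) · 1# * (x ^ i * y ^ j)) + (n C suc i) · 1# * (x * x ^ i * y ^ j))
      ≈⟨ +-congˡ (trans (AD-+ N _ _) (+-congʳ (sym (AD-*ˡ N x _)))) ⟩
    (suc n C 0) · 1# * (1# * y ^ suc N) + (x * B + B′)
      -- The term i = 0, whose binomial coefficient is 1 for n + 1 as for n, extends `B′` to a sum
      -- of degree `suc N`; hence the recursive call at `suc m`.
      ≈⟨ x∙yz≈y∙xz _ _ _ ⟩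
    x * B + AD (suc N) (λ i j → (n C i) · 1# * (x ^ i * y ^ j))
      ≈⟨ +-cong (*-congˡ (binomial-AD m n x y)) (binomial-AD (suc m) n x y) ⟩
    x * (y ^ m * (x + y) ^ n) + y ^ suc m * (x + y) ^ n
      ≈⟨ solve 4 (λ x y z w → x :* (z :* w) :+ y :* z :* w := z :* ((x :+ y) :* w)) refl x y _ _ ⟩
    y ^ m * (x + y) ^ suc n ∎
    where
    N = m ℕ.+ n
    B = AD N (λ i j → (n C i) · 1# * (x ^ i * y ^ j))
    B′ = AD N (λ i j → (n C suc i) · 1# * (x ^ suc i * y ^ j))
    pascal : ∀ i → (suc n C suc i) · 1# ≈ (n C i) · 1# + (n C suc i) · 1#
    pascal i = trans (×-congˡ {x = 1#} (≡.sym (nCk+nC[k+1]≡[n+1]C[k+1] n i))) (×-homo-+ 1# (n C i) (n C suc i))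

-- Formal power series

module PowerSeries (A : CommutativeRing 0ℓ 0ℓ) where
  open CommutativeRing A hiding (zero)
  open AntidiagonalSums A
  open import Relation.Binary.Reasoning.Setoid setoid

  Series : Set
  Series = ℕ → Carrier

  infix  4 _≋_
  infixl 7 _⊛_

  _≋_ : Series → Series → Set
  f ≋ g = ∀ n → f n ≈ g n

  _⊛_ : Series → Series → Series
  (f ⊛ g) n = AD n (λ i j → f i * g j)

  const : Carrier → Series
  const a zero    = a
  const a (suc n) = 0#

  X : Series
  X zero    = 0#
  X (suc n) = const 1# n

  const-⊛ : ∀ a f n → (const a ⊛ f) n ≈ a * f n
  const-⊛ a f zero    = refl
  const-⊛ a f (suc n) = trans (+-congˡ (AD-0 n λ i j _ → zeroˡ _)) (+-identityʳ _)

  X-⊛-suc : ∀ f n → (X ⊛ f) (suc n) ≈ f n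
  X-⊛-suc f n = trans (+-cong (zeroˡ _) (trans (const-⊛ 1# f n) (*-identityˡ _))) (+-identityˡ _)

  ⊛-comm : ∀ f g → f ⊛ g ≋ g ⊛ f
  ⊛-comm f g n = trans (AD-comm n _) (AD-cong′ n λ i j → *-comm _ _)

  ⊛-assoc : ∀ f g h → (f ⊛ g) ⊛ h ≋ f ⊛ (g ⊛ h)
  ⊛-assoc f g h n = begin
    AD n (λ m k → AD m (λ i j → f i * g j) * h k)   ≈⟨ AD-cong′ n (λ m k → AD-*ʳ m _ _) ⟩
    AD n (λ m k → AD m (λ i j → f i * g j * h k))   ≈⟨ AD-assoc n _ ⟩
    AD n (λ i m → AD m (λ j k → f i * g j * h k))   ≈⟨ AD-cong′ n (λ i m → trans (AD-cong′ m (λ j k → *-assoc _ _ _)) (sym (AD-*ˡ m _ _))) ⟩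
    AD n (λ i m → f i * AD m (λ j k → g j * h k))   ∎

  ⊛-identityˡ : ∀ f → const 1# ⊛ f ≋ f
  ⊛-identityˡ f n = trans (const-⊛ 1# f n) (*-identityˡ _)

  ⊛-distribˡ : ∀ f g h → f ⊛ (λ n → g n + h n) ≋ λ n → (f ⊛ g) n + (f ⊛ h) n
  ⊛-distribˡ f g h n = trans (AD-cong′ n λ i j → distribˡ _ _ _) (AD-+ n _ _)

  powerSeries : CommutativeRing 0ℓ 0ℓ
  powerSeries = record
    { Carrier = Series
    ; _≈_ = _≋_
    ; _+_ = λ f g n → f n + g n
    ; _*_ = _⊛_
    ; -_  = λ f n → - f n
    ; 0#  = λ _ → 0#
    ; 1#  = const 1#
    ; isCommutativeRing = record
      { isRing = record
        { +-isAbelianGroup = record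
          { isGroup = record
            { isMonoid = record
              { isSemigroup = record
                { isMagma = record
                  { isEquivalence = record
                    { refl  = λ _ → refl
                    ; sym   = λ p n → sym (p n)
                    ; trans = λ p q n → trans (p n) (q n)
                    }
                  ; ∙-cong = λ p q n → +-cong (p n) (q n)
                  }
                ; assoc = λ _ _ _ _ → +-assoc _ _ _
                }
              ; identity = (λ _ _ → +-identityˡ _) , (λ _ _ → +-identityʳ _)
              }
            ; inverse = (λ _ _ → -‿inverseˡ _) , (λ _ _ → -‿inverseʳ _)
            ; ⁻¹-cong = λ p n → -‿cong (p n)
            }
          ; comm = λ _ _ _ → +-comm _ _
          }
        ; *-cong = λ p q n → AD-cong′ n λ i j → *-cong (p i) (q j)
        ; *-assoc = ⊛-assoc
        ; *-identity = ⊛-identityˡ , λ f n → trans (⊛-comm f _ n) (⊛-identityˡ f n)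
        ; distrib = ⊛-distribˡ , λ f g h n →
            trans (⊛-comm _ f n) (trans (⊛-distribˡ f g h n) (+-cong (⊛-comm f g n) (⊛-comm f h n)))
        }
      ; *-comm = ⊛-comm
      }
    }

  module P = CommutativeRing powerSeries

  const-+ : ∀ a b → const (a + b) ≋ const a P.+ const b
  const-+ a b zero    = refl
  const-+ a b (suc n) = sym (+-identityˡ _)

  const-* : ∀ a b → const (a * b) ≋ const a ⊛ const b
  const-* a b zero    = refl
  const-* a b (suc n) = sym (trans (const-⊛ a _ (suc n)) (zeroʳ a))

  const-cong : ∀ {a b} → a ≈ b → const a ≋ const b
  const-cong a≈b zero    = a≈b
  const-cong a≈b (suc n) = refl

NonZeroDivisor : (A : CommutativeRing 0ℓ 0ℓ) → CommutativeRing.Carrier A → Set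
NonZeroDivisor A a = ∀ f → a * f ≈ 0# → f ≈ 0#
  where open CommutativeRing A

module _ (A : CommutativeRing 0ℓ 0ℓ) where
  open CommutativeRing A hiding (zero)
  open PowerSeries A

  const-nonZeroDivisor : ∀ {a} → NonZeroDivisor A a → NonZeroDivisor powerSeries (const a)
  const-nonZeroDivisor nzd f af≈0 n = nzd (f n) (trans (sym (const-⊛ _ f n)) (af≈0 n))

  -- If (a - X) f = 0, then a f₀ = 0 and a fₙ₊₁ = fₙ, so the coefficients vanish one after the
  -- other.
  const-X-nonZeroDivisor : ∀ {a} → NonZeroDivisor A a → NonZeroDivisor powerSeries (const a P.- X)
  const-X-nonZeroDivisor {a} nzd f eq = vanish
    where
    expand : ∀ n → a * f n ≈ (X ⊛ f) n
    expand n = trans (sym (const-⊛ a f n)) (trans (solve₁ n) (trans (+-congʳ (eq n)) (+-identityˡ _)))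
      where
      solve₁ : const a ⊛ f ≋ (const a P.- X) ⊛ f P.+ X ⊛ f
      solve₁ = solve 3 (λ c x f → c :* f := (c :- x) :* f :+ x :* f) (λ _ → refl) (const a) X f
        where open IntegerCoefficientSolver powerSeries
    vanish : ∀ n → f n ≈ 0#
    vanish zero    = nzd (f 0) (trans (expand 0) (zeroˡ _))
    vanish (suc n) = nzd (f (suc n)) (trans (expand (suc n)) (trans (X-⊛-suc f n) (vanish n)))

-- Sums and products over all field elements

module SumsOverField {q : ℕ} (F : FiniteField q) (M : CommutativeMonoid 0ℓ 0ℓ) where
  private module F = FiniteField F
  open ≡ using (refl; sym; trans)
  open CommutativeMonoid M hiding (refl) renaming (sym to ≈-sym; trans to ≈-trans)
  open import Algebra.Properties.CommutativeMonoid.Sum M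
  open import Algebra.Properties.Monoid.Mult monoid using () renaming (_×_ to _·_)

  elem : Fin q → F.Carrier
  elem = Inverse.from F.card

  index : F.Carrier → Fin q
  index = Inverse.to F.card

  elem-index : ∀ x → elem (index x) ≡ x
  elem-index = Inverse.strictlyInverseʳ F.card

  index-elem : ∀ i → index (elem i) ≡ i
  index-elem = Inverse.strictlyInverseˡ F.card

  -- With the monoid as a parameter, the same reindexing serves sums with values in F or in an
  -- F-algebra and the products behind Fermat's theorem.
  sumF : (F.Carrier → Carrier) → Carrier
  sumF r = sum (λ i → r (elem i))

  sumF-cong : ∀ {r r′} → (∀ x → r x ≈ r′ x) → sumF r ≈ sumF r′
  sumF-cong r≈r′ = sum-cong-≋ λ i → r≈r′ (elem i)

  sumF-∙ : ∀ r r′ → sumF (λ x → r x ∙ r′ x) ≈ sumF r ∙ sumF r′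
  sumF-∙ r r′ = ∑-distrib-+ (r ∘ elem) (r′ ∘ elem)

  sumF-constant : ∀ c → sumF (λ _ → c) ≈ q · c
  sumF-constant c = sum-replicate q

  sumF-reindex : ∀ (σ τ : F.Carrier → F.Carrier) → (∀ x → σ (τ x) ≡ x) → (∀ x → τ (σ x) ≡ x) →
                 ∀ r → sumF (r ∘ σ) ≈ sumF r
  sumF-reindex σ τ στ τσ r = ≈-trans
    (sum-cong-≋ λ i → reflexive (cong r (sym (elem-index (σ (elem i))))))
    (≈-sym (sum-permute (r ∘ elem) π))
    where
    conj : ∀ (σ τ : F.Carrier → F.Carrier) → (∀ x → σ (τ x) ≡ x) →
           ∀ i → index (σ (elem (index (τ (elem i))))) ≡ i
    conj σ τ στ i = trans (cong (index ∘ σ) (elem-index _)) (trans (cong index (στ _)) (index-elem i))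
    π : Permutation q q
    π = permutation (index ∘ σ ∘ elem) (index ∘ τ ∘ elem) (conj σ τ στ) (conj τ σ τσ)

  sum-single : ∀ {n} (i : Fin n) t → (∀ j → j ≢ i → t j ≈ ε) → sum t ≈ t i
  sum-single {suc n} Fin.zero t t≈ε =
    ≈-trans (∙-congˡ (≈-trans (sum-cong-≋ λ j → t≈ε (Fin.suc j) λ ()) (sum-replicate-zero n))) (identityʳ _)
  sum-single (Fin.suc i) t t≈ε =
    ≈-trans (∙-cong (t≈ε Fin.zero λ ()) (sum-single i (t ∘ Fin.suc) λ j j≢i → t≈ε (Fin.suc j) λ { refl → j≢i refl }))
            (identityˡ _)

  at : F.Carrier → Carrier → F.Carrier → Carrier
  at a c x = if does (x F.≟ a) then c else ε

  sumF-at : ∀ a c → sumF (at a c) ≈ c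
  sumF-at a c = ≈-trans (sum-single (index a) _ λ j j≢a → reflexive (off j j≢a)) (reflexive on)
    where
    on : at a c (elem (index a)) ≡ c
    on rewrite elem-index a | dec-true (a F.≟ a) refl = refl
    off : ∀ j → j ≢ index a → at a c (elem j) ≡ ε
    off j j≢a rewrite dec-false (elem j F.≟ a) (λ e → j≢a (trans (sym (index-elem j)) (cong index e))) = refl

-- Arithmetic of a finite field with q = d + 2 elements

module FieldFacts {d : ℕ} (F : FiniteField (suc (suc d))) where

  private module F = FiniteField F
  open ≡ using (refl; sym; trans)

  fieldRing : CommutativeRing 0ℓ 0ℓ
  fieldRing = record { isCommutativeRing = F.isCommutativeRing }

  open CommutativeRing fieldRing hiding (zero; refl; sym; trans) public
  open import Algebra.Properties.Semiring.Exp semiring using (_^_; ^-homo-*; ^-assocʳ) public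
  open import Algebra.Properties.CommutativeSemiring.Exp commutativeSemiring using (^-distrib-*)
  open import Algebra.Properties.Semiring.Mult semiring using () renaming (_×_ to _·_)
  open import Algebra.Properties.Ring ring
  open AntidiagonalSums fieldRing
  open IntegerCoefficientSolver fieldRing
  open SumsOverField F +-commutativeMonoid
  private module ∏ = SumsOverField F *-commutativeMonoid
  open import Algebra.Properties.CommutativeMonoid.Sum *-commutativeMonoid using () renaming (sum to product)
  open ≡.≡-Reasoning
  open import Algebra.Properties.Semiring.Sum semiring using (*-distribˡ-sum)

  _⁻¹ : ∀ {x} → x ≢ 0# → Carrier
  _⁻¹ {x} x≢0 = proj₁ (F.inverse x x≢0)

  ⁻¹-inverseˡ : ∀ {x} (x≢0 : x ≢ 0#) → (x≢0 ⁻¹) * x ≡ 1#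
  ⁻¹-inverseˡ {x} x≢0 = proj₂ (F.inverse x x≢0)

  ⁻¹-cancelˡ : ∀ {x} (x≢0 : x ≢ 0#) y → (x≢0 ⁻¹) * (x * y) ≡ y
  ⁻¹-cancelˡ x≢0 y = trans (sym (*-assoc _ _ y)) (trans (cong (_* y) (⁻¹-inverseˡ x≢0)) (*-identityˡ y))

  *-zero-cancelˡ : ∀ {x y} → x ≢ 0# → x * y ≡ 0# → y ≡ 0#
  *-zero-cancelˡ {x} {y} x≢0 xy≡0 = trans (sym (⁻¹-cancelˡ x≢0 y)) (trans (cong (_ *_) xy≡0) (zeroʳ _))

  *-cancelˡ : ∀ {x y z} → x ≢ 0# → x * y ≡ x * z → y ≡ z
  *-cancelˡ {x} {y} {z} x≢0 eq =
    trans (sym (⁻¹-cancelˡ x≢0 y)) (trans (cong (_ *_) eq) (⁻¹-cancelˡ x≢0 z))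

  *-nonzero : ∀ {x y} → x ≢ 0# → y ≢ 0# → x * y ≢ 0#
  *-nonzero x≢0 y≢0 xy≡0 = y≢0 (*-zero-cancelˡ x≢0 xy≡0)

  scale-sumF : ∀ {ε} → ε ≢ 0# → ∀ r → sumF (λ x → r (ε * x)) ≡ sumF r
  scale-sumF {ε} ε≢0 = sumF-reindex (ε *_) (ε≢0 ⁻¹ *_)
    (λ x → trans (sym (*-assoc _ _ x)) (trans (cong (_* x) (trans (*-comm _ _) (⁻¹-inverseˡ ε≢0))) (*-identityˡ x)))
    (⁻¹-cancelˡ ε≢0)

  -- Translation by 1 permutes the field, so Σ x = Σ (x + 1) = Σ x + Σ 1.
  sumF-1 : sumF (λ _ → 1#) ≡ 0#
  sumF-1 = begin
    ones                                   ≡⟨ solve 2 (λ s o → o := (s :+ o) :- s) refl (sumF (λ x → x)) ones ⟩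
    (sumF (λ x → x) + ones) - sumF (λ x → x) ≡⟨ cong (_- sumF (λ x → x)) shift ⟩
    sumF (λ x → x) - sumF (λ x → x)        ≡⟨ -‿inverseʳ _ ⟩
    0#                                     ∎
    where
    ones = sumF (λ _ → 1#)
    shift : sumF (λ x → x) + ones ≡ sumF (λ x → x)
    shift = trans (sym (sumF-∙ (λ x → x) (λ _ → 1#)))
      (sumF-reindex (_+ 1#) (_- 1#)
        (solve 1 (λ x → (x :- :1) :+ :1 := x) refl)
        (solve 1 (λ x → (x :+ :1) :- :1 := x) refl) (λ x → x))

  ∏-nonzero : ∀ {n} (t : Fin n → Carrier) → (∀ i → t i ≢ 0#) → product t ≢ 0#
  ∏-nonzero {zero}  t t≢0 = F.1≢0
  ∏-nonzero {suc n} t t≢0 = *-nonzero (t≢0 Fin.zero) (∏-nonzero (t ∘ Fin.suc) (t≢0 ∘ Fin.suc))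

  fermat : ∀ {ε} → ε ≢ 0# → ε ^ suc d ≡ 1#
  fermat {ε} ε≢0 = *-cancelˡ ε≢0 (begin
    ε ^ suc (suc d)                      ≡⟨ ∏.sumF-constant ε ⟨
    ∏.sumF (λ _ → ε)                     ≡⟨ ∏.sumF-cong split ⟩
    ∏.sumF (λ x → ∏.at 0# ε x * scale x) ≡⟨ ∏.sumF-∙ (∏.at 0# ε) scale ⟩
    ∏.sumF (∏.at 0# ε) * ∏.sumF scale    ≡⟨ cong₂ _*_ (∏.sumF-at 0# ε) ∏scale≡1 ⟩
    ε * 1#                               ∎)
    where
    -- Multiplication by ε permutes the factors of the product of all nonzero elements.
    unit scale : Carrier → Carrier
    unit  x = if does (x F.≟ 0#) then 1# else x
    scale x = if does (x F.≟ 0#) then 1# else ε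
    split : ∀ x → ε ≡ ∏.at 0# ε x * scale x
    split x with x F.≟ 0#
    ... | yes _ = sym (*-identityʳ ε)
    ... | no  _ = sym (*-identityˡ ε)
    unit≢0 : ∀ x → unit x ≢ 0#
    unit≢0 x with x F.≟ 0#
    ... | yes _  = F.1≢0
    ... | no x≢0 = x≢0
    unit-scale : ∀ x → unit (ε * x) ≡ unit x * scale x
    unit-scale x with x F.≟ 0#
    ... | yes refl rewrite dec-true ((ε * 0#) F.≟ 0#) (zeroʳ ε) = sym (*-identityˡ 1#)
    ... | no x≢0   rewrite dec-false ((ε * x) F.≟ 0#) (*-nonzero ε≢0 x≢0) = *-comm ε x
    ∏scale≡1 : ∏.sumF scale ≡ 1#
    ∏scale≡1 = *-cancelˡ (∏-nonzero (unit ∘ ∏.elem) (unit≢0 ∘ ∏.elem)) (begin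
      ∏.sumF unit * ∏.sumF scale          ≡⟨ ∏.sumF-∙ unit scale ⟨
      ∏.sumF (λ x → unit x * scale x)     ≡⟨ ∏.sumF-cong (sym ∘ unit-scale) ⟩
      ∏.sumF (λ x → unit (ε * x))         ≡⟨ ∏.sumF-reindex (ε *_) (ε≢0 ⁻¹ *_)
         (λ x → trans (sym (*-assoc _ _ x)) (trans (cong (_* x) (trans (*-comm _ _) (⁻¹-inverseˡ ε≢0))) (*-identityˡ x)))
         (⁻¹-cancelˡ ε≢0) unit ⟩
      ∏.sumF unit                         ≡⟨ *-identityʳ _ ⟨
      ∏.sumF unit * 1#                    ∎)

  1^ : ∀ n → 1# ^ n ≡ 1#
  1^ zero    = refl
  1^ (suc n) = trans (*-identityˡ _) (1^ n)

  fermat-∣ : ∀ {ε j} → ε ≢ 0# → suc d ∣ j → ε ^ j ≡ 1#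
  fermat-∣ {ε} {j} ε≢0 (divides k refl) = begin
    ε ^ (k ℕ.* suc d)   ≡⟨ cong (ε ^_) (ℕ.*-comm k (suc d)) ⟩
    ε ^ (suc d ℕ.* k)   ≡⟨ ^-assocʳ ε (suc d) k ⟨
    (ε ^ suc d) ^ k     ≡⟨ cong (_^ k) (fermat ε≢0) ⟩
    1# ^ k              ≡⟨ 1^ k ⟩
    1#                  ∎

  frobenius-fixed : ∀ x → x ^ suc (suc d) ≡ x
  frobenius-fixed x with x F.≟ 0#
  ... | yes refl = zeroˡ _
  ... | no x≢0   = trans (cong (x *_) (fermat x≢0)) (*-identityʳ x)

  -1^∣ : ∀ {j} → suc d ∣ j → (- 1#) ^ j ≡ 1#
  -1^∣ = fermat-∣ λ -1≡0 → F.1≢0 (trans (sym (-‿involutive 1#)) (trans (cong -_ -1≡0) -0#≈0#))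

  -- Polynomials over the field and their roots

  eval : ℕ → (ℕ → Carrier) → Carrier → Carrier
  eval zero    c x = c 0
  eval (suc n) c x = c 0 + x * eval n (c ∘ suc) x

  -- Coefficients of (c(x) - c(a)) / (x - a) for c of degree at most n + 1: the i-th is the value at
  -- a of c with its first i + 1 coefficients dropped.
  quotient : ℕ → (ℕ → Carrier) → Carrier → ℕ → Carrier
  quotient zero    c a _       = c 1
  quotient (suc n) c a zero    = eval (suc n) (c ∘ suc) a
  quotient (suc n) c a (suc i) = quotient n (c ∘ suc) a i

  eval-division : ∀ n c a x → eval (suc n) c x ≡ eval (suc n) c a + (x - a) * eval n (quotient n c a) x
  eval-division zero    c a x =
    solve 4 (λ c₀ c₁ a x → c₀ :+ x :* c₁ := c₀ :+ a :* c₁ :+ (x :- a) :* c₁) refl (c 0) (c 1) a x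
  eval-division (suc n) c a x = trans
    (cong (λ z → c 0 + x * z) (eval-division n (c ∘ suc) a x))
    (solve 5 (λ c₀ r e a x → c₀ :+ x :* (r :+ (x :- a) :* e) := c₀ :+ a :* r :+ (x :- a) :* (r :+ x :* e))
      refl (c 0) _ _ a x)

  quotient-zero : ∀ n c a → eval (suc n) c a ≡ 0# → (∀ i → i ℕ.≤ n → quotient n c a i ≡ 0#) →
                  ∀ i → i ℕ.≤ suc n → c i ≡ 0#
  quotient-zero zero c a root q≡0 zero _ = begin
    c 0            ≡⟨ solve 2 (λ c z → c := c :+ z :* :0) refl (c 0) a ⟩
    c 0 + a * 0#   ≡⟨ cong (λ z → c 0 + a * z) (q≡0 0 z≤n) ⟨
    c 0 + a * c 1  ≡⟨ root ⟩
    0#             ∎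
  quotient-zero zero c a root q≡0 (suc zero) _ = q≡0 0 z≤n
  quotient-zero zero c a root q≡0 (suc (suc i)) (s≤s ())
  quotient-zero (suc n) c a root q≡0 zero _ = begin
    c 0            ≡⟨ solve 2 (λ c z → c := c :+ z :* :0) refl (c 0) a ⟩
    c 0 + a * 0#   ≡⟨ cong (λ z → c 0 + a * z) (q≡0 0 z≤n) ⟨
    eval (suc (suc n)) c a ≡⟨ root ⟩
    0#             ∎
  -- Coefficient 0 of the quotient is the value of the tail `c ∘ suc` at a, so its vanishing makes a
  -- a root of the tail.
  quotient-zero (suc n) c a root q≡0 (suc i) (s≤s i≤n) =
    quotient-zero n (c ∘ suc) a (q≡0 0 z≤n) (λ i i≤n → q≡0 (suc i) (s≤s i≤n)) i i≤n

  -- Division by x - a, for the first root a, leaves a quotient that vanishes at the other roots,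
  -- because their differences from a are nonzero.
  root-bound : ∀ n c (f : Fin (suc n) → Carrier) → Injective _≡_ _≡_ f → (∀ i → eval n c (f i) ≡ 0#) →
               ∀ i → i ℕ.≤ n → c i ≡ 0#
  root-bound zero    c f inj roots zero z≤n = roots Fin.zero
  root-bound (suc n) c f inj roots = quotient-zero n c a (roots Fin.zero)
    (root-bound n (quotient n c a) (f ∘ Fin.suc) (λ eq → suc-injective (inj eq)) λ i →
      *-zero-cancelˡ (λ eq → 0≢suc (inj (sym (difference-zero eq)))) (begin
        (f (Fin.suc i) - a) * eval n (quotient n c a) (f (Fin.suc i))
          ≡⟨ trans (cong (_+ (f (Fin.suc i) - a) * eval n (quotient n c a) (f (Fin.suc i))) (roots Fin.zero)) (+-identityˡ _) ⟨
        eval (suc n) c a + (f (Fin.suc i) - a) * eval n (quotient n c a) (f (Fin.suc i))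
          ≡⟨ eval-division n c a (f (Fin.suc i)) ⟨
        eval (suc n) c (f (Fin.suc i))
          ≡⟨ roots (Fin.suc i) ⟩
        0# ∎))
    where
    a = f Fin.zero
    0≢suc : ∀ {i : Fin (suc n)} → Fin.zero ≢ Fin.suc i
    0≢suc ()
    suc-injective : ∀ {i j : Fin (suc n)} → Fin.suc i ≡ Fin.suc j → i ≡ j
    suc-injective refl = refl
    difference-zero : ∀ {x y} → x - y ≡ 0# → x ≡ y
    difference-zero {x} {y} eq =
      trans (solve 2 (λ x y → x := (x :- y) :+ y) refl x y) (trans (cong (_+ y) eq) (+-identityˡ y))

  eval-AD : ∀ n c x → eval n c x ≡ AD n (λ i j → c i * x ^ i)
  eval-AD zero    c x = sym (*-identityʳ _)
  eval-AD (suc n) c x = cong₂ _+_ (sym (*-identityʳ _)) (begin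
    x * eval n (c ∘ suc) x                  ≡⟨ cong (x *_) (eval-AD n (c ∘ suc) x) ⟩
    x * AD n (λ i j → c (suc i) * x ^ i)    ≡⟨ AD-*ˡ n x _ ⟩
    AD n (λ i j → x * (c (suc i) * x ^ i))  ≡⟨ AD-cong′ n (λ i j → solve 3 (λ x c z → x :* (c :* z) := c :* (x :* z)) refl x _ _) ⟩
    AD n (λ i j → c (suc i) * x ^ suc i)    ∎)

  eval-minus : ∀ n c c′ x → eval n (λ i → c i - c′ i) x ≡ eval n c x - eval n c′ x
  eval-minus zero    c c′ x = refl
  eval-minus (suc n) c c′ x = trans (cong (λ z → c 0 - c′ 0 + x * z) (eval-minus n (c ∘ suc) (c′ ∘ suc) x))
    (solve 5 (λ a b x y z → a :- b :+ x :* (y :- z) := (a :+ x :* y) :- (b :+ x :* z)) refl (c 0) (c′ 0) x _ _)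

  eval-injective : ∀ c c′ → (∀ x → eval (suc d) c x ≡ eval (suc d) c′ x) → ∀ i → i ℕ.≤ suc d → c i ≡ c′ i
  eval-injective c c′ eq i i≤d = trans (solve 2 (λ x y → x := (x :- y) :+ y) refl (c i) (c′ i)) (trans
    (cong (_+ c′ i) (root-bound (suc d) (λ i → c i - c′ i) elem elem-injective
      (λ j → trans (eval-minus (suc d) c c′ (elem j)) (trans (cong (_- eval (suc d) c′ (elem j)) (eq (elem j))) (-‿inverseʳ _))) i i≤d))
    (+-identityˡ _))
    where
    elem-injective : Injective _≡_ _≡_ elem
    elem-injective {i} {j} e = trans (sym (index-elem i)) (trans (cong index e) (index-elem j))

  monomial : ℕ → ℕ → Carrier
  monomial zero    zero    = 1#
  monomial zero    (suc i) = 0#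
  monomial (suc k) zero    = 0#
  monomial (suc k) (suc i) = monomial k i

  monomial-same : ∀ k → monomial k k ≡ 1#
  monomial-same zero    = refl
  monomial-same (suc k) = monomial-same k

  eval-0 : ∀ n x → eval n (λ _ → 0#) x ≡ 0#
  eval-0 zero    x = refl
  eval-0 (suc n) x = trans (+-identityˡ _) (trans (cong (x *_) (eval-0 n x)) (zeroʳ x))

  eval-monomial : ∀ {n k} → k ℕ.≤ n → ∀ x → eval n (monomial k) x ≡ x ^ k
  eval-monomial {zero}  {zero}  _ x = refl
  eval-monomial {suc n} {zero}  _ x =
    trans (cong (λ z → 1# + x * z) (eval-0 n x)) (solve 1 (λ x → :1 :+ x :* :0 := :1) refl x)
  eval-monomial {suc n} {suc k} (s≤s k≤n) x = trans (+-identityˡ _) (cong (x *_) (eval-monomial k≤n x))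

  -- Power sums over the field

  powerSum : ℕ → Carrier
  powerSum j = sumF (_^ j)

  -- Nonzero elements contribute 1 by Fermat and 0 contributes 0, so adding the indicator of 0 gives
  -- the sum of q ones, which is 0.
  powerSum-∣ : ∀ {j} → suc d ∣ suc j → powerSum (suc j) ≡ - 1#
  powerSum-∣ {j} d∣j = begin
    powerSum (suc j)               ≡⟨ solve 1 (λ s → s := (:1 :+ s) :- :1) refl _ ⟩
    (1# + powerSum (suc j)) - 1#   ≡⟨ cong (_- 1#) total ⟩
    0# - 1#                        ≡⟨ +-identityˡ _ ⟩
    - 1#                           ∎
    where
    indicator : ∀ x → at 0# 1# x + x ^ suc j ≡ 1#
    indicator x with x F.≟ 0#
    ... | yes refl = trans (cong (1# +_) (zeroˡ _)) (+-identityʳ 1#)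
    ... | no x≢0   = trans (+-identityˡ _) (fermat-∣ x≢0 d∣j)
    total : 1# + powerSum (suc j) ≡ 0#
    total = begin
      1# + powerSum (suc j)                ≡⟨ cong (_+ powerSum (suc j)) (sumF-at 0# 1#) ⟨
      sumF (at 0# 1#) + powerSum (suc j)   ≡⟨ sumF-∙ (at 0# 1#) (_^ suc j) ⟨
      sumF (λ x → at 0# 1# x + x ^ suc j)  ≡⟨ sumF-cong indicator ⟩
      sumF (λ _ → 1#)                      ≡⟨ sumF-1 ⟩
      0#                                   ∎

  -- Scaling the variable by ε ≠ 0 multiplies the sum by ε^(r+1). If the sum were nonzero, x^(r+2) =
  -- x would hold on the whole field, although these are distinct polynomials of degree less than q.
  powerSum-small : ∀ {r} → suc r ℕ.≤ d → powerSum (suc r) ≡ 0#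
  powerSum-small {r} r<d with powerSum (suc r) F.≟ 0#
  ... | yes s≡0 = s≡0
  ... | no s≢0  = ⊥-elim (F.1≢0 (sym (eval-injective (monomial (suc (suc r))) (monomial 1)
                     (λ x → trans (eval-monomial (s≤s r<d) x)
                            (trans (all-roots x) (sym (eval-monomial {suc d} (s≤s z≤n) x)))) 1 (s≤s z≤n))))
    where
    scaled : ∀ {ε} → ε ≢ 0# → powerSum (suc r) * ε ^ suc r ≡ powerSum (suc r) * 1#
    scaled {ε} ε≢0 = begin
      powerSum (suc r) * ε ^ suc r        ≡⟨ *-comm _ _ ⟩
      ε ^ suc r * powerSum (suc r)        ≡⟨ *-distribˡ-sum (ε ^ suc r) (λ i → elem i ^ suc r) ⟩
      sumF (λ x → ε ^ suc r * x ^ suc r)  ≡⟨ sumF-cong (λ x → ^-distrib-* ε x (suc r)) ⟨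
      sumF (λ x → (ε * x) ^ suc r)        ≡⟨ scale-sumF ε≢0 (_^ suc r) ⟩
      powerSum (suc r)                    ≡⟨ *-identityʳ _ ⟨
      powerSum (suc r) * 1#               ∎
    all-roots : ∀ x → x ^ suc (suc r) ≡ x ^ 1
    all-roots x with x F.≟ 0#
    ... | yes refl = trans (zeroˡ _) (sym (zeroˡ _))
    ... | no x≢0   = cong (x *_) (*-cancelˡ s≢0 (scaled x≢0))

  powerSum-∤ : ∀ {j} → ¬ suc d ∣ j → powerSum j ≡ 0#
  powerSum-∤ {j} d∤j with j % suc d in r≡
  ... | zero  = ⊥-elim (d∤j (m%n≡0⇒n∣m j (suc d) r≡))
  ... | suc r = trans (sumF-cong reduced) (powerSum-small (ℕ.≤-pred (subst (ℕ._< suc d) r≡ (m%n<n j (suc d)))))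
    where
    j≡ : j ≡ suc r ℕ.+ j / suc d ℕ.* suc d
    j≡ = subst (λ z → j ≡ z ℕ.+ j / suc d ℕ.* suc d) r≡ (m≡m%n+[m/n]*n j (suc d))
    reduced : ∀ x → x ^ j ≡ x ^ suc r
    reduced x with x F.≟ 0#
    ... | yes refl = trans (cong (0# ^_) j≡) (trans (zeroˡ _) (sym (zeroˡ _)))
    ... | no x≢0   = begin
      x ^ j                                    ≡⟨ cong (x ^_) j≡ ⟩
      x ^ (suc r ℕ.+ j / suc d ℕ.* suc d)      ≡⟨ ^-homo-* x (suc r) _ ⟩
      x ^ suc r * x ^ (j / suc d ℕ.* suc d)    ≡⟨ cong (x ^ suc r *_) (fermat-∣ x≢0 (divides (j / suc d) refl)) ⟩
      x ^ suc r * 1#                           ≡⟨ *-identityʳ _ ⟩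
      x ^ suc r                                ∎

  -- The coefficients of (x + 1)^q − x^q, of degree less than q, are those of
  -- the constant 1, since both agree on all of 𝔽_q.
  q-choose-vanishes : ∀ i → suc i ℕ.≤ suc d → (suc (suc d) C suc i) · 1# ≡ 0#
  q-choose-vanishes i i<q = eval-injective (λ i → (q C i) · 1#) (monomial 0)
    (λ x → trans (value x) (sym (eval-monomial {suc d} z≤n x))) (suc i) i<q
    where
    q = suc (suc d)
    open import Data.Nat.Combinatorics using (nCn≡1)
    value : ∀ x → eval (suc d) (λ i → (q C i) · 1#) x ≡ 1#
    value x = begin
      eval (suc d) (λ i → (q C i) · 1#) x
        ≡⟨ eval-AD (suc d) (λ i → (q C i) · 1#) x ⟩
      E
        ≡⟨ solve 2 (λ e x → e := (e :+ x) :- x) refl E x ⟩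
      (E + x) - x
        ≡⟨ cong (λ z → (E + z) - x) top ⟨
      (E + (q C q) · 1# * x ^ q) - x
        ≡⟨ cong (_- x) (AD-last (suc d) (λ i j → (q C i) · 1# * x ^ i)) ⟨
      AD q (λ i j → (q C i) · 1# * x ^ i) - x
        ≡⟨ cong (_- x) (AD-cong′ q (λ i j → cong ((q C i) · 1# *_) (trans (cong (x ^ i *_) (1^ j)) (*-identityʳ _)))) ⟨
      AD q (λ i j → (q C i) · 1# * (x ^ i * 1# ^ j)) - x
        ≡⟨ cong (_- x) (binomial-AD 0 q x 1#) ⟩
      1# * (x + 1#) ^ q - x
        ≡⟨ cong (λ z → 1# * z - x) (frobenius-fixed (x + 1#)) ⟩
      1# * (x + 1#) - x
        ≡⟨ solve 1 (λ x → :1 :* (x :+ :1) :- x := :1) refl x ⟩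
      1# ∎
      where
      E = AD (suc d) (λ i j → (q C i) · 1# * x ^ i)
      top : (q C q) · 1# * x ^ q ≡ x
      top = trans (cong₂ (λ n z → n · 1# * z) (nCn≡1 q) (frobenius-fixed x))
                  (solve 1 (λ x → (:1 :+ :0) :* x := x) refl x)

-- Coefficients of diamond products of letters

module TripleProduct {d : ℕ} (F : FiniteField (suc (suc d))) where
  open FieldFacts F
  open AntidiagonalSums fieldRing

  Coefficient : Set
  Coefficient = Carrier

  -- Weights are stored as predecessors, except that the weight j of the second
  -- letter is stored as such, j = 0 standing for a missing second letter.
  A : ℕ → ℕ → ℕ → Carrier
  A zero    a b = 1#
  A (suc j) a b = Δ F (suc j) (suc a) (suc b)

  -- Expands x_{a+1} ⋄ x_{b+1} in front of a word: i + 1 is the weight of the new first letter, and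
  -- j = 0 gives the leading term x_{a+b+2}.
  D : ℕ → ℕ → (ℕ → ℕ → Carrier) → Carrier
  D a b f = AD (suc (a ℕ.+ b)) (λ i j → A j a b * f i j)

  -- Value of x_l ⧢ x_j ⧢ M, where weight 0 means no letter. The parameters are the values on M, on
  -- one letter ⧢ M and on a two-letter word ⧢ M; the last clause writes out the shuffle of x_{l+1}
  -- and x_{j+1}.
  inner : Carrier → (ℕ → Carrier) → (ℕ → ℕ → Carrier) → ℕ → ℕ → Carrier
  inner h₀ h₁ h₂ zero    zero    = h₀
  inner h₀ h₁ h₂ zero    (suc j) = h₁ j
  inner h₀ h₁ h₂ (suc l) zero    = h₁ l
  inner h₀ h₁ h₂ (suc l) (suc j) =
    h₂ l j + h₂ j l + (h₁ (suc (l ℕ.+ j)) + AD (l ℕ.+ j) (λ m n → Δ F (suc n) (suc l) (suc j) * h₂ m n))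

  -- Value of (x_{a+1} ⋄ x_{b+1}) ⋄ x_{c+1}. The first product leaves an inner letter of weight j,
  -- the second an inner letter of weight l, and both act on the remaining word.
  triple : (ℕ → Carrier) → (ℕ → ℕ → Carrier) → (ℕ → ℕ → ℕ → Carrier) → ℕ → ℕ → ℕ → Carrier
  triple f₀ f₁ f₂ a b c = D a b (λ i j → D i c (λ k l → inner (f₀ k) (f₁ k) (f₂ k) l j))

  Δ-sym : ∀ j r s → Δ F j r s ≡ Δ F j s r
  Δ-sym j r s with suc d ∣? j
  ... | yes _ = +-comm _ _
  ... | no  _ = ≡.refl

  inner-sym : ∀ h₀ h₁ h₂ l j → inner h₀ h₁ h₂ l j ≡ inner h₀ h₁ h₂ j l
  inner-sym h₀ h₁ h₂ zero    zero    = ≡.refl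
  inner-sym h₀ h₁ h₂ zero    (suc j) = ≡.refl
  inner-sym h₀ h₁ h₂ (suc l) zero    = ≡.refl
  inner-sym h₀ h₁ h₂ (suc l) (suc j) rewrite ℕ.+-comm l j =
    ≡.cong₂ _+_ (+-comm _ _) (≡.cong (h₁ _ +_) (AD-cong′ (j ℕ.+ l) λ m n → ≡.cong (_* h₂ m n) (Δ-sym (suc n) (suc l) (suc j))))

-- The variables of the generating functions are arbitrary elements of such an algebra, so that sums
-- and differences of variables can be substituted freely.
record FieldAlgebra {d : ℕ} (F : FiniteField (suc (suc d))) : Set₁ where
  private module F = CommutativeRing (FieldFacts.fieldRing F)
  field
    ring : CommutativeRing 0ℓ 0ℓ
  open CommutativeRing ring
  field
    φ   : F.Carrier → Carrier
    φ-+ : ∀ a b → φ (a F.+ b) ≈ φ a + φ b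
    φ-* : ∀ a b → φ (a F.* b) ≈ φ a * φ b
    φ-1 : φ F.1# ≈ 1#

-- The identity for P, one coefficient at a time

module KeyIdentity {d : ℕ} {F : FiniteField (suc (suc d))} (𝕂 : FieldAlgebra F) where

  open FieldAlgebra 𝕂 using (φ; φ-+; φ-*; φ-1) renaming (ring to K)
  private
    module F = FieldFacts F
    module F₁ = FiniteField F
    module ADF = AntidiagonalSums F.fieldRing
    module Fmult where
      open import Algebra.Properties.Semiring.Mult F.semiring public using () renaming (_×_ to _·_)
      open import Algebra.Properties.CommutativeMonoid.Sum F.+-commutativeMonoid public using (sum)
  open CommutativeRing K hiding (zero)
  open import Algebra.Properties.Semiring.Exp semiring using (_^_; ^-homo-*; ^-congˡ)
  open import Algebra.Properties.CommutativeSemiring.Exp commutativeSemiring using (^-distrib-*)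
  open import Algebra.Properties.Semiring.Mult semiring using (×-congˡ) renaming (_×_ to _·_)
  open import Algebra.Properties.Semiring.Sum semiring using (sum; *-distribˡ-sum)
  open import Algebra.Properties.Ring ring using (-1*x≈-x; -0#≈0#)
  open import Relation.Binary.Reasoning.Setoid setoid
  open AntidiagonalSums K
  open IntegerCoefficientSolver K
  open SumsOverField F +-commutativeMonoid

  φ-cong : ∀ {a b} → a ≡ b → φ a ≈ φ b
  φ-cong eq = reflexive (≡.cong φ eq)

  φ-0 : φ F.0# ≈ 0#
  φ-0 = begin
    φ F.0#                          ≈⟨ solve 1 (λ z → z := (z :+ z) :- z) refl (φ F.0#) ⟩
    (φ F.0# + φ F.0#) - φ F.0#      ≈⟨ +-congʳ (φ-+ F.0# F.0#) ⟨
    φ (F.0# F.+ F.0#) - φ F.0#      ≈⟨ +-congʳ (φ-cong (F.+-identityˡ F.0#)) ⟩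
    φ F.0# - φ F.0#                 ≈⟨ -‿inverseʳ _ ⟩
    0#                              ∎

  φ-neg : ∀ a → φ (F.- a) ≈ - φ a
  φ-neg a = begin
    φ (F.- a)                       ≈⟨ solve 2 (λ x y → x := (x :+ y) :- y) refl (φ (F.- a)) (φ a) ⟩
    (φ (F.- a) + φ a) - φ a         ≈⟨ +-congʳ (trans (sym (φ-+ (F.- a) a)) (trans (φ-cong (F.-‿inverseˡ a)) φ-0)) ⟩
    0# - φ a                        ≈⟨ +-identityˡ _ ⟩
    - φ a                           ∎

  φ-^ : ∀ a n → φ (a F.^ n) ≈ φ a ^ n
  φ-^ a zero    = φ-1
  φ-^ a (suc n) = trans (φ-* _ _) (*-congˡ (φ-^ a n))

  φ-· : ∀ n → φ (n Fmult.· F.1#) ≈ n · 1#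
  φ-· zero    = φ-0
  φ-· (suc n) = trans (φ-+ _ _) (+-cong φ-1 (φ-· n))

  φ-sum : ∀ {n} (t : Fin n → F.Carrier) → φ (Fmult.sum t) ≈ sum (φ ∘ t)
  φ-sum {zero}  t = φ-0
  φ-sum {suc n} t = trans (φ-+ _ _) (+-congˡ (φ-sum (t ∘ Fin.suc)))

  φ-AD : ∀ n f → φ (ADF.AD n f) ≈ AD n (λ i j → φ (f i j))
  φ-AD zero    f = refl
  φ-AD (suc n) f = trans (φ-+ _ _) (+-congˡ (φ-AD n _))

  φ-ι : ∀ n → φ (ι F n) ≈ n · 1#
  φ-ι zero    = φ-0
  φ-ι (suc n) = trans (φ-+ _ _) (+-cong φ-1 (φ-ι n))

  φ-sgn : ∀ n → φ (sgn F n) ≈ (- 1#) ^ n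
  φ-sgn zero    = φ-1
  φ-sgn (suc n) = trans (φ-neg _) (trans (sym (-1*x≈-x _)) (*-congˡ (φ-sgn n)))

  -- As a factor in the algebra, the condition (q - 1) | j can be carried through sums; `δ-guard`
  -- uses it to rewrite the cofactor.
  δ : ℕ → Carrier
  δ j = if does (suc d ∣? j) then 1# else 0#

  δ-∣ : ∀ {j} → suc d ∣ j → δ j ≈ 1#
  δ-∣ {j} d∣j rewrite dec-true (suc d ∣? j) d∣j = refl

  δ-∤ : ∀ {j} → ¬ suc d ∣ j → δ j ≈ 0#
  δ-∤ {j} d∤j rewrite dec-false (suc d ∣? j) d∤j = refl

  δ-guard : ∀ j {x y} → (suc d ∣ j → x ≈ y) → δ j * x ≈ δ j * y
  δ-guard j eq with suc d ∣? j
  ... | yes d∣j = *-congˡ (eq d∣j)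
  ... | no  d∤j = trans (vanish _) (sym (vanish _))
    where
    vanish : ∀ x → δ j * x ≈ 0#
    vanish x = trans (*-congʳ (δ-∤ d∤j)) (zeroˡ x)

  δ-∣+ : ∀ i j {n} → i ℕ.+ j ≡ n → suc d ∣ n → δ i * δ j ≈ δ i
  δ-∣+ i j ≡.refl d∣n = trans (δ-guard i (λ d∣i → δ-∣ (∣m+n∣m⇒∣n d∣n d∣i))) (*-identityʳ _)

  δ-∤+ : ∀ i j {n} → i ℕ.+ j ≡ n → ¬ suc d ∣ n → δ i * δ j ≈ 0#
  δ-∤+ i j ≡.refl d∤n = trans (δ-guard i {y = 0#} (λ d∣i → δ-∤ (λ d∣j → d∤n (∣m∣n⇒∣m+n d∣i d∣j)))) (zeroʳ _)

  -- Fermat applied to -1 covers even and odd q alike.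
  -1^-even : ∀ {j} → suc d ∣ j → (- 1#) ^ j ≈ 1#
  -1^-even {j} d∣j = begin
    (- 1#) ^ j          ≈⟨ ^-congˡ j (trans (-‿cong (sym φ-1)) (sym (φ-neg F.1#))) ⟩
    φ (F.- F.1#) ^ j    ≈⟨ φ-^ _ j ⟨
    φ ((F.- F.1#) F.^ j) ≈⟨ φ-cong (F.-1^∣ d∣j) ⟩
    φ F.1#              ≈⟨ φ-1 ⟩
    1#                  ∎

  -1^-odd : ∀ {j} → suc d ∣ suc j → (- 1#) ^ j ≈ - 1#
  -1^-odd {j} d∣j = begin
    (- 1#) ^ j              ≈⟨ solve 1 (λ x → x := :- (:- :1 :* x)) refl _ ⟩
    - ((- 1#) ^ suc j)      ≈⟨ -‿cong (-1^-even d∣j) ⟩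
    - 1#                    ∎

  neg-^ : ∀ x n → (- x) ^ n ≈ (- 1#) ^ n * x ^ n
  neg-^ x n = trans (^-congˡ n (sym (-1*x≈-x x))) (^-distrib-* (- 1#) x n)

  neg-^-odd : ∀ {j} → suc d ∣ suc j → ∀ x → (- x) ^ j ≈ - (x ^ j)
  neg-^-odd {j} d∣j x = trans (neg-^ x j) (trans (*-congʳ (-1^-odd d∣j)) (-1*x≈-x _))

  neg-^-even : ∀ {j} → suc d ∣ j → ∀ x → (- x) ^ j ≈ x ^ j
  neg-^-even {j} d∣j x = trans (neg-^ x j) (trans (*-congʳ (-1^-even d∣j)) (*-identityˡ _))

  φ-Δ : ∀ j r s → φ (Δ F (suc j) (suc r) (suc s)) ≈
                  δ (suc j) * ((- 1#) ^ r * (j C r) · 1# + (- 1#) ^ s * (j C s) · 1#)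
  φ-Δ j r s with suc d ∣? suc j
  ... | yes d∣j = trans (φ-+ _ _) (trans (+-cong (term r) (term s)) (sym (trans (*-congʳ (δ-∣ d∣j)) (*-identityˡ _))))
    where
    term : ∀ r → φ (sgn F r F.* ι F (j C r)) ≈ (- 1#) ^ r * (j C r) · 1#
    term r = trans (φ-* _ _) (*-cong (φ-sgn r) (φ-ι (j C r)))
  ... | no  d∤j = trans φ-0 (sym (trans (*-congʳ (δ-∤ d∤j)) (zeroˡ _)))

  φ-powerSum : ∀ j → φ (F.powerSum (suc j)) ≈ - δ (suc j)
  φ-powerSum j with suc d ∣? suc j
  ... | yes d∣j = trans (φ-cong (F.powerSum-∣ d∣j)) (trans (φ-neg _) (-‿cong (trans φ-1 (sym (δ-∣ d∣j)))))
  ... | no  d∤j = trans (φ-cong (F.powerSum-∤ d∤j)) (trans φ-0 (sym (trans (-‿cong (δ-∤ d∤j)) -0#≈0#)))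

  -- The inner binomial coefficients of exponent q vanish in F, and `φ` carries this to the algebra.
  frobenius : ∀ u v → (u + v) ^ suc (suc d) ≈ u ^ suc (suc d) + v ^ suc (suc d)
  frobenius u v = begin
    (u + v) ^ q
      ≈⟨ trans (sym (*-identityˡ _)) (sym (binomial-AD 0 q u v)) ⟩
    AD q f
      ≈⟨ AD-ends d f ⟩
    f 0 q + AD d (λ i j → f (suc i) (suc j)) + f q 0
      ≈⟨ +-cong (+-congˡ (AD-0 d λ i j eq → trans (*-congʳ (inside i (≡.subst (i ℕ.≤_) eq (ℕ.m≤m+n i j)))) (zeroˡ _)))
                (*-congʳ (×-congˡ {x = 1#} (nCn≡1 q))) ⟩
    f 0 q + 0# + 1 · 1# * (u ^ q * v ^ 0)
      ≈⟨ solve 2 (λ x y → (:1 :+ :0) :* (:1 :* y) :+ :0 :+ (:1 :+ :0) :* (x :* :1) := x :+ y) refl (u ^ q) (v ^ q) ⟩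
    u ^ q + v ^ q ∎
    where
    q = suc (suc d)
    f : ℕ → ℕ → Carrier
    f i j = (q C i) · 1# * (u ^ i * v ^ j)
    inside : ∀ i → i ℕ.≤ d → (q C suc i) · 1# ≈ 0#
    inside i i≤d = trans (sym (φ-· (q C suc i))) (trans (φ-cong (F.q-choose-vanishes i (s≤s i≤d))) φ-0)

  -- For n > 0, the factor with which the single letter x_n occurs in uP(u) · vP(v).
  H : ℕ → Carrier → Carrier → Carrier
  H n u v = AD n (λ j l → δ j * δ l * (u ^ j * v ^ l))

  H-∤ : ∀ {n} → ¬ suc d ∣ n → ∀ u v → H n u v ≈ 0#
  H-∤ {n} d∤n u v = AD-0 n λ j l eq → trans (*-congʳ (δ-∤+ j l eq d∤n)) (zeroˡ _)

  H-sym : ∀ n u v → H n u v ≈ H n v u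
  H-sym n u v = trans (AD-comm n _) (AD-cong′ n λ j l → *-cong (*-comm _ _) (*-comm _ _))

  δ-shift : ∀ j → δ (suc d ℕ.+ j) ≈ δ j
  δ-shift j with suc d ∣? j
  ... | yes d∣j = trans (δ-∣ (∣m∣n⇒∣m+n ∣-refl d∣j)) (sym (δ-∣ d∣j))
  ... | no  d∤j = trans (δ-∤ (λ d∣j → d∤j (∣m+n∣m⇒∣n d∣j ∣-refl))) (sym (δ-∤ d∤j))

  -- The summand j = 0 stands alone, those with 0 < j < q - 1 vanish, and shifting the remaining j
  -- by q - 1 splits off u^(q-1).
  H-step : ∀ n u v → H (suc d ℕ.+ n) u v ≈ δ (suc d ℕ.+ n) * v ^ (suc d ℕ.+ n) + u ^ suc d * H n u v
  H-step n u v = +-cong first (trans (AD-skip d n _ skipped) (trans (AD-cong′ n rest) (sym (AD-*ˡ n _ _))))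
    where
    first : δ 0 * δ (suc d ℕ.+ n) * (1# * v ^ (suc d ℕ.+ n)) ≈ δ (suc d ℕ.+ n) * v ^ (suc d ℕ.+ n)
    first = trans (*-congʳ (*-congʳ (δ-∣ (suc d ∣0))))
                  (solve 2 (λ x y → :1 :* x :* (:1 :* y) := x :* y) refl _ _)
    skipped : ∀ i j → i ℕ.< d → δ (suc i) * δ j * (u ^ suc i * v ^ j) ≈ 0#
    skipped i j i<d = trans (*-congʳ (trans (*-congʳ (δ-∤ λ d∣i → ℕ.<⇒≱ i<d (ℕ.≤-pred (∣⇒≤ d∣i)))) (zeroˡ _))) (zeroˡ _)
    rest : ∀ i j → δ (suc d ℕ.+ i) * δ j * (u ^ (suc d ℕ.+ i) * v ^ j) ≈ u ^ suc d * (δ i * δ j * (u ^ i * v ^ j))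
    rest i j = trans (*-cong (*-congʳ (δ-shift i)) (*-congʳ (^-homo-* u (suc d) i)))
      (solve 5 (λ a b x y z → a :* b :* (x :* y :* z) := x :* (a :* b :* (y :* z))) refl _ _ _ _ _)

  -- Both sides vanish unless (q - 1) | n, so n grows in steps of q - 1. Expanding u H and v H by
  -- `H-step` from opposite sides produces (u^q + v^q) H, which Frobenius turns into (u + v)^(q-1)
  -- times the left-hand side of the previous step.
  H-key : ∀ n u v → (u + v) * H n u v ≈ v * H n u (u + v) + u * H n v (u + v)
  H-key n u v with suc d ∣? n
  ... | no  d∤n = trans (*-congˡ (H-∤ d∤n u v)) (trans (solve 2 (λ x y → (x :+ y) :* :0 := y :* :0 :+ x :* :0) refl u v)
                    (sym (+-cong (*-congˡ (H-∤ d∤n u (u + v))) (*-congˡ (H-∤ d∤n v (u + v))))))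
  ... | yes (divides k ≡.refl) = multiple k
    where
    w = u + v
    multiple : ∀ k → w * H (k ℕ.* suc d) u v ≈ v * H (k ℕ.* suc d) u w + u * H (k ℕ.* suc d) v w
    multiple zero    = solve 3 (λ x y z → (x :+ y) :* z := y :* z :+ x :* z) refl u v _
    multiple (suc k) = begin
      w * H (suc d ℕ.+ n′) u v
        ≈⟨ distribʳ _ u v ⟩
      u * H (suc d ℕ.+ n′) u v + v * H (suc d ℕ.+ n′) u v
        ≈⟨ +-cong (*-congˡ (H-step n′ u v)) (*-congˡ (trans (H-sym (suc d ℕ.+ n′) u v) (trans (H-step n′ v u) (+-congˡ (*-congˡ (H-sym n′ v u)))))) ⟩
      u * (e * V + u ^ suc d * h) + v * (e * U + v ^ suc d * h)
        ≈⟨ solve 8 (λ u v e U V u′ v′ h → u :* (e :* V :+ u′ :* h) :+ v :* (e :* U :+ v′ :* h)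
                   := e :* (v :* U :+ u :* V) :+ (u :* u′ :+ v :* v′) :* h) refl u v e U V (u ^ suc d) (v ^ suc d) h ⟩
      e * (v * U + u * V) + (u ^ suc (suc d) + v ^ suc (suc d)) * h
        ≈⟨ +-congˡ (*-congʳ (frobenius u v)) ⟨
      e * (v * U + u * V) + w * w ^ suc d * h
        ≈⟨ +-congˡ (solve 3 (λ x y z → x :* y :* z := y :* (x :* z)) refl _ _ _) ⟩
      e * (v * U + u * V) + w ^ suc d * (w * h)
        ≈⟨ +-congˡ (*-congˡ (multiple k)) ⟩
      e * (v * U + u * V) + w ^ suc d * (v * H n′ u w + u * H n′ v w)
        ≈⟨ solve 8 (λ u v e U V w′ a b → e :* (v :* U :+ u :* V) :+ w′ :* (v :* a :+ u :* b)
                   := v :* (e :* U :+ w′ :* a) :+ u :* (e :* V :+ w′ :* b)) refl u v e U V _ _ _ ⟩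
      v * (e * U + w ^ suc d * H n′ u w) + u * (e * V + w ^ suc d * H n′ v w)
        ≈⟨ +-cong (*-congˡ (swap u)) (*-congˡ (swap v)) ⟨
      v * H (suc d ℕ.+ n′) u w + u * H (suc d ℕ.+ n′) v w ∎
      where
      n′ = k ℕ.* suc d
      e = δ (suc d ℕ.+ n′)
      U = u ^ (suc d ℕ.+ n′)
      V = v ^ (suc d ℕ.+ n′)
      h = H n′ u v
      swap : ∀ x → H (suc d ℕ.+ n′) x w ≈ e * x ^ (suc d ℕ.+ n′) + w ^ suc d * H n′ x w
      swap x = trans (H-sym (suc d ℕ.+ n′) x w) (trans (H-step n′ w x) (+-congˡ (*-congˡ (H-sym n′ w x))))

  sumF-*ˡ : ∀ c r → c * sumF r ≈ sumF (λ ε → c * r ε)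
  sumF-*ˡ c r = *-distribˡ-sum c (λ i → r (elem i))

  sumF-neg : ∀ r → sumF (λ ε → - r ε) ≈ - sumF r
  sumF-neg r = trans (sumF-cong λ ε → sym (-1*x≈-x (r ε))) (trans (sym (sumF-*ˡ (- 1#) r)) (-1*x≈-x _))

  Φ : ℕ → Carrier → Carrier → Carrier
  Φ n u v = sumF (λ ε → (v + φ ε * u) ^ n)

  Φ-translate : ∀ n u v → Φ n u (u + v) ≈ Φ n u v
  Φ-translate n u v = begin
    sumF (λ ε → ((u + v) + φ ε * u) ^ n)   ≈⟨ sumF-cong (λ ε → ^-congˡ n (begin
      (u + v) + φ ε * u         ≈⟨ solve 3 (λ u v e → u :+ v :+ e :* u := v :+ (e :+ :1) :* u) refl u v (φ ε) ⟩
      v + (φ ε + 1#) * u        ≈⟨ +-congˡ (*-congʳ (trans (+-congˡ (sym φ-1)) (sym (φ-+ _ _)))) ⟩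
      v + φ (ε F.+ F.1#) * u    ∎)) ⟩
    sumF (λ ε → (v + φ (ε F.+ F.1#) * u) ^ n)
      ≈⟨ sumF-reindex (F._+ F.1#) (F._- F.1#)
           (SF.solve 1 (λ x → (x SF.:- SF.:1) SF.:+ SF.:1 SF.:= x) ≡.refl)
           (SF.solve 1 (λ x → (x SF.:+ SF.:1) SF.:- SF.:1 SF.:= x) ≡.refl)
           (λ ε → (v + φ ε * u) ^ n) ⟩
    Φ n u v ∎
    where module SF = IntegerCoefficientSolver F.fieldRing

  -- The involution ε ↦ -(1 + ε) sends v + ε(u + v) to -(u + ε(u + v)), and the n-th power keeps the
  -- sign because (q - 1) | n + 1.
  Φ-reflect : ∀ {n} → suc d ∣ suc n → ∀ u v → Φ n (u + v) v ≈ - Φ n (u + v) u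
  Φ-reflect {n} d∣n u v = begin
    sumF (λ ε → (v + φ ε * w) ^ n)
      ≈⟨ sumF-reindex reflect reflect involutive involutive (λ ε → (v + φ ε * w) ^ n) ⟨
    sumF (λ ε → (v + φ (reflect ε) * w) ^ n)
      ≈⟨ sumF-cong (λ ε → trans (^-congˡ n (negated ε)) (neg-^-odd d∣n (u + φ ε * w))) ⟩
    sumF (λ ε → - ((u + φ ε * w) ^ n))
      ≈⟨ sumF-neg (λ ε → (u + φ ε * w) ^ n) ⟩
    - Φ n w u ∎
    where
    module SF = IntegerCoefficientSolver F.fieldRing
    w = u + v
    reflect : F.Carrier → F.Carrier
    reflect ε = F.- (F.1# F.+ ε)
    involutive : ∀ ε → reflect (reflect ε) ≡ ε
    involutive = SF.solve 1 (λ x → SF.:- (SF.:1 SF.:+ SF.:- (SF.:1 SF.:+ x)) SF.:= x) ≡.refl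
    negated : ∀ ε → v + φ (reflect ε) * w ≈ - (u + φ ε * w)
    negated ε = begin
      v + φ (reflect ε) * w     ≈⟨ +-congˡ (*-congʳ (trans (φ-neg _) (-‿cong (trans (φ-+ _ _) (+-congʳ φ-1))))) ⟩
      v + - (1# + φ ε) * w      ≈⟨ solve 3 (λ u v e → v :+ :- (:1 :+ e) :* (u :+ v) := :- (u :+ e :* (u :+ v))) refl u v (φ ε) ⟩
      - (u + φ ε * w)           ∎

  -- ε^m is the indicator of ε ≠ 0, as (q − 1) ∣ m.
  Φ-split : ∀ {m} → suc d ∣ suc m → ∀ n u v →
            Φ n u v ≈ v ^ n + sumF (λ ε → φ ε ^ suc m * (v + φ ε * u) ^ n)
  Φ-split {m} d∣m n u v = trans (sumF-cong split) (trans (sumF-∙ (at F.0# (v ^ n)) (λ ε → φ ε ^ suc m * (v + φ ε * u) ^ n)) (+-congʳ (sumF-at F.0# (v ^ n))))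
    where
    split : ∀ ε → (v + φ ε * u) ^ n ≈ at F.0# (v ^ n) ε + φ ε ^ suc m * (v + φ ε * u) ^ n
    split ε with ε F₁.≟ F.0#
    ... | yes ≡.refl = begin
      (v + φ F.0# * u) ^ n       ≈⟨ ^-congˡ n (trans (+-congˡ (trans (*-congʳ φ-0) (zeroˡ u))) (+-identityʳ v)) ⟩
      v ^ n                      ≈⟨ +-identityʳ _ ⟨
      v ^ n + 0#                 ≈⟨ +-congˡ (trans (*-congʳ (trans (*-congʳ φ-0) (zeroˡ _))) (zeroˡ _)) ⟨
      v ^ n + φ F.0# ^ suc m * (v + φ F.0# * u) ^ n ∎
    ... | no ε≢0 = begin
      (v + φ ε * u) ^ n                        ≈⟨ trans (*-congʳ φ-1) (*-identityˡ _) ⟨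
      φ F.1# * (v + φ ε * u) ^ n               ≈⟨ *-congʳ (trans (φ-cong (≡.sym (F.fermat-∣ ε≢0 d∣m))) (φ-^ ε (suc m))) ⟩
      φ ε ^ suc m * (v + φ ε * u) ^ n          ≈⟨ +-identityˡ _ ⟨
      0# + φ ε ^ suc m * (v + φ ε * u) ^ n     ∎

  B : ℕ → ℕ → Carrier → Carrier → Carrier
  B m n u v = AD (m ℕ.+ n) (λ l j → (n C l) · 1# * δ (suc j) * (v ^ suc l * u ^ suc j))

  -- The factor ε^(m+1) from `Φ-split` joins u^(m+1), so the binomial expansion has only positive
  -- powers ε^(j+1), and summing these over the field gives -δ. This is the origin of `B`.
  Φ-expand : ∀ {m} → suc d ∣ suc m → ∀ n u v → u ^ suc m * v * Φ n u v ≈ u ^ suc m * v ^ suc n - B m n u v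
  Φ-expand {m} d∣m n u v = begin
    u ^ suc m * v * Φ n u v
      ≈⟨ *-congˡ (Φ-split d∣m n u v) ⟩
    u ^ suc m * v * (v ^ n + sumF (λ ε → φ ε ^ suc m * (v + φ ε * u) ^ n))
      ≈⟨ solve 4 (λ a v b s → a :* v :* (b :+ s) := a :* (v :* b) :+ a :* v :* s) refl _ v _ _ ⟩
    u ^ suc m * v ^ suc n + u ^ suc m * v * sumF (λ ε → φ ε ^ suc m * (v + φ ε * u) ^ n)
      ≈⟨ +-congˡ (begin
         u ^ suc m * v * sumF (λ ε → φ ε ^ suc m * (v + φ ε * u) ^ n)
           ≈⟨ sumF-*ˡ _ (λ ε → φ ε ^ suc m * (v + φ ε * u) ^ n) ⟩
         sumF (λ ε → u ^ suc m * v * (φ ε ^ suc m * (v + φ ε * u) ^ n))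
           ≈⟨ sumF-cong expand ⟩
         sumF (λ ε → AD (m ℕ.+ n) (λ l j → c l j * φ ε ^ suc j))
           ≈⟨ sum-AD (m ℕ.+ n) (λ l j i → c l j * φ (elem i) ^ suc j) ⟩
         AD (m ℕ.+ n) (λ l j → sumF (λ ε → c l j * φ ε ^ suc j))
           ≈⟨ AD-cong′ (m ℕ.+ n) (λ l j → power l j) ⟩
         AD (m ℕ.+ n) (λ l j → - 1# * ((n C l) · 1# * δ (suc j) * (v ^ suc l * u ^ suc j)))
           ≈⟨ AD-*ˡ (m ℕ.+ n) (- 1#) _ ⟨
         - 1# * B m n u v
           ≈⟨ -1*x≈-x _ ⟩
         - B m n u v ∎) ⟩
    u ^ suc m * v ^ suc n - B m n u v ∎
    where
    c : ℕ → ℕ → Carrier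
    c l j = (n C l) · 1# * (v ^ suc l * u ^ suc j)
    expand : ∀ ε → u ^ suc m * v * (φ ε ^ suc m * (v + φ ε * u) ^ n) ≈ AD (m ℕ.+ n) (λ l j → c l j * φ ε ^ suc j)
    expand ε = begin
      u ^ suc m * v * (φ ε ^ suc m * (v + φ ε * u) ^ n)
        ≈⟨ solve 6 (λ u U v e E p → u :* U :* v :* (e :* E :* p) := u :* v :* e :* (E :* U :* p)) refl u _ v (φ ε) _ _ ⟩
      u * v * φ ε * (φ ε ^ m * u ^ m * (v + φ ε * u) ^ n)
        ≈⟨ *-congˡ (trans (*-congʳ (sym (^-distrib-* (φ ε) u m))) (sym (binomial-AD m n v (φ ε * u)))) ⟩
      u * v * φ ε * AD (m ℕ.+ n) (λ l j → (n C l) · 1# * (v ^ l * (φ ε * u) ^ j))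
        ≈⟨ AD-*ˡ (m ℕ.+ n) _ _ ⟩
      AD (m ℕ.+ n) (λ l j → u * v * φ ε * ((n C l) · 1# * (v ^ l * (φ ε * u) ^ j)))
        ≈⟨ AD-cong′ (m ℕ.+ n) (λ l j → trans (*-congˡ (*-congˡ (*-congˡ (^-distrib-* (φ ε) u j))))
             (solve 7 (λ u v e k V E U → u :* v :* e :* (k :* (V :* (E :* U))) := k :* (v :* V :* (u :* U)) :* (e :* E))
               refl u v (φ ε) _ _ _ _)) ⟩
      AD (m ℕ.+ n) (λ l j → c l j * φ ε ^ suc j) ∎
    power : ∀ l j → sumF (λ ε → c l j * φ ε ^ suc j) ≈ - 1# * ((n C l) · 1# * δ (suc j) * (v ^ suc l * u ^ suc j))
    power l j = begin
      sumF (λ ε → c l j * φ ε ^ suc j)      ≈⟨ sumF-*ˡ (c l j) (λ ε → φ ε ^ suc j) ⟨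
      c l j * sumF (λ ε → φ ε ^ suc j)      ≈⟨ *-congˡ (sumF-cong (λ ε → φ-^ ε (suc j))) ⟨
      c l j * sumF (λ ε → φ (ε F.^ suc j))  ≈⟨ *-congˡ (φ-sum (λ i → elem i F.^ suc j)) ⟨
      c l j * φ (F.powerSum (suc j))        ≈⟨ *-congˡ (φ-powerSum j) ⟩
      c l j * - δ (suc j)                   ≈⟨ solve 3 (λ k z e → k :* z :* (:- e) := :- :1 :* (k :* e :* z)) refl _ _ _ ⟩
      - 1# * ((n C l) · 1# * δ (suc j) * (v ^ suc l * u ^ suc j)) ∎

  -- Coefficient of x_{m+1} x_{n+1} in the product of two inner letter series.
  W : ℕ → ℕ → Carrier → Carrier → Carrier
  W m n u v = δ (suc m) * δ (suc n) * (u ^ suc m * v ^ suc n + u ^ suc n * v ^ suc m)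
            + AD (m ℕ.+ n) (λ j l → δ (suc j) * δ (suc l) * φ (Δ F (suc n) (suc l) (suc j)) * (u ^ suc j * v ^ suc l))

  -- As (q - 1) divides the total degree, each of δ_{j+1} and δ_{l+1} implies the other, and the
  -- signs in `Δ` are then -1. The two binomial coefficients of `Δ` thus give -B(u, v) and -B(v, u),
  -- to which `Φ-expand` applies.
  W-expand : ∀ {m n} → suc d ∣ suc m → suc d ∣ suc n → ∀ u v →
             W m n u v ≈ u ^ suc m * v * Φ n u v + v ^ suc m * u * Φ n v u
  W-expand {m} {n} d∣m d∣n u v = begin
    W m n u v
      ≈⟨ +-cong (trans (*-congʳ (trans (*-cong (δ-∣ d∣m) (δ-∣ d∣n)) (*-identityˡ 1#))) (*-identityˡ _))
                (AD-cong (m ℕ.+ n) term) ⟩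
    (um * vn + un * vm)
      + AD (m ℕ.+ n) (λ j l → - 1# * ((n C l) · 1# * δ (suc j) * (v ^ suc l * u ^ suc j))
                            + - 1# * ((n C j) · 1# * δ (suc l) * (u ^ suc j * v ^ suc l)))
      ≈⟨ +-congˡ (trans (AD-+ (m ℕ.+ n) _ _) (+-cong
           (trans (sym (AD-*ˡ (m ℕ.+ n) (- 1#) _)) (*-congˡ (AD-comm (m ℕ.+ n) _)))
           (sym (AD-*ˡ (m ℕ.+ n) (- 1#) _)))) ⟩
    (um * vn + un * vm) + (- 1# * B m n u v + - 1# * B m n v u)
      ≈⟨ solve 6 (λ um vn un vm b b′ → um :* vn :+ un :* vm :+ (:- :1 :* b :+ :- :1 :* b′)
                 := um :* vn :- b :+ (vm :* un :- b′)) refl um vn un vm _ _ ⟩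
    (um * vn - B m n u v) + (vm * un - B m n v u)
      ≈⟨ +-cong (Φ-expand d∣m n u v) (Φ-expand d∣m n v u) ⟨
    um * v * Φ n u v + vm * u * Φ n v u ∎
    where
    um = u ^ suc m
    un = u ^ suc n
    vm = v ^ suc m
    vn = v ^ suc n
    total : ∀ i j → i ℕ.+ j ≡ m ℕ.+ n → suc d ∣ suc i ℕ.+ suc j
    total i j eq = ≡.subst (suc d ∣_)
      (≡.trans (≡.cong suc (ℕ.+-suc m n)) (≡.sym (≡.trans (≡.cong suc (ℕ.+-suc i j)) (≡.cong (suc ∘ suc) eq))))
      (∣m∣n⇒∣m+n d∣m d∣n)
    odd : ∀ l → δ (suc l) * (- 1#) ^ l ≈ δ (suc l) * - 1#
    odd l = δ-guard (suc l) -1^-odd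
    term : ∀ j l → j ℕ.+ l ≡ m ℕ.+ n →
           δ (suc j) * δ (suc l) * φ (Δ F (suc n) (suc l) (suc j)) * (u ^ suc j * v ^ suc l)
           ≈ - 1# * ((n C l) · 1# * δ (suc j) * (v ^ suc l * u ^ suc j))
           + - 1# * ((n C j) · 1# * δ (suc l) * (u ^ suc j * v ^ suc l))
    term j l eq = begin
      dj * dl * φ (Δ F (suc n) (suc l) (suc j)) * (U * V)
        ≈⟨ *-congʳ (*-congˡ (trans (φ-Δ n l j) (trans (*-congʳ (δ-∣ d∣n)) (*-identityˡ _)))) ⟩
      dj * dl * ((- 1#) ^ l * cl + (- 1#) ^ j * cj) * (U * V)
        ≈⟨ solve 8 (λ dj dl sl cl sj cj U V → dj :* dl :* (sl :* cl :+ sj :* cj) :* (U :* V)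
                   := dj :* (dl :* sl) :* (cl :* (V :* U)) :+ dl :* (dj :* sj) :* (cj :* (U :* V)))
             refl dj dl _ cl _ cj U V ⟩
      dj * (dl * (- 1#) ^ l) * (cl * (V * U)) + dl * (dj * (- 1#) ^ j) * (cj * (U * V))
        ≈⟨ +-cong (*-congʳ (*-congˡ (odd l))) (*-congʳ (*-congˡ (odd j))) ⟩
      dj * (dl * - 1#) * (cl * (V * U)) + dl * (dj * - 1#) * (cj * (U * V))
        ≈⟨ +-cong (*-congʳ (trans (sym (*-assoc _ _ _)) (*-congʳ (δ-∣+ (suc j) (suc l) ≡.refl (total j l eq)))))
                  (*-congʳ (trans (sym (*-assoc _ _ _)) (*-congʳ (absorb j l eq)))) ⟩
      dj * - 1# * (cl * (V * U)) + dl * - 1# * (cj * (U * V))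
        ≈⟨ solve 6 (λ dj dl cl cj U V → dj :* (:- :1) :* (cl :* (V :* U)) :+ dl :* (:- :1) :* (cj :* (U :* V))
                   := :- :1 :* (cl :* dj :* (V :* U)) :+ :- :1 :* (cj :* dl :* (U :* V))) refl dj dl cl cj U V ⟩
      - 1# * (cl * dj * (V * U)) + - 1# * (cj * dl * (U * V)) ∎
      where
      dj = δ (suc j)
      dl = δ (suc l)
      cl = (n C l) · 1#
      cj = (n C j) · 1#
      U = u ^ suc j
      V = v ^ suc l
      absorb : ∀ j l → j ℕ.+ l ≡ m ℕ.+ n → δ (suc l) * δ (suc j) ≈ δ (suc l)
      absorb j l eq = δ-∣+ (suc l) (suc j) ≡.refl (total l j (≡.trans (ℕ.+-comm l j) eq))

  -- A nonzero `Δ` requires (q - 1) | n + 1; then m + n + 2 is not divisible by q - 1, and δ_{j+1}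
  -- δ_{l+1} vanishes for each of its splittings.
  W-∤ˡ : ∀ {m n} → ¬ suc d ∣ suc m → ∀ u v → W m n u v ≈ 0#
  W-∤ˡ {m} {n} d∤m u v = trans (+-cong
    (trans (*-congʳ (trans (*-congʳ (δ-∤ d∤m)) (zeroˡ _))) (zeroˡ _))
    (AD-0 (m ℕ.+ n) vanish)) (+-identityˡ 0#)
    where
    vanish : ∀ j l → j ℕ.+ l ≡ m ℕ.+ n →
             δ (suc j) * δ (suc l) * φ (Δ F (suc n) (suc l) (suc j)) * (u ^ suc j * v ^ suc l) ≈ 0#
    vanish j l eq = trans (*-congʳ (begin
      δ (suc j) * δ (suc l) * φ (Δ F (suc n) (suc l) (suc j))
        ≈⟨ *-congˡ (φ-Δ n l j) ⟩
      δ (suc j) * δ (suc l) * (δ (suc n) * x)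
        ≈⟨ solve 4 (λ a b c x → a :* b :* (c :* x) := c :* (a :* b) :* x) refl _ _ _ x ⟩
      δ (suc n) * (δ (suc j) * δ (suc l)) * x
        ≈⟨ *-congʳ (trans (δ-guard (suc n) (λ d∣n → δ-∤+ (suc j) (suc l) ≡.refl (λ d∣jl →
             d∤m (∣m+n∣m⇒∣n (≡.subst (suc d ∣_) (total j l eq) d∣jl) d∣n)))) (zeroʳ _)) ⟩
      0# * x
        ≈⟨ zeroˡ x ⟩
      0# ∎)) (zeroˡ _)
      where
      x = (- 1#) ^ l * (n C l) · 1# + (- 1#) ^ j * (n C j) · 1#
      total : ∀ j l → j ℕ.+ l ≡ m ℕ.+ n → suc j ℕ.+ suc l ≡ suc n ℕ.+ suc m
      total j l eq = ≡.trans (≡.cong suc (ℕ.+-suc j l))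
        (≡.trans (≡.cong (suc ∘ suc) (≡.trans eq (ℕ.+-comm m n))) (≡.sym (≡.cong suc (ℕ.+-suc n m))))

  W-∤ʳ : ∀ {m n} → ¬ suc d ∣ suc n → ∀ u v → W m n u v ≈ 0#
  W-∤ʳ {m} {n} d∤n u v = trans (+-cong
    (trans (*-congʳ (trans (*-congˡ (δ-∤ d∤n)) (zeroʳ _))) (zeroˡ _))
    (AD-0 (m ℕ.+ n) λ j l _ → trans (*-congʳ (trans (*-congˡ
      (trans (φ-Δ n l j) (trans (*-congʳ (δ-∤ d∤n)) (zeroˡ _)))) (zeroʳ _))) (zeroˡ _))) (+-identityˡ 0#)

  -- After `W-expand`, translation turns Φ n u w and Φ n v w on the right into the values on the
  -- left; the two terms with w^(m+1) cancel by `Φ-reflect`.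
  W-key : ∀ m n u v → (u + v) * W m n u v ≈ v * W m n u (u + v) + u * W m n v (u + v)
  W-key m n u v = cases (suc d ∣? suc m) (suc d ∣? suc n)
    where
    w = u + v
    U = u ^ suc m
    V = v ^ suc m
    W′ = w ^ suc m
    trivial : (∀ u v → W m n u v ≈ 0#) → w * W m n u v ≈ v * W m n u w + u * W m n v w
    trivial W≈0 = trans (*-congˡ (W≈0 _ _)) (trans (solve 2 (λ u v → (u :+ v) :* :0 := v :* :0 :+ u :* :0) refl u v)
      (sym (+-cong (*-congˡ (W≈0 _ _)) (*-congˡ (W≈0 _ _)))))
    cases : Dec (suc d ∣ suc m) → Dec (suc d ∣ suc n) → w * W m n u v ≈ v * W m n u w + u * W m n v w
    cases (no d∤m)  _         = trivial (W-∤ˡ d∤m)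
    cases (yes _)   (no d∤n)  = trivial (W-∤ʳ d∤n)
    cases (yes d∣m) (yes d∣n) = begin
      w * W m n u v
        ≈⟨ *-congˡ (W-expand d∣m d∣n u v) ⟩
      w * (U * v * Φ n u v + V * u * Φ n v u)
        ≈⟨ solve 8 (λ w U v a V u b W → w :* (U :* v :* a :+ V :* u :* b)
               := v :* (U :* w :* a) :+ u :* (V :* w :* b) :+ u :* v :* W :* :0) refl w U v _ V u _ _ ⟩
      v * (U * w * Φ n u v) + u * (V * w * Φ n v u) + u * v * W′ * 0#
        ≈⟨ +-congˡ (*-congˡ (trans (+-congˡ (Φ-reflect d∣n u v)) (-‿inverseʳ _))) ⟨
      v * (U * w * Φ n u v) + u * (V * w * Φ n v u) + u * v * W′ * (Φ n w u + Φ n w v)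
        ≈⟨ solve 9 (λ w U v a V u b W c → v :* (U :* w :* a) :+ u :* (V :* w :* b) :+ c
               := (v :* (U :* w :* a) :+ u :* (V :* w :* b)) :+ c) refl w U v _ V u _ W′ _ ⟩
      (v * (U * w * Φ n u v) + u * (V * w * Φ n v u)) + u * v * W′ * (Φ n w u + Φ n w v)
        ≈⟨ +-congʳ (+-cong (*-congˡ (*-congˡ (Φ-translate n u v)))
             (*-congˡ (*-congˡ (trans (sumF-cong λ ε → ^-congˡ n (+-congʳ {φ ε * v} (+-comm u v))) (Φ-translate n v u))))) ⟨
      (v * (U * w * Φ n u w) + u * (V * w * Φ n v w)) + u * v * W′ * (Φ n w u + Φ n w v)
        ≈⟨ solve 10 (λ w U v a V u b W c e → (v :* (U :* w :* a) :+ u :* (V :* w :* b)) :+ u :* v :* W :* (c :+ e)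
               := v :* (U :* w :* a :+ W :* u :* c) :+ u :* (V :* w :* b :+ W :* v :* e)) refl w U v _ V u _ W′ _ _ ⟩
      v * (U * w * Φ n u w + W′ * u * Φ n w u) + u * (V * w * Φ n v w + W′ * v * Φ n w v)
        ≈⟨ +-cong (*-congˡ (W-expand d∣m d∣n u w)) (*-congˡ (W-expand d∣m d∣n v w)) ⟨
      v * W m n u w + u * W m n v w ∎

-- Generating functions of letter products

module GeneratingFunctions {d : ℕ} {F : FiniteField (suc (suc d))} (𝕂 : FieldAlgebra F) where

  open FieldAlgebra 𝕂 using (φ; φ-+; φ-*; φ-1) renaming (ring to K)
  private module F = FieldFacts F
  open CommutativeRing K hiding (zero)
  open import Algebra.Properties.Semiring.Exp semiring using (_^_; ^-congˡ)
  open import Algebra.Properties.Semiring.Mult semiring using () renaming (_×_ to _·_)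
  open import Relation.Binary.Reasoning.Setoid setoid
  open AntidiagonalSums K
  open IntegerCoefficientSolver K
  open KeyIdentity 𝕂
  open TripleProduct F

  module _ (h₀ : Coefficient) (h₁ : ℕ → Coefficient) (h₂ : ℕ → ℕ → Coefficient) where

    private
      g : ℕ → ℕ → Coefficient
      g = inner h₀ h₁ h₂

    -- Degree n part of uP(u) · vP(v), evaluated through h₀, h₁, h₂.
    G : ℕ → Carrier → Carrier → Carrier
    G n u v = AD n (λ j l → δ j * δ l * φ (g l j) * (u ^ j * v ^ l))

    G-sym : ∀ n u v → G n u v ≈ G n v u
    G-sym n u v = trans (AD-comm n _) (AD-cong′ n λ j l →
      *-cong (*-cong (*-comm _ _) (φ-cong (inner-sym h₀ h₁ h₂ j l))) (*-comm _ _))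

    G-even : ∀ n u v → G n (- u) v ≈ G n u v
    G-even n u v = AD-cong′ n λ j l → begin
      δ j * δ l * φ (g l j) * ((- u) ^ j * v ^ l)
        ≈⟨ solve 5 (λ a b c x y → a :* b :* c :* (x :* y) := a :* x :* (b :* c :* y)) refl _ _ _ _ _ ⟩
      δ j * (- u) ^ j * (δ l * φ (g l j) * v ^ l)
        ≈⟨ *-congʳ (δ-guard j λ d∣j → neg-^-even d∣j u) ⟩
      δ j * u ^ j * (δ l * φ (g l j) * v ^ l)
        ≈⟨ solve 5 (λ a b c x y → a :* x :* (b :* c :* y) := a :* b :* c :* (x :* y)) refl _ _ _ _ _ ⟩
      δ j * δ l * φ (g l j) * (u ^ j * v ^ l) ∎

    G-1 : ∀ u v → G 1 u v ≈ φ (h₁ 0) * H 1 u v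
    G-1 u v = solve 5 (λ a b h x y → a :* b :* h :* x :+ b :* a :* h :* y := h :* (a :* b :* x :+ b :* a :* y))
      refl (δ 0) (δ 1) _ _ _

    -- Sorts `G` by the unknowns: in degree n + 2 only the letter of that weight and the pairs of
    -- letters of that total weight occur.
    G-2+ : ∀ n u v → G (suc (suc n)) u v ≈ φ (h₁ (suc n)) * H (suc (suc n)) u v + AD n (λ i j → φ (h₂ i j) * W i j u v)
    G-2+ n u v = begin
      G N u v
        ≈⟨ AD-ends n (λ j l → δ j * δ l * φ (g l j) * (u ^ j * v ^ l)) ⟩
      δ 0 * δ N * h * (u ^ 0 * v ^ N) + AD n (λ j l → e j l * φ (g (suc l) (suc j)) * x j l) + δ N * δ 0 * h * (u ^ N * v ^ 0)
        ≈⟨ +-congʳ (+-congˡ (AD-cong n middle)) ⟩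
      δ 0 * δ N * h * (u ^ 0 * v ^ N) + AD n (λ j l → h * (e j l * x j l) + (P j l + (Q j l + R j l))) + δ N * δ 0 * h * (u ^ N * v ^ 0)
        ≈⟨ +-congʳ (+-congˡ (trans (AD-+ n _ _) (+-congʳ (sym (AD-*ˡ n h _))))) ⟩
      δ 0 * δ N * h * (u ^ 0 * v ^ N) + (h * AD n (λ j l → e j l * x j l) + AD n (λ j l → P j l + (Q j l + R j l))) + δ N * δ 0 * h * (u ^ N * v ^ 0)
        ≈⟨ solve 7 (λ a b h x s t y → a :* b :* h :* x :+ (h :* s :+ t) :+ b :* a :* h :* y
                   := h :* (a :* b :* x :+ s :+ b :* a :* y) :+ t) refl (δ 0) (δ N) h _ _ _ _ ⟩
      h * (δ 0 * δ N * (u ^ 0 * v ^ N) + AD n (λ j l → e j l * x j l) + δ N * δ 0 * (u ^ N * v ^ 0)) + AD n (λ j l → P j l + (Q j l + R j l))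
        ≈⟨ +-cong (*-congˡ (sym (AD-ends n (λ j l → δ j * δ l * (u ^ j * v ^ l))))) second ⟩
      h * H N u v + AD n (λ i j → φ (h₂ i j) * W i j u v) ∎
      where
      N = suc (suc n)
      h = φ (h₁ (suc n))
      e x P Q R : ℕ → ℕ → Carrier
      e j l = δ (suc j) * δ (suc l)
      x j l = u ^ suc j * v ^ suc l
      P j l = φ (h₂ j l) * (e j l * x j l)
      Q j l = φ (h₂ l j) * (e l j * x j l)
      R j l = AD n (λ i k → φ (h₂ i k) * (e j l * φ (Δ F (suc k) (suc l) (suc j)) * x j l))
      middle : ∀ j l → j ℕ.+ l ≡ n → e j l * φ (g (suc l) (suc j)) * x j l ≈ h * (e j l * x j l) + (P j l + (Q j l + R j l))
      middle j l eq = begin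
        e j l * φ (g (suc l) (suc j)) * x j l
          ≈⟨ *-congʳ (*-congˡ (trans (φ-+ _ _) (+-cong (φ-+ _ _) (trans (φ-+ _ _) (+-cong (φ-cong (≡.cong (h₁ ∘ suc) l+j≡n)) (trans (φ-AD (l ℕ.+ j) _)
               (reflexive (≡.cong (λ m → AD m (λ i k → φ (Δ F (suc k) (suc l) (suc j) F.* h₂ i k))) l+j≡n)))))))) ⟩
        e j l * ((φ (h₂ l j) + φ (h₂ j l)) + (h + S)) * x j l
          ≈⟨ solve 7 (λ a b p q h s x → a :* b :* ((q :+ p) :+ (h :+ s)) :* x
                     := h :* (a :* b :* x) :+ (p :* (a :* b :* x) :+ (q :* (b :* a :* x) :+ a :* b :* x :* s)))
               refl _ _ _ _ h S (x j l) ⟩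
        h * (e j l * x j l) + (P j l + (Q j l + e j l * x j l * S))
          ≈⟨ +-congˡ (+-congˡ (+-congˡ (trans (AD-*ˡ n _ _) (AD-cong′ n λ i k → trans (*-congˡ (φ-* _ _))
               (solve 5 (λ a b x t h → a :* b :* x :* (t :* h) := h :* (a :* b :* t :* x)) refl _ _ _ _ _))))) ⟩
        h * (e j l * x j l) + (P j l + (Q j l + R j l)) ∎
        where
        l+j≡n = ≡.trans (ℕ.+-comm l j) eq
        S = AD n (λ i k → φ (Δ F (suc k) (suc l) (suc j) F.* h₂ i k))
      second : AD n (λ j l → P j l + (Q j l + R j l)) ≈ AD n (λ i j → φ (h₂ i j) * W i j u v)
      second = begin
        AD n (λ j l → P j l + (Q j l + R j l))
          -- `AD-swap` exchanges the pair of letters being multiplied with the pair occurring in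
          -- their product.
          ≈⟨ trans (AD-+ n _ _) (+-congˡ (trans (AD-+ n _ _) (+-cong (AD-comm n _) (AD-swap n n _)))) ⟩
        AD n P + (AD n (λ j l → Q l j) + AD n (λ i k → AD n (λ j l → φ (h₂ i k) * (e j l * φ (Δ F (suc k) (suc l) (suc j)) * x j l))))
          ≈⟨ trans (AD-+ n _ _) (+-congˡ (AD-+ n _ _)) ⟨
        AD n (λ i k → P i k + (Q k i + AD n (λ j l → φ (h₂ i k) * (e j l * φ (Δ F (suc k) (suc l) (suc j)) * x j l))))
          ≈⟨ AD-cong n (λ i k eq → trans (+-congˡ (+-congˡ (sym (AD-*ˡ n _ _))))
               (trans (solve 5 (λ h e p q s → h :* (e :* p) :+ (h :* (e :* q) :+ h :* s) := h :* (e :* (p :+ q) :+ s)) refl (φ (h₂ i k)) (e i k) _ _ _)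
                 (*-congˡ (+-congˡ (reflexive (≡.cong (λ m → AD m (λ j l → e j l * φ (Δ F (suc k) (suc l) (suc j)) * x j l)) (≡.sym eq))))))) ⟩
        AD n (λ i k → φ (h₂ i k) * W i k u v) ∎

    -- This is P(u) P(v) = P(u + v) (P(u) + P(v)) multiplied by u v (u + v). It is linear in the
    -- unknowns, so `H-key` and `W-key` suffice; degrees 0 and 1 contain no pairs of letters.
    G-key : ∀ n u v → (u + v) * G n u v ≈ v * G n u (u + v) + u * G n v (u + v)
    G-key zero u v = solve 3 (λ u v c → (u :+ v) :* c := v :* c :+ u :* c) refl u v _
    G-key (suc zero) u v = begin
      (u + v) * G 1 u v                        ≈⟨ *-congˡ (G-1 u v) ⟩
      (u + v) * (h * H 1 u v)                  ≈⟨ solve 3 (λ w h z → w :* (h :* z) := h :* (w :* z)) refl _ h _ ⟩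
      h * ((u + v) * H 1 u v)                  ≈⟨ *-congˡ (H-key 1 u v) ⟩
      h * (v * H 1 u (u + v) + u * H 1 v (u + v)) ≈⟨ solve 5 (λ h u v a b → h :* (v :* a :+ u :* b) := v :* (h :* a) :+ u :* (h :* b)) refl h u v _ _ ⟩
      v * (h * H 1 u (u + v)) + u * (h * H 1 v (u + v)) ≈⟨ +-cong (*-congˡ (G-1 u (u + v))) (*-congˡ (G-1 v (u + v))) ⟨
      v * G 1 u (u + v) + u * G 1 v (u + v)    ∎
      where h = φ (h₁ 0)
    G-key (suc (suc n)) u v = begin
      w * G N u v
        ≈⟨ *-congˡ (G-2+ n u v) ⟩
      w * (h * H N u v + Σ u v)
        ≈⟨ solve 4 (λ w h z s → w :* (h :* z :+ s) := h :* (w :* z) :+ w :* s) refl w h _ _ ⟩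
      h * (w * H N u v) + w * Σ u v
        ≈⟨ +-cong (*-congˡ (H-key N u v)) (begin
          w * Σ u v
            ≈⟨ AD-*ˡ n w _ ⟩
          AD n (λ i j → w * (φ (h₂ i j) * W i j u v))
            ≈⟨ AD-cong′ n (λ i j → trans (solve 3 (λ w h z → w :* (h :* z) := h :* (w :* z)) refl w _ _)
                 (trans (*-congˡ (W-key i j u v))
                 (solve 5 (λ h u v a b → h :* (v :* a :+ u :* b) := v :* (h :* a) :+ u :* (h :* b)) refl _ u v _ _))) ⟩
          AD n (λ i j → v * (φ (h₂ i j) * W i j u w) + u * (φ (h₂ i j) * W i j v w))
            ≈⟨ trans (AD-+ n _ _) (+-cong (sym (AD-*ˡ n v _)) (sym (AD-*ˡ n u _))) ⟩
          v * Σ u w + u * Σ v w ∎) ⟩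
      h * (v * H N u w + u * H N v w) + (v * Σ u w + u * Σ v w)
        ≈⟨ solve 7 (λ h u v a b s t → h :* (v :* a :+ u :* b) :+ (v :* s :+ u :* t)
                   := v :* (h :* a :+ s) :+ u :* (h :* b :+ t)) refl h u v _ _ _ _ ⟩
      v * (h * H N u w + Σ u w) + u * (h * H N v w + Σ v w)
        ≈⟨ +-cong (*-congˡ (G-2+ n u w)) (*-congˡ (G-2+ n v w)) ⟨
      v * G N u w + u * G N v w ∎
      where
      N = suc (suc n)
      w = u + v
      h = φ (h₁ (suc n))
      Σ : Carrier → Carrier → Carrier
      Σ u v = AD n (λ i j → φ (h₂ i j) * W i j u v)

  -- For j = 0 this is a geometric sum. For j > 0 the two binomials of `Δ` sum to T^i (T - S)^(j-1)
  -- and S^i (S - T)^(j-1), and (T - S)^(j-1) = -(S - T)^(j-1) because (q - 1) | j.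
  A-generating : ∀ i j n → i ℕ.+ j ≡ suc n → ∀ S T →
                 (S - T) * AD n (λ a b → φ (A j a b) * (S ^ a * T ^ b)) ≈ δ j * ((S ^ i - T ^ i) * (S - T) ^ j)
  A-generating i zero n eq S T rewrite ≡.trans (≡.sym (ℕ.+-identityʳ i)) eq = begin
    (S - T) * AD n (λ a b → φ F.1# * (S ^ a * T ^ b))
      ≈⟨ *-congˡ (AD-cong′ n λ a b → trans (*-congʳ φ-1) (*-identityˡ _)) ⟩
    (S - T) * AD n (λ a b → S ^ a * T ^ b)
      ≈⟨ geometric-AD n S T ⟩
    S ^ suc n - T ^ suc n
      ≈⟨ solve 1 (λ x → :1 :* (x :* :1) := x) refl _ ⟨
    1# * ((S ^ suc n - T ^ suc n) * 1#)
      ≈⟨ *-congʳ (δ-∣ (suc d ∣0)) ⟨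
    δ 0 * ((S ^ suc n - T ^ suc n) * 1#) ∎
  A-generating i (suc j) n eq S T = begin
    (S - T) * AD n (λ a b → φ (Δ F (suc j) (suc a) (suc b)) * (S ^ a * T ^ b))
      ≈⟨ *-congˡ (trans (AD-cong′ n term) (trans (sym (AD-*ˡ n _ _)) (*-congˡ (AD-+ n _ _)))) ⟩
    (S - T) * (δ (suc j) * (AD n (λ a b → (j C a) · 1# * ((- S) ^ a * T ^ b)) + AD n (λ a b → (j C b) · 1# * ((- T) ^ b * S ^ a))))
      ≈⟨ *-congˡ (*-congˡ (+-cong (binomial (- S) T) (trans (AD-comm n _) (binomial (- T) S)))) ⟩
    (S - T) * (δ (suc j) * (T ^ i * (- S + T) ^ j + S ^ i * (- T + S) ^ j))
      ≈⟨ *-congˡ (δ-guard (suc j) λ d∣j → +-cong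
           (*-congˡ (trans (^-congˡ j (solve 2 (λ S T → :- S :+ T := :- (S :- T)) refl S T)) (neg-^-odd d∣j (S - T))))
           (*-congˡ (^-congˡ j (+-comm (- T) S)))) ⟩
    (S - T) * (δ (suc j) * (T ^ i * - ((S - T) ^ j) + S ^ i * (S - T) ^ j))
      ≈⟨ solve 5 (λ z e s t p → z :* (e :* (t :* (:- p) :+ s :* p)) := e :* ((s :- t) :* (z :* p))) refl (S - T) _ _ _ _ ⟩
    δ (suc j) * ((S ^ i - T ^ i) * (S - T) ^ suc j) ∎
    where
    binomial : ∀ x y → AD n (λ a b → (j C a) · 1# * (x ^ a * y ^ b)) ≈ y ^ i * (x + y) ^ j
    binomial x y = trans (reflexive (≡.cong (λ m → AD m (λ a b → (j C a) · 1# * (x ^ a * y ^ b)))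
      (≡.sym (ℕ.suc-injective (≡.trans (≡.sym (ℕ.+-suc i j)) eq))))) (binomial-AD i j x y)
    term : ∀ a b → φ (Δ F (suc j) (suc a) (suc b)) * (S ^ a * T ^ b)
                   ≈ δ (suc j) * ((j C a) · 1# * ((- S) ^ a * T ^ b) + (j C b) · 1# * ((- T) ^ b * S ^ a))
    term a b = begin
      φ (Δ F (suc j) (suc a) (suc b)) * (S ^ a * T ^ b)
        ≈⟨ *-congʳ (φ-Δ j a b) ⟩
      δ (suc j) * ((- 1#) ^ a * (j C a) · 1# + (- 1#) ^ b * (j C b) · 1#) * (S ^ a * T ^ b)
        ≈⟨ solve 7 (λ e s k t l S T → e :* (s :* k :+ t :* l) :* (S :* T) := e :* (k :* (s :* S :* T) :+ l :* (t :* T :* S)))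
             refl _ _ _ _ _ _ _ ⟩
      δ (suc j) * ((j C a) · 1# * ((- 1#) ^ a * S ^ a * T ^ b) + (j C b) · 1# * ((- 1#) ^ b * T ^ b * S ^ a))
        ≈⟨ *-congˡ (+-cong (*-congˡ (*-congʳ (neg-^ S a))) (*-congˡ (*-congʳ (neg-^ T b)))) ⟨
      δ (suc j) * ((j C a) · 1# * ((- S) ^ a * T ^ b) + (j C b) · 1# * ((- T) ^ b * S ^ a)) ∎

  -- Degree n of X(S) ⋄ X(T) = (X(S) - X(T)) P(S - T), cleared of the pole by the factor S - T.
  D-generating : ∀ n f S T →
                 (S - T) * AD n (λ a b → φ (D a b f) * (S ^ a * T ^ b))
                 ≈ AD (suc n) (λ i j → δ j * ((S ^ i - T ^ i) * (S - T) ^ j) * φ (f i j))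
  D-generating n f S T = begin
    (S - T) * AD n (λ a b → φ (D a b f) * (S ^ a * T ^ b))
      ≈⟨ *-congˡ (AD-cong n expand) ⟩
    (S - T) * AD n (λ a b → AD (suc n) (λ i j → t i j a b))
      ≈⟨ *-congˡ (AD-swap n (suc n) (λ a b i j → t i j a b)) ⟩
    (S - T) * AD (suc n) (λ i j → AD n (t i j))
      ≈⟨ AD-*ˡ (suc n) _ (λ i j → AD n (t i j)) ⟩
    AD (suc n) (λ i j → (S - T) * AD n (t i j))
      ≈⟨ AD-cong (suc n) collect ⟩
    AD (suc n) (λ i j → δ j * ((S ^ i - T ^ i) * (S - T) ^ j) * φ (f i j)) ∎
    where
    t : ℕ → ℕ → ℕ → ℕ → Carrier
    t i j a b = φ (A j a b) * (S ^ a * T ^ b) * φ (f i j)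
    expand : ∀ a b → a ℕ.+ b ≡ n → φ (D a b f) * (S ^ a * T ^ b) ≈ AD (suc n) (λ i j → t i j a b)
    expand a b ≡.refl = begin
      φ (D a b f) * (S ^ a * T ^ b)
        ≈⟨ *-congʳ (φ-AD (suc n) (λ i j → A j a b F.* f i j)) ⟩
      AD (suc n) (λ i j → φ (A j a b F.* f i j)) * (S ^ a * T ^ b)
        ≈⟨ AD-*ʳ (suc n) _ (λ i j → φ (A j a b F.* f i j)) ⟩
      AD (suc n) (λ i j → φ (A j a b F.* f i j) * (S ^ a * T ^ b))
        ≈⟨ AD-cong′ (suc n) (λ i j → trans (*-congʳ (φ-* (A j a b) (f i j)))
             (solve 3 (λ x y z → x :* y :* z := x :* z :* y) refl _ _ (S ^ a * T ^ b))) ⟩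
      AD (suc n) (λ i j → t i j a b) ∎
    collect : ∀ i j → i ℕ.+ j ≡ suc n → (S - T) * AD n (t i j) ≈ δ j * ((S ^ i - T ^ i) * (S - T) ^ j) * φ (f i j)
    collect i j eq = begin
      (S - T) * AD n (t i j)
        ≈⟨ *-congˡ (AD-*ʳ n _ _) ⟨
      (S - T) * (AD n (λ a b → φ (A j a b) * (S ^ a * T ^ b)) * φ (f i j))
        ≈⟨ *-assoc _ _ _ ⟨
      (S - T) * AD n (λ a b → φ (A j a b) * (S ^ a * T ^ b)) * φ (f i j)
        ≈⟨ *-congʳ (A-generating i j n eq S T) ⟩
      δ j * ((S ^ i - T ^ i) * (S - T) ^ j) * φ (f i j) ∎

-- The generating function of the triple product

module TripleGenerating {d : ℕ} {F : FiniteField (suc (suc d))} (𝕂 : FieldAlgebra F) where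

  open FieldAlgebra 𝕂 using (φ) renaming (ring to K)
  open CommutativeRing K hiding (zero)
  open import Algebra.Properties.Semiring.Exp semiring using (_^_; ^-congˡ)
  open import Relation.Binary.Reasoning.Setoid setoid
  open AntidiagonalSums K
  open IntegerCoefficientSolver K
  open KeyIdentity 𝕂
  open GeneratingFunctions 𝕂
  open TripleProduct F

  generating : (ℕ → ℕ → ℕ → Coefficient) → ℕ → Carrier → Carrier → Carrier → Carrier
  generating e n S T R = AD n (λ m c → AD m (λ a b → φ (e a b c) * (S ^ a * T ^ b)) * R ^ c)

  generating-swap : ∀ e n S T R → generating e n S R T ≈ generating (λ a b c → e a c b) n S T R
  generating-swap e n S T R = begin
    generating e n S R T
      ≈⟨ AD-cong′ n (λ m c → AD-*ʳ m _ _) ⟩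
    AD n (λ m c → AD m (λ a b → φ (e a b c) * (S ^ a * R ^ b) * T ^ c))
      ≈⟨ AD-assoc n (λ a b c → φ (e a b c) * (S ^ a * R ^ b) * T ^ c) ⟩
    AD n (λ a m → AD m (λ b c → φ (e a b c) * (S ^ a * R ^ b) * T ^ c))
      ≈⟨ AD-cong′ n (λ a m → trans (AD-comm m _) (AD-cong′ m λ c b →
           solve 4 (λ e s r t → e :* (s :* r) :* t := e :* (s :* t) :* r) refl _ _ _ _)) ⟩
    AD n (λ a m → AD m (λ c b → φ (e a b c) * (S ^ a * T ^ c) * R ^ b))
      ≈⟨ AD-assoc n (λ a c b → φ (e a b c) * (S ^ a * T ^ c) * R ^ b) ⟨
    AD n (λ m b → AD m (λ a c → φ (e a b c) * (S ^ a * T ^ c) * R ^ b))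
      ≈⟨ AD-cong′ n (λ m c → AD-*ʳ m _ _) ⟨
    generating (λ a b c → e a c b) n S T R ∎

  module _ (f₀ : ℕ → Coefficient) (f₁ : ℕ → ℕ → Coefficient) (f₂ : ℕ → ℕ → ℕ → Coefficient) where

    private
      Gₖ : ℕ → ℕ → Carrier → Carrier → Carrier
      Gₖ k = G (f₀ k) (f₁ k) (f₂ k)

      g : ℕ → ℕ → ℕ → Coefficient
      g k = inner (f₀ k) (f₁ k) (f₂ k)

    Gₖ-cong : ∀ k n {u u′ v v′} → u ≈ u′ → v ≈ v′ → Gₖ k n u v ≈ Gₖ k n u′ v′
    Gₖ-cong k n u≈u′ v≈v′ = AD-cong′ n λ j l → *-congˡ (*-cong (^-congˡ j u≈u′) (^-congˡ l v≈v′))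

    -- The triple product is ((X(S) - X(R)) P(S - R) - (X(T) - X(R)) P(T - R)) P(S - T). Multiplied
    -- by (S - T)(S - R)(T - R), it has these coefficients at X(S), X(T), X(R); the one at X(R) is
    -- rewritten by `G-key` with u = S - T and v = T - R.
    closedTerm : Carrier → Carrier → Carrier → ℕ → ℕ → Carrier
    closedTerm S T R k m = S ^ k * ((T - R) * Gₖ k m (S - T) (S - R))
                         - T ^ k * ((S - R) * Gₖ k m (S - T) (T - R))
                         + R ^ k * ((S - T) * Gₖ k m (T - R) (S - R))

    generating-closed : ∀ n S T R →
      (S - R) * (T - R) * ((S - T) * generating (triple f₀ f₁ f₂) n S T R)
      ≈ AD (suc (suc n)) (closedTerm S T R)
    generating-closed n S T R = begin
      (S - R) * (T - R) * ((S - T) * generating (triple f₀ f₁ f₂) n S T R)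
        ≈⟨ *-congˡ step₁ ⟩
      (S - R) * (T - R) * AD (suc n) (λ j m → AD m (λ i c → z i j c))
        ≈⟨ AD-*ˡ (suc n) _ (λ j m → AD m (λ i c → z i j c)) ⟩
      AD (suc n) (λ j m → (S - R) * (T - R) * AD m (λ i c → z i j c))
        ≈⟨ AD-cong′ (suc n) step₂ ⟩
      AD (suc n) (λ j m → Q j (suc m))
        -- `Q j 0` vanishes because zeroth powers agree, so the sum extends to degree n + 2 and its
        -- indices can be regrouped.
        ≈⟨ trans (AD-last (suc n) Q) (trans (+-congˡ (Q-0 (suc (suc n)))) (+-identityʳ _)) ⟨
      AD (suc (suc n)) (λ j m → AD m (λ k l → q k j l))
        ≈⟨ AD-exchange (suc (suc n)) (λ j k l → q k j l) ⟩
      AD (suc (suc n)) (λ k m → AD m (λ j l → q k j l))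
        ≈⟨ AD-cong′ (suc (suc n)) step₃ ⟩
      AD (suc (suc n)) (closedTerm S T R) ∎
      where
      u = S - T
      v = T - R
      w = S - R
      Dφ : ℕ → ℕ → ℕ → Carrier
      Dφ i j c = φ (D i c (λ k l → g k l j))
      z q : ℕ → ℕ → ℕ → Carrier
      z i j c = δ j * ((S ^ i - T ^ i) * u ^ j) * Dφ i j c * R ^ c
      q k j l = δ j * u ^ j * (v * (δ l * ((S ^ k - R ^ k) * w ^ l) * φ (g k l j))
                             - w * (δ l * ((T ^ k - R ^ k) * v ^ l) * φ (g k l j)))
      Z Q : ℕ → ℕ → Carrier
      Z m c = AD m (λ i j → δ j * ((S ^ i - T ^ i) * u ^ j) * Dφ i j c) * R ^ c
      Q j m = AD m (λ k l → q k j l)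
      Z-0 : ∀ c → Z 0 c ≈ 0#
      Z-0 c = solve 3 (λ e p r → e :* ((:1 :- :1) :* :1) :* p :* r := :0) refl _ _ _
      Q-0 : ∀ j → Q j 0 ≈ 0#
      Q-0 j = solve 6 (λ e U v d p w → e :* U :* (v :* (d :* ((:1 :- :1) :* :1) :* p) :- w :* (d :* ((:1 :- :1) :* :1) :* p)) := :0)
        refl _ _ v _ _ w
      step₁ : u * generating (triple f₀ f₁ f₂) n S T R ≈ AD (suc n) (λ j m → AD m (λ i c → z i j c))
      step₁ = begin
        u * generating (triple f₀ f₁ f₂) n S T R
          ≈⟨ AD-*ˡ n u _ ⟩
        AD n (λ m c → u * (AD m (λ a b → φ (triple f₀ f₁ f₂ a b c) * (S ^ a * T ^ b)) * R ^ c))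
          ≈⟨ AD-cong′ n (λ m c → trans (sym (*-assoc _ _ _))
               (*-congʳ (D-generating m (λ i j → D i c (λ k l → g k l j)) S T))) ⟩
        AD n (λ m c → Z (suc m) c)
          ≈⟨ trans (+-congʳ (Z-0 (suc n))) (+-identityˡ _) ⟨
        AD (suc n) Z
          ≈⟨ AD-cong′ (suc n) (λ m c → AD-*ʳ m (R ^ c) (λ i j → δ j * ((S ^ i - T ^ i) * u ^ j) * Dφ i j c)) ⟩
        AD (suc n) (λ m c → AD m (λ i j → z i j c))
          ≈⟨ AD-assoc (suc n) z ⟩
        AD (suc n) (λ i m → AD m (λ j c → z i j c))
          ≈⟨ AD-exchange (suc n) z ⟩
        AD (suc n) (λ j m → AD m (λ i c → z i j c)) ∎
      step₂ : ∀ j m → w * v * AD m (λ i c → z i j c) ≈ Q j (suc m)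
      step₂ j m = begin
        w * v * AD m (λ i c → z i j c)
          ≈⟨ *-congˡ (trans (AD-cong′ m (λ i c →
               solve 6 (λ e s t U p r → e :* ((s :- t) :* U) :* p :* r := e :* U :* (p :* (s :* r)) :+ (:- (e :* U)) :* (p :* (t :* r)))
                 refl _ _ _ _ _ _)) (trans (AD-+ m _ _) (+-cong (sym (AD-*ˡ m _ _)) (sym (AD-*ˡ m _ _))))) ⟩
        w * v * (δ j * u ^ j * AD m (λ i c → Dφ i j c * (S ^ i * R ^ c)) + - (δ j * u ^ j) * AD m (λ i c → Dφ i j c * (T ^ i * R ^ c)))
          ≈⟨ solve 5 (λ w v c x y → w :* v :* (c :* x :+ (:- c) :* y) := c :* (v :* (w :* x) :- w :* (v :* y))) refl w v _ _ _ ⟩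
        δ j * u ^ j * (v * (w * AD m (λ i c → Dφ i j c * (S ^ i * R ^ c))) - w * (v * AD m (λ i c → Dφ i j c * (T ^ i * R ^ c))))
          ≈⟨ *-congˡ (+-cong (*-congˡ (D-generating m (λ k l → g k l j) S R))
                             (-‿cong (*-congˡ (D-generating m (λ k l → g k l j) T R)))) ⟩
        δ j * u ^ j * (v * AD (suc m) (λ k l → y S w k l) - w * AD (suc m) (λ k l → y T v k l))
          ≈⟨ *-congˡ (+-cong (AD-*ˡ (suc m) v (y S w))
               (trans (solve 2 (λ w x → :- (w :* x) := (:- w) :* x) refl w _) (AD-*ˡ (suc m) (- w) (y T v)))) ⟩
        δ j * u ^ j * (AD (suc m) (λ k l → v * y S w k l) + AD (suc m) (λ k l → - w * y T v k l))
          ≈⟨ *-congˡ (AD-+ (suc m) (λ k l → v * y S w k l) (λ k l → - w * y T v k l)) ⟨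
        δ j * u ^ j * AD (suc m) (λ k l → v * y S w k l + - w * y T v k l)
          ≈⟨ AD-*ˡ (suc m) _ (λ k l → v * y S w k l + - w * y T v k l) ⟩
        AD (suc m) (λ k l → δ j * u ^ j * (v * y S w k l + - w * y T v k l))
          ≈⟨ AD-cong′ (suc m) (λ k l → *-congˡ {δ j * u ^ j} (+-congˡ {v * y S w k l} (solve 2 (λ w x → (:- w) :* x := :- (w :* x)) refl w (y T v k l)))) ⟩
        Q j (suc m) ∎
        where
        y : Carrier → Carrier → ℕ → ℕ → Carrier
        y x s k l = δ l * ((x ^ k - R ^ k) * s ^ l) * φ (g k l j)
      step₃ : ∀ k m → AD m (λ j l → q k j l) ≈ closedTerm S T R k m
      step₃ k m = begin
        AD m (λ j l → q k j l)
          ≈⟨ AD-cong′ m (λ j l →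
               solve 11 (λ e U v d s r t W p w V → e :* U :* (v :* (d :* ((s :- r) :* W) :* p) :- w :* (d :* ((t :- r) :* V) :* p))
                  := v :* (s :- r) :* (e :* d :* p :* (U :* W)) :+ (:- (w :* (t :- r))) :* (e :* d :* p :* (U :* V)))
                refl (δ j) (u ^ j) v (δ l) (S ^ k) (R ^ k) (T ^ k) (w ^ l) _ w (v ^ l)) ⟩
        AD m (λ j l → v * (S ^ k - R ^ k) * (δ j * δ l * φ (g k l j) * (u ^ j * w ^ l))
                    + - (w * (T ^ k - R ^ k)) * (δ j * δ l * φ (g k l j) * (u ^ j * v ^ l)))
          ≈⟨ trans (AD-+ m _ _) (+-cong (sym (AD-*ˡ m _ _)) (sym (AD-*ˡ m _ _))) ⟩
        v * (S ^ k - R ^ k) * Gₖ k m u w + - (w * (T ^ k - R ^ k)) * Gₖ k m u v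
          ≈⟨ solve 7 (λ v s r a w t b → v :* (s :- r) :* a :+ (:- (w :* (t :- r))) :* b
                     := s :* (v :* a) :- t :* (w :* b) :+ r :* (w :* b :- v :* a)) refl v (S ^ k) (R ^ k) _ w (T ^ k) _ ⟩
        S ^ k * (v * Gₖ k m u w) - T ^ k * (w * Gₖ k m u v) + R ^ k * (w * Gₖ k m u v - v * Gₖ k m u w)
          ≈⟨ +-congˡ (*-congˡ (trans (+-congʳ key) (solve 2 (λ a b → a :+ b :- a := b) refl _ _))) ⟩
        closedTerm S T R k m ∎
        where
        u+v≈w : u + v ≈ w
        u+v≈w = solve 3 (λ S T R → (S :- T) :+ (T :- R) := S :- R) refl S T R
        key : w * Gₖ k m u v ≈ v * Gₖ k m u w + u * Gₖ k m v w
        key = begin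
          w * Gₖ k m u v         ≈⟨ *-congʳ u+v≈w ⟨
          (u + v) * Gₖ k m u v   ≈⟨ G-key (f₀ k) (f₁ k) (f₂ k) m u v ⟩
          v * Gₖ k m u (u + v) + u * Gₖ k m v (u + v)
            ≈⟨ +-cong (*-congˡ (Gₖ-cong k m refl u+v≈w)) (*-congˡ (Gₖ-cong k m refl u+v≈w)) ⟩
          v * Gₖ k m u w + u * Gₖ k m v w ∎

    -- The swap exchanges S - T with S - R and negates T - R. `G-sym` and `G-even` restore the
    -- arguments of `G`, which leaves the sign of T - R and the exchange of the last two terms.
    closedTerm-antisym : ∀ S T R k m → closedTerm S R T k m ≈ - 1# * closedTerm S T R k m
    closedTerm-antisym S T R k m = begin
      S ^ k * ((R - T) * Gₖ k m w u) - R ^ k * (u * Gₖ k m w (R - T)) + T ^ k * (w * Gₖ k m (R - T) u)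
        ≈⟨ +-cong (+-cong (*-congˡ (*-cong R-T (sym′ w u))) (-‿cong (*-congˡ (*-congˡ
             (trans (sym′ w (R - T)) (flip-sign w))))))
             (*-congˡ (*-congˡ (trans (flip-sign u) (sym′ v u)))) ⟩
      S ^ k * (- v * Gₖ k m u w) - R ^ k * (u * Gₖ k m v w) + T ^ k * (w * Gₖ k m u v)
        ≈⟨ solve 9 (λ s v a r u b t w c → s :* ((:- v) :* a) :- r :* (u :* b) :+ t :* (w :* c)
                   := :- :1 :* (s :* (v :* a) :- t :* (w :* c) :+ r :* (u :* b)))
             refl (S ^ k) v _ (R ^ k) u _ (T ^ k) w _ ⟩
      - 1# * closedTerm S T R k m ∎
      where
      u = S - T
      v = T - R
      w = S - R
      sym′ = G-sym (f₀ k) (f₁ k) (f₂ k) m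
      R-T : R - T ≈ - v
      R-T = solve 2 (λ R T → R :- T := :- (T :- R)) refl R T
      flip-sign : ∀ x → Gₖ k m (R - T) x ≈ Gₖ k m v x
      flip-sign x = trans (Gₖ-cong k m R-T refl) (G-even (f₀ k) (f₁ k) (f₂ k) m v x)

    -- The factor (S - T)(S - R)(T - R) and the closed form both change sign when T and R are
    -- swapped.
    generating-symmetric : ∀ n S T R →
      (S - T) * ((S - R) * ((T - R) * (generating (triple f₀ f₁ f₂) n S T R - generating (triple f₀ f₁ f₂) n S R T))) ≈ 0#
    generating-symmetric n S T R = begin
      (S - T) * ((S - R) * ((T - R) * (X - Y)))
        ≈⟨ solve 5 (λ S T R X Y → (S :- T) :* ((S :- R) :* ((T :- R) :* (X :- Y)))
             := (S :- R) :* (T :- R) :* ((S :- T) :* X) :+ (S :- T) :* (R :- T) :* ((S :- R) :* Y)) refl S T R X Y ⟩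
      (S - R) * (T - R) * ((S - T) * X) + (S - T) * (R - T) * ((S - R) * Y)
        ≈⟨ +-cong (generating-closed n S T R) (trans (generating-closed n S R T)
             (trans (AD-cong′ (suc (suc n)) (closedTerm-antisym S T R)) (sym (AD-*ˡ (suc (suc n)) (- 1#) (closedTerm S T R))))) ⟩
      C + - 1# * C
        ≈⟨ solve 1 (λ c → c :+ :- :1 :* c := :0) refl C ⟩
      0# ∎
      where
      X = generating (triple f₀ f₁ f₂) n S T R
      Y = generating (triple f₀ f₁ f₂) n S R T
      C = AD (suc (suc n)) (closedTerm S T R)

-- Extraction of coefficients

module CoefficientExtraction (A : CommutativeRing 0ℓ 0ℓ) where
  open CommutativeRing A hiding (zero)
  open PowerSeries A
  open AntidiagonalSums A
  private module ADP = AntidiagonalSums powerSeries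
  open import Algebra.Properties.Semiring.Exp semiring using (_^_)
  open import Algebra.Properties.Semiring.Exp P.semiring using () renaming (_^_ to _^ᴾ_)
  open IntegerCoefficientSolver powerSeries using (solve; _:=_; _:*_)

  const-AD : ∀ n f → const (AD n f) ≋ ADP.AD n (λ i j → const (f i j))
  const-AD zero    f = P.refl
  const-AD (suc n) f = P.trans (const-+ _ _) (P.+-congˡ (const-AD n _))

  const-^ : ∀ a n → const (a ^ n) ≋ const a ^ᴾ n
  const-^ a zero    = P.refl
  const-^ a (suc n) = P.trans (const-* _ _) (P.*-congˡ {const a} (const-^ a n))

  extract : ∀ n (z : ℕ → ℕ → Carrier) m k → m ℕ.+ k ≡ n →
            ADP.AD n (λ i j → const (z i j) ⊛ X ^ᴾ j) k ≈ z m k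
  extract n z m k eq = trans (ADP.AD-comm n (λ i j → const (z i j) ⊛ X ^ᴾ j) k)
                             (extract′ n z m k (≡.trans (ℕ.+-comm k m) eq))
    where
    extract′ : ∀ n (z : ℕ → ℕ → Carrier) m k → k ℕ.+ m ≡ n →
               ADP.AD n (λ j i → const (z i j) ⊛ X ^ᴾ j) k ≈ z m k
    extract′ zero    z zero zero ≡.refl = *-identityʳ _
    extract′ (suc n) z m k eq = trans
      (+-cong (trans (const-⊛ _ _ k) refl)
        (trans (ADP.AD-cong′ n (λ j i → solve 3 (λ c x y → c :* (x :* y) := x :* (c :* y)) P.refl (const (z i (suc j))) X (X ^ᴾ j)) k)
        (sym (ADP.AD-*ˡ n X (λ j i → const (z i (suc j)) ⊛ X ^ᴾ j) k))))
      (finish k eq)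
      where
      rest = ADP.AD n (λ j i → const (z i (suc j)) ⊛ X ^ᴾ j)
      finish : ∀ k → k ℕ.+ m ≡ suc n → z (suc n) 0 * const 1# k + (X ⊛ rest) k ≈ z m k
      finish zero    ≡.refl = trans (+-cong (*-identityʳ _) (zeroˡ _)) (+-identityʳ _)
      finish (suc k) eq     = trans (+-cong (zeroʳ _) (X-⊛-suc rest k))
        (trans (+-identityˡ _) (extract′ n (λ i j → z i (suc j)) m k (ℕ.suc-injective eq)))

-- Symmetry of the triple product

module TripleSymmetry {d : ℕ} (F : FiniteField (suc (suc d))) where
  open TripleProduct F
  private
    module F = FieldFacts F
    module P₁ = PowerSeries F.fieldRing
    module P₂ = PowerSeries P₁.powerSeries
    module E₁ = CoefficientExtraction F.fieldRing
    module E₂ = CoefficientExtraction P₁.powerSeries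
    module AD₁ = AntidiagonalSums P₁.powerSeries

  twoVariables : FieldAlgebra F
  twoVariables = record
    { ring = P₂.powerSeries
    ; φ    = λ a → P₂.const (P₁.const a)
    ; φ-+  = λ a b → P₂.P.trans (P₂.const-cong (P₁.const-+ a b)) (P₂.const-+ _ _)
    ; φ-*  = λ a b → P₂.P.trans (P₂.const-cong (P₁.const-* a b)) (P₂.const-* _ _)
    ; φ-1  = P₂.P.refl
    }

  open FieldAlgebra twoVariables renaming (ring to K)
  open CommutativeRing K using (_-_; _≈_; 1#; refl; sym; trans; *-congˡ; *-congʳ; *-cong; +-congʳ; +-identityˡ)
  open AntidiagonalSums K
  open import Algebra.Properties.Semiring.Exp (CommutativeRing.semiring K) using (_^_)
  open import Algebra.Properties.Semiring.Exp P₁.P.semiring using () renaming (_^_ to _^₁_)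
  open TripleGenerating twoVariables
  open IntegerCoefficientSolver K using (solve; _:=_; _:-_; _:+_)

  -- `generating` is homogeneous in S, T, R, so S = 1 loses no coefficient and two variables
  -- suffice.
  T R : CommutativeRing.Carrier K
  T = P₂.const P₁.X
  R = P₂.X

  generating-coefficient : ∀ e n a b c → a ℕ.+ b ℕ.+ c ≡ n → generating e n 1# T R c b ≡ e a b c
  generating-coefficient e n a b c eq = ≡.trans
    (AD-cong′ n (λ m c → *-congʳ {R ^ c} (inside m c)) c b)
    (≡.trans (E₂.extract n row (a ℕ.+ b) c eq b) (E₁.extract (a ℕ.+ b) (λ a b → e a b c) a b ≡.refl))
    where
    row : ℕ → ℕ → P₁.Series
    row m c = AD₁.AD m (λ a b → P₁.const (e a b c) P₁.⊛ P₁.X ^₁ b)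
    inside : ∀ m c → AD m (λ a b → P₂.const (P₁.const (e a b c)) P₂.⊛ (1# ^ a P₂.⊛ T ^ b)) ≈ P₂.const (row m c)
    inside m c = trans (AD-cong′ m λ a b → trans
        (*-congˡ {P₂.const (P₁.const (e a b c))} (trans (*-cong (one^ a) (sym (E₂.const-^ P₁.X b)))
                                                         (P₂.⊛-identityˡ (P₂.const (P₁.X ^₁ b)))))
        (sym (P₂.const-* (P₁.const (e a b c)) (P₁.X ^₁ b))))
      (sym (E₂.const-AD m _))
      where
      one^ : ∀ a → 1# ^ a ≈ 1#
      one^ zero    = refl
      one^ (suc a) = trans (P₂.⊛-identityˡ (1# ^ a)) (one^ a)

  private
    1-nonZeroDivisor : NonZeroDivisor F.fieldRing F.1#
    1-nonZeroDivisor f eq = ≡.trans (≡.sym (F.*-identityˡ f)) eq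

    X-nonZeroDivisor : NonZeroDivisor P₁.powerSeries P₁.X
    X-nonZeroDivisor f eq n = ≡.trans (≡.sym (P₁.X-⊛-suc f n)) (eq (suc n))

    1-T : NonZeroDivisor K (1# - T)
    1-T f eq = const-nonZeroDivisor P₁.powerSeries
      (const-X-nonZeroDivisor F.fieldRing 1-nonZeroDivisor) f
      (trans (*-congʳ {f} (trans (P₂.const-+ P₁.P.1# (P₁.P.- P₁.X)) difference)) eq)
      where
      difference : P₂.const P₁.P.1# P₂.P.+ P₂.const (P₁.P.- P₁.X) ≈ 1# - T
      difference zero    = λ _ → ≡.refl
      difference (suc n) = λ _ → ≡.cong (F._+_ F.0#) (≡.sym (≡.trans (≡.sym (F.+-identityˡ _)) (F.-‿inverseʳ F.0#)))

    1-R : NonZeroDivisor K (1# - R)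
    1-R = const-X-nonZeroDivisor P₁.powerSeries λ f eq → P₁.P.trans (P₁.P.sym (P₁.P.*-identityˡ f)) eq

    T-R : NonZeroDivisor K (T - R)
    T-R = const-X-nonZeroDivisor P₁.powerSeries X-nonZeroDivisor

  -- None of 1 - T, 1 - R, T - R is a zero divisor, so `generating-symmetric` cancels down to an
  -- equality of series, to be read off coefficient by coefficient.
  triple-swap : ∀ f₀ f₁ f₂ a b c → triple f₀ f₁ f₂ a b c ≡ triple f₀ f₁ f₂ a c b
  triple-swap f₀ f₁ f₂ a b c = ≡.trans (≡.sym (generating-coefficient e n a b c ≡.refl))
    (≡.trans (equal c b) (≡.trans (generating-swap e n 1# T R c b) (generating-coefficient (λ a b c → e a c b) n a b c ≡.refl)))
    where
    e = triple f₀ f₁ f₂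
    n = a ℕ.+ b ℕ.+ c
    equal : generating e n 1# T R ≈ generating e n 1# R T
    equal = trans (solve 2 (λ x y → x := (x :- y) :+ y) refl X Y)
      (trans (+-congʳ {Y} (T-R (X - Y) (1-R _ (1-T _ (generating-symmetric f₀ f₁ f₂ n 1# T R))))) (+-identityˡ Y))
      where
      X = generating e n 1# T R
      Y = generating e n 1# R T

open import Defs hiding (_⋄_)

-- Linear combinations of words and linear functionals

module Functionals {d : ℕ} (F : FiniteField (suc (suc d))) where
  open ≡ using (refl; sym; trans)
  open FieldFacts F hiding (_≈_)
  open AntidiagonalSums fieldRing
  open IntegerCoefficientSolver fieldRing using (solve; _:=_; _:+_; _:*_; :-_; :0; :1)
  open ≡.≡-Reasoning

  W L : Set
  W = Word F
  L = Lin F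

  -- Linear combinations are compared through the linear functionals on 𝔇,
  -- given by arbitrary functions on words.
  ⟪_⟫ : L → (W → Carrier) → Carrier
  ⟪ [] ⟫          φ = 0#
  ⟪ (c , u) ∷ x ⟫ φ = c * φ u + ⟪ x ⟫ φ

  infix 4 _∼_
  _∼_ : L → L → Set
  x ∼ y = ∀ φ → ⟪ x ⟫ φ ≡ ⟪ y ⟫ φ

  ⟪⟫-cong : ∀ x {φ ψ} → (∀ u → φ u ≡ ψ u) → ⟪ x ⟫ φ ≡ ⟪ x ⟫ ψ
  ⟪⟫-cong []            eq = refl
  ⟪⟫-cong ((c , u) ∷ x) eq = cong₂ (λ a b → c * a + b) (eq u) (⟪⟫-cong x eq)

  ⟪word⟫ : ∀ u φ → ⟪ (1# , u) ∷ [] ⟫ φ ≡ φ u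
  ⟪word⟫ u φ = solve 1 (λ x → :1 :* x :+ :0 := x) refl (φ u)

  ⟪++⟫ : ∀ x y φ → ⟪ x ++ y ⟫ φ ≡ ⟪ x ⟫ φ + ⟪ y ⟫ φ
  ⟪++⟫ []            y φ = sym (+-identityˡ _)
  ⟪++⟫ ((c , u) ∷ x) y φ = trans (cong (c * φ u +_) (⟪++⟫ x y φ)) (sym (+-assoc _ _ _))

  ⟪•⟫ : ∀ c x φ → ⟪ _•_ F c x ⟫ φ ≡ c * ⟪ x ⟫ φ
  ⟪•⟫ c []            φ = sym (zeroʳ c)
  ⟪•⟫ c ((e , u) ∷ x) φ = trans (cong (c * e * φ u +_) (⟪•⟫ c x φ))
    (solve 4 (λ c e p s → c :* e :* p :+ c :* s := c :* (e :* p :+ s)) refl c e _ _)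

  ⟪pre⟫ : ∀ ℓ x φ → ⟪ pre F ℓ x ⟫ φ ≡ ⟪ x ⟫ (φ ∘ (ℓ ∷_))
  ⟪pre⟫ ℓ []            φ = refl
  ⟪pre⟫ ℓ ((c , u) ∷ x) φ = cong (c * φ (ℓ ∷ u) +_) (⟪pre⟫ ℓ x φ)

  ⟪lin⟫ : ∀ f x φ → ⟪ lin F f x ⟫ φ ≡ ⟪ x ⟫ (λ u → ⟪ f u ⟫ φ)
  ⟪lin⟫ f []            φ = refl
  ⟪lin⟫ f ((c , u) ∷ x) φ = trans (⟪++⟫ (_•_ F c (f u)) _ φ) (cong₂ _+_ (⟪•⟫ c (f u) φ) (⟪lin⟫ f x φ))

  ⟪⟫-+ : ∀ x φ ψ → ⟪ x ⟫ (λ u → φ u + ψ u) ≡ ⟪ x ⟫ φ + ⟪ x ⟫ ψ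
  ⟪⟫-+ []            φ ψ = sym (+-identityˡ 0#)
  ⟪⟫-+ ((c , u) ∷ x) φ ψ = trans (cong (c * (φ u + ψ u) +_) (⟪⟫-+ x φ ψ))
    (solve 5 (λ c a b s t → c :* (a :+ b) :+ (s :+ t) := (c :* a :+ s) :+ (c :* b :+ t)) refl c _ _ _ _)

  ⟪⟫-*ˡ : ∀ x a φ → ⟪ x ⟫ (λ u → a * φ u) ≡ a * ⟪ x ⟫ φ
  ⟪⟫-*ˡ []            a φ = sym (zeroʳ a)
  ⟪⟫-*ˡ ((c , u) ∷ x) a φ = trans (cong (c * (a * φ u) +_) (⟪⟫-*ˡ x a φ))
    (solve 4 (λ c a p s → c :* (a :* p) :+ a :* s := a :* (c :* p :+ s)) refl c a _ _)

  ⟪⟫-0 : ∀ x → ⟪ x ⟫ (λ _ → 0#) ≡ 0#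
  ⟪⟫-0 x = trans (⟪⟫-cong x λ _ → sym (zeroˡ 0#)) (trans (⟪⟫-*ˡ x 0# (λ _ → 0#)) (zeroˡ _))

  ⟪⟫-swap : ∀ x y (ψ : W → W → Carrier) →
            ⟪ x ⟫ (λ u → ⟪ y ⟫ (ψ u)) ≡ ⟪ y ⟫ (λ v → ⟪ x ⟫ (λ u → ψ u v))
  ⟪⟫-swap []            y ψ = sym (⟪⟫-0 y)
  ⟪⟫-swap ((c , u) ∷ x) y ψ = begin
    c * ⟪ y ⟫ (ψ u) + ⟪ x ⟫ (λ u → ⟪ y ⟫ (ψ u))
      ≡⟨ cong₂ _+_ (sym (⟪⟫-*ˡ y c (ψ u))) (⟪⟫-swap x y ψ) ⟩
    ⟪ y ⟫ (λ v → c * ψ u v) + ⟪ y ⟫ (λ v → ⟪ x ⟫ (λ u → ψ u v))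
      ≡⟨ ⟪⟫-+ y _ _ ⟨
    ⟪ y ⟫ (λ v → c * ψ u v + ⟪ x ⟫ (λ u → ψ u v)) ∎

  ⟪⟫-AD : ∀ x n (ψ : ℕ → ℕ → W → Carrier) →
          ⟪ x ⟫ (λ u → AD n (λ i j → ψ i j u)) ≡ AD n (λ i j → ⟪ x ⟫ (ψ i j))
  ⟪⟫-AD x zero    ψ = refl
  ⟪⟫-AD x (suc n) ψ = trans (⟪⟫-+ x (ψ 0 (suc n)) _) (cong (⟪ x ⟫ (ψ 0 (suc n)) +_) (⟪⟫-AD x n λ i j → ψ (suc i) j))

  ⟪bilin⟫ : ∀ f x y φ → ⟪ bilin F f x y ⟫ φ ≡ ⟪ x ⟫ (λ u → ⟪ y ⟫ (λ v → ⟪ f u v ⟫ φ))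
  ⟪bilin⟫ f []            y φ = refl
  ⟪bilin⟫ f ((c , u) ∷ x) y φ = trans (⟪++⟫ (row y) _ φ) (cong₂ _+_ (⟪row⟫ y) (⟪bilin⟫ f x y φ))
    where
    row : L → L
    row = concatMap (λ { (e , v) → _•_ F (c * e) (f u v) })
    ⟪row⟫ : ∀ y → ⟪ row y ⟫ φ ≡ c * ⟪ y ⟫ (λ v → ⟪ f u v ⟫ φ)
    ⟪row⟫ []            = sym (zeroʳ c)
    ⟪row⟫ ((e , v) ∷ y) = trans (⟪++⟫ (_•_ F (c * e) (f u v)) _ φ)
      (trans (cong₂ _+_ (⟪•⟫ (c * e) (f u v) φ) (⟪row⟫ y))
      (solve 4 (λ c e p s → c :* e :* p :+ c :* s := c :* (e :* p :+ s)) refl c e _ _))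

  indicator : W → W → Carrier
  indicator w u = if does (_≟W_ F u w) then 1# else 0#

  coeff-⟪⟫ : ∀ w x → coeff F w x ≡ ⟪ x ⟫ (indicator w)
  coeff-⟪⟫ w []            = refl
  coeff-⟪⟫ w ((c , u) ∷ x) with does (_≟W_ F u w)
  ... | true  = cong₂ _+_ (sym (*-identityʳ c)) (coeff-⟪⟫ w x)
  ... | false = trans (coeff-⟪⟫ w x) (solve 2 (λ c s → s := c :* :0 :+ s) refl c _)

  remove : W → L → L
  remove w []            = []
  remove w ((c , u) ∷ x) with does (_≟W_ F u w)
  ... | true  = remove w x
  ... | false = (c , u) ∷ remove w x

  length-remove : ∀ w x → length (remove w x) ℕ.≤ length x
  length-remove w []            = z≤n
  length-remove w ((c , u) ∷ x) with does (_≟W_ F u w)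
  ... | true  = ℕ.m≤n⇒m≤1+n (length-remove w x)
  ... | false = s≤s (length-remove w x)

  ⟪remove⟫ : ∀ w x φ → ⟪ x ⟫ φ ≡ coeff F w x * φ w + ⟪ remove w x ⟫ φ
  ⟪remove⟫ w []            φ = solve 1 (λ p → :0 := :0 :* p :+ :0) refl (φ w)
  ⟪remove⟫ w ((c , u) ∷ x) φ with _≟W_ F u w
  ... | yes refl = trans (cong (c * φ w +_) (⟪remove⟫ w x φ))
        (solve 4 (λ c k p s → c :* p :+ (k :* p :+ s) := (c :+ k) :* p :+ s) refl c _ (φ w) _)
  ... | no  _    = trans (cong (c * φ u +_) (⟪remove⟫ w x φ))
        (solve 3 (λ p q s → p :+ (q :+ s) := q :+ (p :+ s)) refl (c * φ u) _ _)

  -- All occurrences of the first word together contribute its coefficient, which is 0; removing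
  -- them leaves a shorter list. The bound n carries this recursion, which is not structural in the
  -- list.
  ≈0⇒∼0 : ∀ n x → length x ℕ.≤ n → _≈_ F x [] → ∀ φ → ⟪ x ⟫ φ ≡ 0#
  ≈0⇒∼0 n       []            _         x≈0 φ = refl
  ≈0⇒∼0 (suc n) ((c , u) ∷ x) (s≤s len) x≈0 φ = begin
    ⟪ (c , u) ∷ x ⟫ φ
      ≡⟨ ⟪remove⟫ u ((c , u) ∷ x) φ ⟩
    coeff F u ((c , u) ∷ x) * φ u + ⟪ rest ⟫ φ
      ≡⟨ cong₂ (λ a b → a * φ u + b) (x≈0 u) (≈0⇒∼0 n rest short rest≈0 φ) ⟩
    0# * φ u + 0#
      ≡⟨ solve 1 (λ p → :0 :* p :+ :0 := :0) refl (φ u) ⟩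
    0# ∎
    where
    rest = remove u ((c , u) ∷ x)
    short : length rest ℕ.≤ n
    short rewrite dec-true (_≟W_ F u u) refl = ℕ.≤-trans (length-remove u x) len
    rest≈0 : _≈_ F rest []
    rest≈0 w with _≟W_ F u w
    ... | no u≢w = begin
      coeff F w rest                                   ≡⟨ coeff-⟪⟫ w rest ⟩
      ⟪ rest ⟫ (indicator w)                           ≡⟨ solve 2 (λ k s → s := k :* :0 :+ s) refl (coeff F u ((c , u) ∷ x)) _ ⟩
      coeff F u ((c , u) ∷ x) * 0# + ⟪ rest ⟫ (indicator w)
        ≡⟨ cong (λ b → coeff F u ((c , u) ∷ x) * (if b then 1# else 0#) + ⟪ rest ⟫ (indicator w)) (dec-false (_≟W_ F u w) u≢w) ⟨
      coeff F u ((c , u) ∷ x) * indicator w u + ⟪ rest ⟫ (indicator w) ≡⟨ ⟪remove⟫ u ((c , u) ∷ x) (indicator w) ⟨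
      ⟪ (c , u) ∷ x ⟫ (indicator w)                    ≡⟨ coeff-⟪⟫ w ((c , u) ∷ x) ⟨
      coeff F w ((c , u) ∷ x)                          ≡⟨ x≈0 w ⟩
      0#                                               ∎
    ... | yes refl = removed ((c , u) ∷ x)
      where
      removed : ∀ y → coeff F u (remove u y) ≡ 0#
      removed []            = refl
      removed ((e , v) ∷ y) with does (_≟W_ F v u) in eq
      ... | true  = removed y
      ... | false rewrite eq = removed y

  ≈⇒∼ : ∀ x y → _≈_ F x y → x ∼ y
  ≈⇒∼ x y x≈y φ = begin
    ⟪ x ⟫ φ                                ≡⟨ solve 2 (λ a b → a := a :+ :- :1 :* b :+ b) refl _ (⟪ y ⟫ φ) ⟩
    ⟪ x ⟫ φ + - 1# * ⟪ y ⟫ φ + ⟪ y ⟫ φ     ≡⟨ cong (_+ ⟪ y ⟫ φ) (trans (sym (difference φ)) (≈0⇒∼0 _ z ℕ.≤-refl z≈0 φ)) ⟩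
    0# + ⟪ y ⟫ φ                           ≡⟨ +-identityˡ _ ⟩
    ⟪ y ⟫ φ                                ∎
    where
    z = x ++ ⊖_ F y
    difference : ∀ φ → ⟪ z ⟫ φ ≡ ⟪ x ⟫ φ + - 1# * ⟪ y ⟫ φ
    difference φ = trans (⟪++⟫ x _ φ) (cong (⟪ x ⟫ φ +_) (⟪•⟫ (- 1#) y φ))
    z≈0 : _≈_ F z []
    z≈0 w = begin
      coeff F w z                                                 ≡⟨ trans (coeff-⟪⟫ w z) (difference (indicator w)) ⟩
      ⟪ x ⟫ (indicator w) + - 1# * ⟪ y ⟫ (indicator w)            ≡⟨ cong₂ (λ a b → a + - 1# * b) (coeff-⟪⟫ w x) (coeff-⟪⟫ w y) ⟨
      coeff F w x + - 1# * coeff F w y                            ≡⟨ cong (λ a → a + - 1# * coeff F w y) (x≈y w) ⟩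
      coeff F w y + - 1# * coeff F w y                            ≡⟨ solve 1 (λ a → a :+ :- :1 :* a := :0) refl _ ⟩
      0#                                                          ∎

  ∼⇒≈ : ∀ x y → x ∼ y → _≈_ F x y
  ∼⇒≈ x y x∼y w = trans (coeff-⟪⟫ w x) (trans (x∼y (indicator w)) (sym (coeff-⟪⟫ w y)))

  -- Algebra laws of a bilinear product from laws on words

  module _ (f : W → W → L)
           (f-identityˡ : ∀ v φ → ⟪ f [] v ⟫ φ ≡ φ v)
           (f-comm : ∀ u v → f u v ∼ f v u)
           (f-assoc : ∀ u v w φ → ⟪ f u v ⟫ (λ t → ⟪ f t w ⟫ φ) ≡ ⟪ f v w ⟫ (λ t → ⟪ f u t ⟫ φ))
           where

    private
      infixl 7 _∙_
      _∙_ : L → L → L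
      _∙_ = bilin F f

    ∙-comm : ∀ x y → x ∙ y ∼ y ∙ x
    ∙-comm x y φ = begin
      ⟪ x ∙ y ⟫ φ                                   ≡⟨ ⟪bilin⟫ f x y φ ⟩
      ⟪ x ⟫ (λ u → ⟪ y ⟫ (λ v → ⟪ f u v ⟫ φ))       ≡⟨ ⟪⟫-swap x y _ ⟩
      ⟪ y ⟫ (λ v → ⟪ x ⟫ (λ u → ⟪ f u v ⟫ φ))       ≡⟨ ⟪⟫-cong y (λ v → ⟪⟫-cong x (λ u → f-comm u v φ)) ⟩
      ⟪ y ⟫ (λ v → ⟪ x ⟫ (λ u → ⟪ f v u ⟫ φ))       ≡⟨ ⟪bilin⟫ f y x φ ⟨
      ⟪ y ∙ x ⟫ φ                                   ∎

    ∙-congˡ : ∀ x {y z} → y ∼ z → x ∙ y ∼ x ∙ z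
    ∙-congˡ x {y} {z} y∼z φ = trans (⟪bilin⟫ f x y φ)
      (trans (⟪⟫-cong x (λ u → y∼z (λ v → ⟪ f u v ⟫ φ))) (sym (⟪bilin⟫ f x z φ)))

    ∙-assoc : ∀ x y z → (x ∙ y) ∙ z ∼ x ∙ (y ∙ z)
    ∙-assoc x y z φ = begin
      ⟪ (x ∙ y) ∙ z ⟫ φ
        ≡⟨ trans (⟪bilin⟫ f (x ∙ y) z φ) (⟪bilin⟫ f x y _) ⟩
      ⟪ x ⟫ (λ u → ⟪ y ⟫ (λ v → ⟪ f u v ⟫ (λ t → ⟪ z ⟫ (λ w → ⟪ f t w ⟫ φ))))
        ≡⟨ ⟪⟫-cong x (λ u → ⟪⟫-cong y (λ v → trans (⟪⟫-swap (f u v) z _) (⟪⟫-cong z (λ w → f-assoc u v w φ)))) ⟩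
      ⟪ x ⟫ (λ u → ⟪ y ⟫ (λ v → ⟪ z ⟫ (λ w → ⟪ f v w ⟫ (λ t → ⟪ f u t ⟫ φ))))
        ≡⟨ trans (⟪bilin⟫ f x (y ∙ z) φ) (⟪⟫-cong x (λ u → ⟪bilin⟫ f y z _)) ⟨
      ⟪ x ∙ (y ∙ z) ⟫ φ ∎

    ∙-identityˡ : ∀ x → 1D F ∙ x ∼ x
    ∙-identityˡ x φ = trans (⟪bilin⟫ f (1D F) x φ) (trans (⟪word⟫ [] (λ u → ⟪ x ⟫ (λ v → ⟪ f u v ⟫ φ))) (⟪⟫-cong x (λ v → f-identityˡ v φ)))

    ∙-distribˡ : ∀ x y z → x ∙ (y ++ z) ∼ x ∙ y ++ x ∙ z
    ∙-distribˡ x y z φ = begin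
      ⟪ x ∙ (y ++ z) ⟫ φ
        ≡⟨ trans (⟪bilin⟫ f x (y ++ z) φ) (⟪⟫-cong x (λ u → ⟪++⟫ y z _)) ⟩
      ⟪ x ⟫ (λ u → ⟪ y ⟫ (λ v → ⟪ f u v ⟫ φ) + ⟪ z ⟫ (λ v → ⟪ f u v ⟫ φ))
        ≡⟨ ⟪⟫-+ x _ _ ⟩
      ⟪ x ⟫ (λ u → ⟪ y ⟫ (λ v → ⟪ f u v ⟫ φ)) + ⟪ x ⟫ (λ u → ⟪ z ⟫ (λ v → ⟪ f u v ⟫ φ))
        ≡⟨ trans (⟪++⟫ (x ∙ y) (x ∙ z) φ) (cong₂ _+_ (⟪bilin⟫ f x y φ) (⟪bilin⟫ f x z φ)) ⟨
      ⟪ x ∙ y ++ x ∙ z ⟫ φ ∎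

    ++-comm : ∀ x y → x ++ y ∼ y ++ x
    ++-comm x y φ = trans (⟪++⟫ x y φ) (trans (+-comm _ _) (sym (⟪++⟫ y x φ)))

    ++-cong : ∀ {x x′ y y′} → x ∼ x′ → y ∼ y′ → x ++ y ∼ x′ ++ y′
    ++-cong {x} {x′} {y} {y′} p q φ = trans (⟪++⟫ x y φ) (trans (cong₂ _+_ (p φ) (q φ)) (sym (⟪++⟫ x′ y′ φ)))

    ⊖-inverseʳ : ∀ x → x ++ ⊖_ F x ∼ []
    ⊖-inverseʳ x φ = trans (⟪++⟫ x _ φ) (trans (cong (⟪ x ⟫ φ +_) (⟪•⟫ (- 1#) x φ))
      (solve 1 (λ a → a :+ :- :1 :* a := :0) refl _))

    •-assocˡ : ∀ c x y → _•_ F c (x ∙ y) ∼ _•_ F c x ∙ y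
    •-assocˡ c x y φ = trans (⟪•⟫ c (x ∙ y) φ) (trans (cong (c *_) (⟪bilin⟫ f x y φ))
      (sym (trans (⟪bilin⟫ f (_•_ F c x) y φ) (⟪•⟫ c x _))))

    isCommAlgebra : IsCommAlgebra F _∙_
    isCommAlgebra = record
      { isRing = record
        { +-isAbelianGroup = record
          { isGroup = record
            { isMonoid = record
              { isSemigroup = record
                { isMagma = record
                  { isEquivalence = record
                    { refl  = λ _ → refl
                    ; sym   = λ p w → sym (p w)
                    ; trans = λ p q w → trans (p w) (q w)
                    }
                  ; ∙-cong = λ {x} {x′} {y} {y′} p q → ∼⇒≈ (x ++ y) (x′ ++ y′) (++-cong {x} {x′} {y} {y′} (≈⇒∼ x x′ p) (≈⇒∼ y y′ q))
                  }
                ; assoc = λ x y z w → cong (coeff F w) (List.++-assoc x y z)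
                }
              ; identity = (λ _ _ → refl) , (λ x w → cong (coeff F w) (List.++-identityʳ x))
              }
            ; inverse = (λ x → ∼⇒≈ (⊖_ F x ++ x) [] λ φ → trans (++-comm (⊖_ F x) x φ) (⊖-inverseʳ x φ)) , (λ x → ∼⇒≈ (x ++ ⊖_ F x) [] (⊖-inverseʳ x))
            ; ⁻¹-cong = λ {x} {y} p → ∼⇒≈ (⊖_ F x) (⊖_ F y) λ φ →
                trans (⟪•⟫ (- 1#) x φ) (trans (cong (- 1# *_) (≈⇒∼ x y p φ)) (sym (⟪•⟫ (- 1#) y φ)))
            }
          ; comm = λ x y → ∼⇒≈ (x ++ y) (y ++ x) (++-comm x y)
          }
        ; *-cong = λ {x} {x′} {y} {y′} p q → ∼⇒≈ (x ∙ y) (x′ ∙ y′) λ φ →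
            trans (∙-congˡ x {y} {y′} (≈⇒∼ y y′ q) φ) (trans (∙-comm x y′ φ) (trans (∙-congˡ y′ {x} {x′} (≈⇒∼ x x′ p) φ) (∙-comm y′ x′ φ)))
        ; *-assoc = λ x y z → ∼⇒≈ ((x ∙ y) ∙ z) (x ∙ (y ∙ z)) (∙-assoc x y z)
        ; *-identity = (λ x → ∼⇒≈ (1D F ∙ x) x (∙-identityˡ x)) , (λ x → ∼⇒≈ (x ∙ 1D F) x λ φ → trans (∙-comm x (1D F) φ) (∙-identityˡ x φ))
        ; distrib = (λ x y z → ∼⇒≈ (x ∙ (y ++ z)) (x ∙ y ++ x ∙ z) (∙-distribˡ x y z)) , (λ x y z → ∼⇒≈ ((y ++ z) ∙ x) (y ∙ x ++ z ∙ x) λ φ →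
            trans (∙-comm (y ++ z) x φ) (trans (∙-distribˡ x y z φ)
              (++-cong {x ∙ y} {y ∙ x} {x ∙ z} {z ∙ x} (∙-comm x y) (∙-comm x z) φ)))
        }
      ; *-comm = λ x y → ∼⇒≈ (x ∙ y) (y ∙ x) (∙-comm x y)
      } , (λ c x y → ∼⇒≈ (_•_ F c (x ∙ y)) (_•_ F c x ∙ y) (•-assocˡ c x y)) , λ c x y → ∼⇒≈ (_•_ F c (x ∙ y)) (x ∙ _•_ F c y) λ φ → begin
        ⟪ _•_ F c (x ∙ y) ⟫ φ   ≡⟨ trans (⟪•⟫ c (x ∙ y) φ) (trans (cong (c *_) (∙-comm x y φ)) (sym (⟪•⟫ c (y ∙ x) φ))) ⟩
        ⟪ _•_ F c (y ∙ x) ⟫ φ   ≡⟨ •-assocˡ c y x φ ⟩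
        ⟪ _•_ F c y ∙ x ⟫ φ     ≡⟨ ∙-comm (_•_ F c y) x φ ⟩
        ⟪ x ∙ _•_ F c y ⟫ φ     ∎

-- Diamond and shuffle products of words

module WordProducts {d : ℕ} (F : FiniteField (suc (suc d))) where
  open ≡ using (refl; sym; trans)
  open FieldFacts F hiding (_≈_)
  open AntidiagonalSums fieldRing
  open IntegerCoefficientSolver fieldRing using (solve; _:=_; _:+_)
  open TripleProduct F
  open TripleSymmetry F using (triple-swap)
  open Functionals F
  open ≡.≡-Reasoning

  D-cong : ∀ a b {f f′} → (∀ i j → f i j ≡ f′ i j) → D a b f ≡ D a b f′
  D-cong a b f≡f′ = AD-cong′ (suc (a ℕ.+ b)) λ i j → cong (A j a b *_) (f≡f′ i j)

  D-+ : ∀ a b f f′ → D a b (λ i j → f i j + f′ i j) ≡ D a b f + D a b f′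
  D-+ a b f f′ = trans (AD-cong′ (suc (a ℕ.+ b)) λ i j → distribˡ (A j a b) (f i j) (f′ i j))
    (AD-+ (suc (a ℕ.+ b)) (λ i j → A j a b * f i j) (λ i j → A j a b * f′ i j))

  A-sym : ∀ j a b → A j a b ≡ A j b a
  A-sym zero    a b = refl
  A-sym (suc j) a b = Δ-sym (suc j) (suc a) (suc b)

  D-sym : ∀ a b f → D a b f ≡ D b a f
  D-sym a b f rewrite ℕ.+-comm a b = AD-cong′ (suc (b ℕ.+ a)) λ i j → cong (_* f i j) (A-sym j a b)

  ⟪⟫-D : ∀ x a b (f : ℕ → ℕ → W → Carrier) →
         ⟪ x ⟫ (λ u → D a b (λ i j → f i j u)) ≡ D a b (λ i j → ⟪ x ⟫ (f i j))
  ⟪⟫-D x a b f = trans (⟪⟫-AD x (suc (a ℕ.+ b)) λ i j u → A j a b * f i j u)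
    (AD-cong′ (suc (a ℕ.+ b)) λ i j → ⟪⟫-*ˡ x (A j a b) (f i j))

  Letter′ : Set
  Letter′ = Letter F

  pw : Letter′ → ℕ
  pw = Letter.pw

  x₁ : ℕ → Letter′
  x₁ = xj1 F

  merge : Letter′ → Letter′ → ℕ → Letter′
  merge (mkLetter a α α≢0) (mkLetter b β β≢0) i = mkLetter i (α * β) (*-nonzero α≢0 β≢0)

  mkLetter-cong : ∀ {n α β} .{α≢0 : α ≢ 0#} .{β≢0 : β ≢ 0#} → α ≡ β → _≡_ {A = Letter′} (mkLetter n α α≢0) (mkLetter n β β≢0)
  mkLetter-cong refl = refl

  merge-comm : ∀ x y i → merge x y i ≡ merge y x i
  merge-comm (mkLetter a α _) (mkLetter b β _) i = mkLetter-cong (*-comm α β)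

  merge-rotate : ∀ x y z i k → merge (merge x y i) z k ≡ merge (merge y z i) x k
  merge-rotate (mkLetter a α _) (mkLetter b β _) (mkLetter c γ _) i k =
    mkLetter-cong (trans (*-assoc α β γ) (*-comm α (β * γ)))

  merge-x₁ : ∀ l j i → merge (x₁ l) (x₁ j) i ≡ x₁ i
  merge-x₁ l j i = mkLetter-cong (*-identityˡ 1#)

  -- Shuffles the inner letter of weight j into x, with j = 0 for no letter as in `A`.
  act : L → ℕ → (W → Carrier) → Carrier
  act x zero    φ = ⟪ x ⟫ φ
  act x (suc j) φ = ⟪ x ⟫ (λ t → ⟪ ins F (x₁ j) t ⟫ φ)

  act-cong : ∀ x j {φ ψ} → (∀ u → φ u ≡ ψ u) → act x j φ ≡ act x j ψ
  act-cong x zero    eq = ⟪⟫-cong x eq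
  act-cong x (suc j) eq = ⟪⟫-cong x λ t → ⟪⟫-cong (ins F (x₁ j) t) eq

  act-∼ : ∀ x y → x ∼ y → ∀ j φ → act x j φ ≡ act y j φ
  act-∼ x y x∼y zero    φ = x∼y φ
  act-∼ x y x∼y (suc j) φ = x∼y λ t → ⟪ ins F (x₁ j) t ⟫ φ

  act-+ : ∀ x j φ ψ → act x j (λ u → φ u + ψ u) ≡ act x j φ + act x j ψ
  act-+ x zero    φ ψ = ⟪⟫-+ x φ ψ
  act-+ x (suc j) φ ψ = trans (⟪⟫-cong x λ t → ⟪⟫-+ (ins F (x₁ j) t) φ ψ)
    (⟪⟫-+ x (λ t → ⟪ ins F (x₁ j) t ⟫ φ) (λ t → ⟪ ins F (x₁ j) t ⟫ ψ))

  act-D : ∀ x j a b (f : ℕ → ℕ → W → Carrier) →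
          act x j (λ u → D a b (λ i l → f i l u)) ≡ D a b (λ i l → act x j (f i l))
  act-D x zero    a b f = ⟪⟫-D x a b f
  act-D x (suc j) a b f = trans (⟪⟫-cong x λ t → ⟪⟫-D (ins F (x₁ j) t) a b f)
    (⟪⟫-D x a b λ i l t → ⟪ ins F (x₁ j) t ⟫ (f i l))

  -- The functional of x u ⋄ y v, where M = u ⧢ v.
  ⟪_⋄_⟫ : Letter′ → Letter′ → L → (W → Carrier) → Carrier
  ⟪ x ⋄ y ⟫ M φ = D (pw x) (pw y) (λ i j → act M j (φ ∘ (merge x y i ∷_)))

  ⋄-∼ : ∀ x y M N → M ∼ N → ∀ φ → ⟪ x ⋄ y ⟫ M φ ≡ ⟪ x ⋄ y ⟫ N φ
  ⋄-∼ x y M N M∼N φ = D-cong (pw x) (pw y) λ i j → act-∼ M N M∼N j (φ ∘ (merge x y i ∷_))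

  ⋄-sym : ∀ x y M φ → ⟪ x ⋄ y ⟫ M φ ≡ ⟪ y ⋄ x ⟫ M φ
  ⋄-sym x y M φ = trans (D-sym (pw x) (pw y) λ i j → act M j (φ ∘ (merge x y i ∷_)))
    (D-cong (pw y) (pw x) λ i j → cong (λ ℓ → act M j (φ ∘ (ℓ ∷_))) (merge-comm x y i))

  ⟪concat⟫ : ∀ n (f : ℕ → ℕ) (h : ℕ → L) φ →
             ⟪ concat (map h (applyUpTo f (suc n))) ⟫ φ ≡ AD n (λ i j → ⟪ h (f i) ⟫ φ)
  ⟪concat⟫ zero    f h φ = trans (⟪++⟫ (h (f 0)) [] φ) (+-identityʳ _)
  ⟪concat⟫ (suc n) f h φ = trans (⟪++⟫ (h (f 0)) (concat (map h (applyUpTo (f ∘ suc) (suc n)))) φ)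
    (cong (⟪ h (f 0) ⟫ φ +_) (⟪concat⟫ n (f ∘ suc) h φ))

  ⟪diaCore⟫ : ∀ x y M I → (∀ j φ → ⟪ I j ⟫ φ ≡ act M (suc j) φ) →
              ∀ φ → ⟪ diaCore F x y M I ⟫ φ ≡ ⟪ x ⋄ y ⟫ M φ
  ⟪diaCore⟫ x@(mkLetter a α α≢0) y@(mkLetter b β β≢0) M I ⟪I⟫ φ = begin
    ⟪ diaCore F x y M I ⟫ φ
      ≡⟨ ⟪++⟫ (pre F (merge x y (a ℕ.+ suc b)) M) _ φ ⟩
    ⟪ pre F (merge x y (a ℕ.+ suc b)) M ⟫ φ + ⟪ concat (map h (upTo (suc n))) ⟫ φ
      ≡⟨ cong₂ _+_ first (trans (⟪concat⟫ n id h φ) (AD-cong n term)) ⟩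
    f (suc n) 0 + AD n (λ i j → f i (suc j))
      -- `diaCore` lists the leading term first; on the antidiagonal it is the last one, with j = 0.
      ≡⟨ +-comm _ _ ⟩
    AD n (λ i j → f i (suc j)) + f (suc n) 0
      ≡⟨ AD-last n f ⟨
    AD (suc n) f ∎
    where
    n = a ℕ.+ b
    h : ℕ → L
    h i = _•_ F (Δ F (suc (n ∸ i)) (suc a) (suc b)) (pre F (merge x y i) (I (n ∸ i)))
    f : ℕ → ℕ → Carrier
    f i j = A j a b * act M j (φ ∘ (merge x y i ∷_))
    first : ⟪ pre F (merge x y (a ℕ.+ suc b)) M ⟫ φ ≡ f (suc n) 0
    first = trans (⟪pre⟫ (merge x y (a ℕ.+ suc b)) M φ) (trans
      (cong (λ i → ⟪ M ⟫ (φ ∘ (merge x y i ∷_))) (ℕ.+-suc a b)) (sym (*-identityˡ (⟪ M ⟫ (φ ∘ (merge x y (suc n) ∷_))))))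
    term : ∀ i j → i ℕ.+ j ≡ n → ⟪ h i ⟫ φ ≡ f i (suc j)
    term i j eq rewrite sym eq | ℕ.m+n∸m≡n i j = trans (⟪•⟫ (Δ F (suc j) (suc a) (suc b)) (pre F (merge x y i) (I j)) φ)
      (cong (Δ F (suc j) (suc a) (suc b) *_) (trans (⟪pre⟫ (merge x y i) (I j) φ) (⟪I⟫ j (φ ∘ (merge x y i ∷_)))))

  ⟪ins-step⟫ : ∀ x y w φ → ⟪ ins F x (y ∷ w) ⟫ φ ≡
    φ (x ∷ y ∷ w) + ⟪ ins F x w ⟫ (φ ∘ (y ∷_)) + ⟪ x ⋄ y ⟫ ((1# , w) ∷ []) φ
  ⟪ins-step⟫ x y w φ = begin
    ⟪ ins F x (y ∷ w) ⟫ φ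
      ≡⟨ ⟪++⟫ ((1# , x ∷ y ∷ w) ∷ []) (pre F y (ins F x w) ++ core) φ ⟩
    ⟪ (1# , x ∷ y ∷ w) ∷ [] ⟫ φ + ⟪ pre F y (ins F x w) ++ core ⟫ φ
      ≡⟨ cong₂ _+_ (⟪word⟫ (x ∷ y ∷ w) φ) (⟪++⟫ (pre F y (ins F x w)) core φ) ⟩
    φ (x ∷ y ∷ w) + (⟪ pre F y (ins F x w) ⟫ φ + ⟪ core ⟫ φ)
      ≡⟨ +-assoc _ _ _ ⟨
    φ (x ∷ y ∷ w) + ⟪ pre F y (ins F x w) ⟫ φ + ⟪ core ⟫ φ
      ≡⟨ cong₂ (λ p q → φ (x ∷ y ∷ w) + p + q) (⟪pre⟫ y (ins F x w) φ)
           (⟪diaCore⟫ x y ((1# , w) ∷ []) (λ j → ins F (x₁ j) w) (λ j ψ → sym (⟪word⟫ w (λ t → ⟪ ins F (x₁ j) t ⟫ ψ))) φ) ⟩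
    φ (x ∷ y ∷ w) + ⟪ ins F x w ⟫ (φ ∘ (y ∷_)) + ⟪ x ⋄ y ⟫ ((1# , w) ∷ []) φ ∎
    where core = diaCore F x y ((1# , w) ∷ []) (λ j → ins F (x₁ j) w)

  ⟪dia-step⟫ : ∀ x u y v φ → ⟪ dia F (x ∷ u) (y ∷ v) ⟫ φ ≡ ⟪ x ⋄ y ⟫ (sh F u v) φ
  ⟪dia-step⟫ x u y v φ = ⟪diaCore⟫ x y (sh F u v) (λ j → lin F (ins F (x₁ j)) (sh F u v)) (λ j ψ → ⟪lin⟫ (ins F (x₁ j)) (sh F u v) ψ) φ

  ⟪sh-step⟫ : ∀ x u y v φ → ⟪ sh F (x ∷ u) (y ∷ v) ⟫ φ ≡
    ⟪ sh F u (y ∷ v) ⟫ (φ ∘ (x ∷_)) + ⟪ sh F (x ∷ u) v ⟫ (φ ∘ (y ∷_)) + ⟪ x ⋄ y ⟫ (sh F u v) φ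
  ⟪sh-step⟫ x u y v φ = begin
    ⟪ sh F (x ∷ u) (y ∷ v) ⟫ φ
      ≡⟨ trans (⟪++⟫ (pre F x (sh F u (y ∷ v))) _ φ) (cong (⟪ pre F x (sh F u (y ∷ v)) ⟫ φ +_) (⟪++⟫ (pre F y (sh F (x ∷ u) v)) _ φ)) ⟩
    ⟪ pre F x (sh F u (y ∷ v)) ⟫ φ + (⟪ pre F y (sh F (x ∷ u) v) ⟫ φ + ⟪ dia F (x ∷ u) (y ∷ v) ⟫ φ)
      ≡⟨ +-assoc _ _ _ ⟨
    ⟪ pre F x (sh F u (y ∷ v)) ⟫ φ + ⟪ pre F y (sh F (x ∷ u) v) ⟫ φ + ⟪ dia F (x ∷ u) (y ∷ v) ⟫ φ
      ≡⟨ cong₂ _+_ (cong₂ _+_ (⟪pre⟫ x (sh F u (y ∷ v)) φ) (⟪pre⟫ y (sh F (x ∷ u) v) φ)) (⟪dia-step⟫ x u y v φ) ⟩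
    ⟪ sh F u (y ∷ v) ⟫ (φ ∘ (x ∷_)) + ⟪ sh F (x ∷ u) v ⟫ (φ ∘ (y ∷_)) + ⟪ x ⋄ y ⟫ (sh F u v) φ ∎

  ⟪sh-[]ˡ⟫ : ∀ v φ → ⟪ sh F [] v ⟫ φ ≡ φ v
  ⟪sh-[]ˡ⟫ v φ = ⟪word⟫ v φ

  ⟪sh-[]ʳ⟫ : ∀ u φ → ⟪ sh F u [] ⟫ φ ≡ φ u
  ⟪sh-[]ʳ⟫ []      φ = ⟪word⟫ [] φ
  ⟪sh-[]ʳ⟫ (x ∷ u) φ = ⟪word⟫ (x ∷ u) φ

  ⟪dia-[]ʳ⟫ : ∀ u φ → ⟪ dia F u [] ⟫ φ ≡ φ u
  ⟪dia-[]ʳ⟫ []      φ = ⟪word⟫ [] φ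
  ⟪dia-[]ʳ⟫ (x ∷ u) φ = ⟪word⟫ (x ∷ u) φ

  ins-sh : ∀ x w → ins F x w ∼ sh F (x ∷ []) w
  ins-sh x []      φ = refl
  ins-sh x (y ∷ w) φ = trans (⟪ins-step⟫ x y w φ) (trans
    (cong₂ (λ p q → p + q + ⟪ x ⋄ y ⟫ (sh F [] w) φ)
      (sym (⟪sh-[]ˡ⟫ (y ∷ w) (φ ∘ (x ∷_)))) (ins-sh x w (φ ∘ (y ∷_))))
    (sym (⟪sh-step⟫ x [] y w φ)))

  sh-comm : ∀ u v → sh F u v ∼ sh F v u
  sh-comm []      v       φ = trans (⟪sh-[]ˡ⟫ v φ) (sym (⟪sh-[]ʳ⟫ v φ))
  sh-comm (x ∷ u) []      φ = refl
  sh-comm (x ∷ u) (y ∷ v) φ = begin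
    ⟪ sh F (x ∷ u) (y ∷ v) ⟫ φ
      ≡⟨ ⟪sh-step⟫ x u y v φ ⟩
    ⟪ sh F u (y ∷ v) ⟫ (φ ∘ (x ∷_)) + ⟪ sh F (x ∷ u) v ⟫ (φ ∘ (y ∷_)) + ⟪ x ⋄ y ⟫ (sh F u v) φ
      ≡⟨ cong₂ _+_ (trans (+-comm _ _) (cong₂ _+_ (sh-comm (x ∷ u) v (φ ∘ (y ∷_))) (sh-comm u (y ∷ v) (φ ∘ (x ∷_)))))
           (trans (⋄-sym x y (sh F u v) φ) (⋄-∼ y x (sh F u v) (sh F v u) (sh-comm u v) φ)) ⟩
    ⟪ sh F v (x ∷ u) ⟫ (φ ∘ (y ∷_)) + ⟪ sh F (y ∷ v) u ⟫ (φ ∘ (x ∷_)) + ⟪ y ⋄ x ⟫ (sh F v u) φ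
      ≡⟨ ⟪sh-step⟫ y v x u φ ⟨
    ⟪ sh F (y ∷ v) (x ∷ u) ⟫ φ ∎

  dia-comm : ∀ u v → dia F u v ∼ dia F v u
  dia-comm []      v       φ = trans (⟪word⟫ v φ) (sym (⟪dia-[]ʳ⟫ v φ))
  dia-comm (x ∷ u) []      φ = refl
  dia-comm (x ∷ u) (y ∷ v) φ = begin
    ⟪ dia F (x ∷ u) (y ∷ v) ⟫ φ   ≡⟨ ⟪dia-step⟫ x u y v φ ⟩
    ⟪ x ⋄ y ⟫ (sh F u v) φ       ≡⟨ trans (⋄-sym x y (sh F u v) φ) (⋄-∼ y x (sh F u v) (sh F v u) (sh-comm u v) φ) ⟩
    ⟪ y ⋄ x ⟫ (sh F v u) φ       ≡⟨ ⟪dia-step⟫ y v x u φ ⟨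
    ⟪ dia F (y ∷ v) (x ∷ u) ⟫ φ   ∎

  -- Says through functionals that only words of length at most n matter in x, so that an induction
  -- hypothesis on length can be applied under ⟪ x ⟫.
  Bounded : ℕ → L → Set
  Bounded n x = ∀ {φ ψ} → (∀ u → length u ℕ.≤ n → φ u ≡ ψ u) → ⟪ x ⟫ φ ≡ ⟪ x ⟫ ψ

  word-bounded : ∀ u → Bounded (length u) ((1# , u) ∷ [])
  word-bounded u eq = cong (λ p → 1# * p + 0#) (eq u ℕ.≤-refl)

  -- At most two letters stand in for the two removed: the merged first letter and one inner letter.
  ⋄-bounded : ∀ n x y M → Bounded n M → (∀ j t → length t ℕ.≤ n → Bounded (suc n) (ins F (x₁ j) t)) →
              ∀ {φ ψ} → (∀ u → length u ℕ.≤ suc (suc n) → φ u ≡ ψ u) → ⟪ x ⋄ y ⟫ M φ ≡ ⟪ x ⋄ y ⟫ M ψ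
  ⋄-bounded n x y M M-bounded ins-bounded {φ} {ψ} eq = D-cong (pw x) (pw y) bounded
    where
    bounded : ∀ i j → act M j (φ ∘ (merge x y i ∷_)) ≡ act M j (ψ ∘ (merge x y i ∷_))
    bounded i zero    = M-bounded λ t t≤n → eq (merge x y i ∷ t) (s≤s (ℕ.m≤n⇒m≤1+n t≤n))
    bounded i (suc j) = M-bounded λ t t≤n → ins-bounded j t t≤n λ s s≤n → eq (merge x y i ∷ s) (s≤s s≤n)

  -- The recursion is on the bound, since `⋄-bounded` asks for all words up to length n and all
  -- inner letters.
  ins-bounded : ∀ n x w → length w ℕ.≤ n → Bounded (suc n) (ins F x w)
  ins-bounded n       x []      _         eq = word-bounded (x ∷ []) λ u u≤1 → eq u (ℕ.≤-trans u≤1 (s≤s z≤n))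
  ins-bounded (suc n) x (y ∷ w) (s≤s w≤n) {φ} {ψ} eq = begin
    ⟪ ins F x (y ∷ w) ⟫ φ
      ≡⟨ ⟪ins-step⟫ x y w φ ⟩
    φ (x ∷ y ∷ w) + ⟪ ins F x w ⟫ (φ ∘ (y ∷_)) + ⟪ x ⋄ y ⟫ ((1# , w) ∷ []) φ
      ≡⟨ cong₂ _+_ (cong₂ _+_ (eq (x ∷ y ∷ w) (s≤s (s≤s w≤n)))
           (ins-bounded n x w w≤n λ t t≤n → eq (y ∷ t) (s≤s t≤n)))
           (⋄-bounded n x y ((1# , w) ∷ []) (λ e → word-bounded w λ u u≤w → e u (ℕ.≤-trans u≤w w≤n))
             (λ j t t≤n → ins-bounded n (x₁ j) t t≤n) eq) ⟩
    ψ (x ∷ y ∷ w) + ⟪ ins F x w ⟫ (ψ ∘ (y ∷_)) + ⟪ x ⋄ y ⟫ ((1# , w) ∷ []) ψ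
      ≡⟨ ⟪ins-step⟫ x y w ψ ⟨
    ⟪ ins F x (y ∷ w) ⟫ ψ ∎

  sh-bounded : ∀ u v → Bounded (length u ℕ.+ length v) (sh F u v)
  sh-bounded []      v       eq = word-bounded v eq
  sh-bounded (x ∷ u) []      eq = word-bounded (x ∷ u) λ t t≤n → eq t (ℕ.≤-trans t≤n (ℕ.m≤m+n _ 0))
  sh-bounded (x ∷ u) (y ∷ v) {φ} {ψ} eq = begin
    ⟪ sh F (x ∷ u) (y ∷ v) ⟫ φ
      ≡⟨ ⟪sh-step⟫ x u y v φ ⟩
    ⟪ sh F u (y ∷ v) ⟫ (φ ∘ (x ∷_)) + ⟪ sh F (x ∷ u) v ⟫ (φ ∘ (y ∷_)) + ⟪ x ⋄ y ⟫ (sh F u v) φ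
      ≡⟨ cong₂ _+_ (cong₂ _+_
           (sh-bounded u (y ∷ v) λ t t≤n → eq (x ∷ t) (s≤s t≤n))
           (sh-bounded (x ∷ u) v λ t t≤n → eq (y ∷ t) (s≤s (subst (length t ℕ.≤_) (sym (ℕ.+-suc (length u) (length v))) t≤n))))
           (⋄-bounded n x y (sh F u v) (sh-bounded u v) (λ j t t≤n → ins-bounded n (x₁ j) t t≤n)
             λ t t≤n → eq t (subst (length t ℕ.≤_) (cong suc (sym (ℕ.+-suc (length u) (length v)))) t≤n)) ⟩
    ⟪ sh F u (y ∷ v) ⟫ (ψ ∘ (x ∷_)) + ⟪ sh F (x ∷ u) v ⟫ (ψ ∘ (y ∷_)) + ⟪ x ⋄ y ⟫ (sh F u v) ψ
      ≡⟨ ⟪sh-step⟫ x u y v ψ ⟨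
    ⟪ sh F (x ∷ u) (y ∷ v) ⟫ ψ ∎
    where n = length u ℕ.+ length v

  -- Rotation of the triple shuffle product

  T : W → W → W → L
  T u v w = lin F (λ t → sh F t w) (sh F u v)

  act-lin : ∀ x w j φ → ⟪ x ⟫ (λ t → act (sh F t w) j φ) ≡ act (lin F (λ t → sh F t w) x) j φ
  act-lin x w zero    φ = sym (⟪lin⟫ (λ t → sh F t w) x φ)
  act-lin x w (suc j) φ = sym (⟪lin⟫ (λ t → sh F t w) x λ t → ⟪ ins F (x₁ j) t ⟫ φ)

  ⟪T⟫ : ∀ u v w φ → ⟪ T u v w ⟫ φ ≡ ⟪ sh F u v ⟫ (λ t → ⟪ sh F t w ⟫ φ)
  ⟪T⟫ u v w φ = ⟪lin⟫ (λ t → sh F t w) (sh F u v) φ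

  T-bounded : ∀ u v w → Bounded (length u ℕ.+ length v ℕ.+ length w) (T u v w)
  T-bounded u v w {φ} {ψ} eq = trans (⟪T⟫ u v w φ) (trans
    (sh-bounded u v λ t t≤n → sh-bounded t w λ s s≤n → eq s (ℕ.≤-trans s≤n (ℕ.+-monoˡ-≤ (length w) t≤n)))
    (sym (⟪T⟫ u v w ψ)))

  AssociativeBelow : ℕ → Set
  AssociativeBelow n = ∀ u v w → length u ℕ.+ length v ℕ.+ length w ℕ.< n → ∀ φ →
    ⟪ sh F u v ⟫ (λ t → ⟪ sh F t w ⟫ φ) ≡ ⟪ sh F v w ⟫ (λ t → ⟪ sh F u t ⟫ φ)

  withOneLetter : L → (W → Carrier) → ℕ → Carrier
  withOneLetter M ψ l = ⟪ M ⟫ (λ t → ⟪ sh F (x₁ l ∷ []) t ⟫ ψ)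

  withTwoLetters : L → (W → Carrier) → ℕ → ℕ → Carrier
  withTwoLetters M ψ l j = ⟪ M ⟫ (λ t → ⟪ sh F (x₁ l ∷ x₁ j ∷ []) t ⟫ ψ)

  -- `merge` takes only the field coefficients of its letters, so the inner weight 0 is a
  -- placeholder.
  afterMerge : Letter′ → Letter′ → Letter′ → (W → Carrier) → ℕ → W → Carrier
  afterMerge x y z φ k t = φ (merge (merge x y 0) z k ∷ t)

  -- The functional of x u ⋄ y v ⋄ z w, where M = u ⧢ v ⧢ w.
  ⟪_⋄_⋄_⟫ : Letter′ → Letter′ → Letter′ → L → (W → Carrier) → Carrier
  ⟪ x ⋄ y ⋄ z ⟫ M φ = triple (λ k → ⟪ M ⟫ (ψ k)) (λ k → withOneLetter M (ψ k)) (λ k → withTwoLetters M (ψ k))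
                             (pw x) (pw y) (pw z)
    where ψ = afterMerge x y z φ

  inner-cong : ∀ {h₀ h₀′ h₁ h₁′ h₂ h₂′} → h₀ ≡ h₀′ → (∀ l → h₁ l ≡ h₁′ l) → (∀ l j → h₂ l j ≡ h₂′ l j) →
               ∀ l j → inner h₀ h₁ h₂ l j ≡ inner h₀′ h₁′ h₂′ l j
  inner-cong p q r zero    zero    = p
  inner-cong p q r zero    (suc j) = q j
  inner-cong p q r (suc l) zero    = q l
  inner-cong p q r (suc l) (suc j) = cong₂ _+_ (cong₂ _+_ (r l j) (r j l))
    (cong₂ _+_ (q (suc (l ℕ.+ j))) (AD-cong′ (l ℕ.+ j) λ m n → cong (Δ F (suc n) (suc l) (suc j) *_) (r m n)))

  triple-cong : ∀ {f₀ f₀′ f₁ f₁′ f₂ f₂′} → (∀ k → f₀ k ≡ f₀′ k) → (∀ k l → f₁ k l ≡ f₁′ k l) →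
                (∀ k l j → f₂ k l j ≡ f₂′ k l j) → ∀ a b c → triple f₀ f₁ f₂ a b c ≡ triple f₀′ f₁′ f₂′ a b c
  triple-cong p q r a b c = D-cong a b λ i j → D-cong i c λ k l → inner-cong (p k) (q k) (r k) l j

  -- The rotation is the swap of x and y, by symmetry of `D`, followed by the swap of x and z in the
  -- last two places, by `triple-swap`.
  ⋄⋄-rotate : ∀ x y z M N → M ∼ N → ∀ φ → ⟪ x ⋄ y ⋄ z ⟫ M φ ≡ ⟪ y ⋄ z ⋄ x ⟫ N φ
  ⋄⋄-rotate x y z M N M∼N φ = begin
    triple f₀ f₁ f₂ (pw x) (pw y) (pw z)
      ≡⟨ D-sym (pw x) (pw y) (λ i j → D i (pw z) (λ k l → inner (f₀ k) (f₁ k) (f₂ k) l j)) ⟩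
    triple f₀ f₁ f₂ (pw y) (pw x) (pw z)
      ≡⟨ triple-swap f₀ f₁ f₂ (pw y) (pw x) (pw z) ⟩
    triple f₀ f₁ f₂ (pw y) (pw z) (pw x)
      ≡⟨ triple-cong (λ k → rotate k id) (λ k l → rotate k λ χ t → ⟪ sh F (x₁ l ∷ []) t ⟫ χ)
           (λ k l j → rotate k λ χ t → ⟪ sh F (x₁ l ∷ x₁ j ∷ []) t ⟫ χ) (pw y) (pw z) (pw x) ⟩
    ⟪ y ⋄ z ⋄ x ⟫ N φ ∎
    where
    ψ ψ′ : ℕ → W → Carrier
    ψ  = afterMerge x y z φ
    ψ′ = afterMerge y z x φ
    f₀ : ℕ → Carrier
    f₀ k = ⟪ M ⟫ (ψ k)
    f₁ : ℕ → ℕ → Carrier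
    f₁ k = withOneLetter M (ψ k)
    f₂ : ℕ → ℕ → ℕ → Carrier
    f₂ k = withTwoLetters M (ψ k)
    rotate : ∀ k (θ : (W → Carrier) → W → Carrier) → ⟪ M ⟫ (θ (ψ k)) ≡ ⟪ N ⟫ (θ (ψ′ k))
    rotate k θ = trans (M∼N _) (cong (λ ℓ → ⟪ N ⟫ (θ (λ t → φ (ℓ ∷ t)))) (merge-rotate x y z 0 k))

  ⟪sh-letters⟫ : ∀ l j χ → ⟪ sh F (x₁ l ∷ []) (x₁ j ∷ []) ⟫ χ ≡
    χ (x₁ l ∷ x₁ j ∷ []) + χ (x₁ j ∷ x₁ l ∷ []) +
    (χ (x₁ (suc (l ℕ.+ j)) ∷ []) + AD (l ℕ.+ j) (λ m n → Δ F (suc n) (suc l) (suc j) * χ (x₁ m ∷ x₁ n ∷ [])))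
  ⟪sh-letters⟫ l j χ = trans (⟪sh-step⟫ (x₁ l) [] (x₁ j) [] χ) (cong₂ _+_
    (cong₂ _+_ (⟪word⟫ _ (χ ∘ (x₁ l ∷_))) (⟪word⟫ _ (χ ∘ (x₁ j ∷_))))
    (trans (AD-last (l ℕ.+ j) (λ m n → A n l j * act (sh F [] []) n (χ ∘ (merge (x₁ l) (x₁ j) m ∷_))))
    (trans (+-comm _ _) (cong₂ _+_
      (trans (*-identityˡ _) (trans (⟪word⟫ [] (χ ∘ (merge (x₁ l) (x₁ j) (suc (l ℕ.+ j)) ∷_))) (cong (λ ℓ → χ (ℓ ∷ [])) (merge-x₁ l j (suc (l ℕ.+ j))))))
      (AD-cong′ (l ℕ.+ j) λ m n → cong (Δ F (suc n) (suc l) (suc j) *_)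
        (trans (⟪word⟫ [] (λ t → ⟪ ins F (x₁ n) t ⟫ (χ ∘ (merge (x₁ l) (x₁ j) m ∷_)))) (trans (⟪word⟫ (x₁ n ∷ []) (χ ∘ (merge (x₁ l) (x₁ j) m ∷_))) (cong (λ ℓ → χ (ℓ ∷ x₁ n ∷ [])) (merge-x₁ l j m)))))))))

  module Expansion (n : ℕ) (assoc : AssociativeBelow n) where

    -- For an inner letter, associativity is applied to that letter, a word t of u ⧢ v, and w. The
    -- total length is at most one more than that of u, v, w.
    act-sh : ∀ u v w → suc (length u ℕ.+ length v ℕ.+ length w) ℕ.< n → ∀ j φ →
             act (sh F u v) j (λ t → ⟪ sh F t w ⟫ φ) ≡ act (T u v w) j φ
    act-sh u v w small zero    φ = sym (⟪T⟫ u v w φ)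
    act-sh u v w small (suc j) φ = trans
      (sh-bounded u v λ t t≤ → begin
        ⟪ ins F (x₁ j) t ⟫ (λ s → ⟪ sh F s w ⟫ φ)
          ≡⟨ ins-sh (x₁ j) t _ ⟩
        ⟪ sh F (x₁ j ∷ []) t ⟫ (λ s → ⟪ sh F s w ⟫ φ)
          ≡⟨ assoc (x₁ j ∷ []) t w (ℕ.≤-<-trans (s≤s (ℕ.+-monoˡ-≤ (length w) t≤)) small) φ ⟩
        ⟪ sh F t w ⟫ (λ s → ⟪ sh F (x₁ j ∷ []) s ⟫ φ)
          ≡⟨ ⟪⟫-cong (sh F t w) (λ s → ins-sh (x₁ j) s φ) ⟨
        ⟪ sh F t w ⟫ (λ s → ⟪ ins F (x₁ j) s ⟫ φ) ∎)
      (sym (⟪T⟫ u v w _))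

    -- Associativity for x_{l+1}, x_{j+1} and a word of M, of total length at most m + 2, moves the
    -- shuffle onto the two letters, where `⟪sh-letters⟫` matches the last clause of `inner`.
    two-letters : ∀ M m → Bounded m M → suc (suc m) ℕ.< n → ∀ l j ψ →
      ⟪ M ⟫ (λ t → ⟪ ins F (x₁ j) t ⟫ (λ s → ⟪ ins F (x₁ l) s ⟫ ψ)) ≡
      inner (⟪ M ⟫ ψ) (withOneLetter M ψ) (withTwoLetters M ψ) (suc l) (suc j)
    two-letters M m M-bounded small l j ψ = begin
      ⟪ M ⟫ (λ t → ⟪ ins F (x₁ j) t ⟫ (λ s → ⟪ ins F (x₁ l) s ⟫ ψ))
        ≡⟨ M-bounded (λ t t≤m → trans (trans (ins-sh (x₁ j) t _) (⟪⟫-cong (sh F (x₁ j ∷ []) t) (λ s → ins-sh (x₁ l) s ψ)))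
             (trans (sym (assoc (x₁ l ∷ []) (x₁ j ∷ []) t (ℕ.≤-<-trans (s≤s (s≤s t≤m)) small) ψ))
                    (⟪sh-letters⟫ l j (λ s → ⟪ sh F s t ⟫ ψ)))) ⟩
      ⟪ M ⟫ (λ t → c l j t + c j l t + (e t + AD (l ℕ.+ j) (λ p r → Δ F (suc r) (suc l) (suc j) * c p r t)))
        ≡⟨ ⟪⟫-+ M (λ t → c l j t + c j l t) _ ⟩
      ⟪ M ⟫ (λ t → c l j t + c j l t) + ⟪ M ⟫ (λ t → e t + AD (l ℕ.+ j) (λ p r → Δ F (suc r) (suc l) (suc j) * c p r t))
        ≡⟨ cong₂ _+_ (⟪⟫-+ M (c l j) (c j l)) (trans (⟪⟫-+ M e _) (cong (⟪ M ⟫ e +_)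
             (trans (⟪⟫-AD M (l ℕ.+ j) λ p r t → Δ F (suc r) (suc l) (suc j) * c p r t)
               (AD-cong′ (l ℕ.+ j) λ p r → ⟪⟫-*ˡ M (Δ F (suc r) (suc l) (suc j)) (c p r))))) ⟩
      inner (⟪ M ⟫ ψ) (withOneLetter M ψ) (withTwoLetters M ψ) (suc l) (suc j) ∎
      where
      c : ℕ → ℕ → W → Carrier
      c l j t = ⟪ sh F (x₁ l ∷ x₁ j ∷ []) t ⟫ ψ
      e : W → Carrier
      e t = ⟪ sh F (x₁ (suc (l ℕ.+ j)) ∷ []) t ⟫ ψ

    ⋄⋄-expand : ∀ x u y v z w → suc (suc (length u ℕ.+ length v ℕ.+ length w)) ℕ.< n → ∀ φ →
      D (pw x) (pw y) (λ i j → act (sh F u v) j (λ t → ⟪ merge x y i ⋄ z ⟫ (sh F t w) φ)) ≡ ⟪ x ⋄ y ⋄ z ⟫ (T u v w) φ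
    ⋄⋄-expand x@(mkLetter _ _ _) u y@(mkLetter _ _ _) v z@(mkLetter _ _ _) w small φ = D-cong (pw x) (pw y) λ i j → trans
      (act-D (sh F u v) j i (pw z) (λ k l t → act (sh F t w) l (ψ k)))
      (D-cong i (pw z) λ k l → letters l j (ψ k))
      where
      M = T u v w
      m = length u ℕ.+ length v ℕ.+ length w
      ψ = afterMerge x y z φ
      letters : ∀ l j ψ → act (sh F u v) j (λ t → act (sh F t w) l ψ) ≡
        inner (⟪ M ⟫ ψ) (withOneLetter M ψ) (withTwoLetters M ψ) l j
      letters zero    zero    ψ = sym (⟪T⟫ u v w ψ)
      letters (suc l) zero    ψ = trans (sym (⟪T⟫ u v w _)) (⟪⟫-cong M λ t → ins-sh (x₁ l) t ψ)
      letters zero    (suc j) ψ = trans (act-sh u v w (ℕ.<-trans (ℕ.n<1+n _) small) (suc j) ψ)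
                                        (⟪⟫-cong M λ t → ins-sh (x₁ j) t ψ)
      letters (suc l) (suc j) ψ = trans (act-sh u v w (ℕ.<-trans (ℕ.n<1+n _) small) (suc j) (λ t → ⟪ ins F (x₁ l) t ⟫ ψ))
                                        (two-letters M m (T-bounded u v w) small l j ψ)

    -- The first letter comes from one of the three words, from the diamond of two of them, or from
    -- that of all three. Rotation permutes the terms within each of these groups.
    T-expand : ∀ x u y v z w → suc (suc (length u ℕ.+ length v ℕ.+ length w)) ℕ.< n → ∀ φ →
      ⟪ T (x ∷ u) (y ∷ v) (z ∷ w) ⟫ φ ≡
      (⟪ T u (y ∷ v) (z ∷ w) ⟫ (φ ∘ (x ∷_)) + ⟪ T (x ∷ u) v (z ∷ w) ⟫ (φ ∘ (y ∷_)) + ⟪ T (x ∷ u) (y ∷ v) w ⟫ (φ ∘ (z ∷_)))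
      + (⟪ x ⋄ y ⟫ (T u v (z ∷ w)) φ + ⟪ x ⋄ z ⟫ (T u (y ∷ v) w) φ + ⟪ y ⋄ z ⟫ (T (x ∷ u) v w) φ)
      + ⟪ x ⋄ y ⋄ z ⟫ (T u v w) φ
    T-expand x u y v z w small φ = begin
      ⟪ T (x ∷ u) (y ∷ v) (z ∷ w) ⟫ φ
        ≡⟨ trans (⟪T⟫ (x ∷ u) (y ∷ v) (z ∷ w) φ) (⟪sh-step⟫ x u y v _) ⟩
      ⟪ sh F u (y ∷ v) ⟫ (λ t → ⟪ sh F (x ∷ t) (z ∷ w) ⟫ φ) + ⟪ sh F (x ∷ u) v ⟫ (λ t → ⟪ sh F (y ∷ t) (z ∷ w) ⟫ φ)
        + D (pw x) (pw y) (λ i j → act (sh F u v) j (λ t → ⟪ sh F (merge x y i ∷ t) (z ∷ w) ⟫ φ))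
        ≡⟨ cong₂ _+_ (cong₂ _+_ (single x (sh F u (y ∷ v))) (single y (sh F (x ∷ u) v))) merged ⟩
      (lhs x (sh F u (y ∷ v)) + ⟪ sh F u (y ∷ v) ⟫ (χ ∘ (x ∷_)) + ⟪ x ⋄ z ⟫ (T u (y ∷ v) w) φ)
        + (lhs y (sh F (x ∷ u) v) + ⟪ sh F (x ∷ u) v ⟫ (χ ∘ (y ∷_)) + ⟪ y ⋄ z ⟫ (T (x ∷ u) v w) φ)
        + (⟪ x ⋄ y ⟫ (T u v (z ∷ w)) φ + ⟪ x ⋄ y ⟫ (sh F u v) χ + ⟪ x ⋄ y ⋄ z ⟫ (T u v w) φ)
        -- The terms a₂, b₂, c₂ put z first; together they are the recursive expansion of x u ⧢ y v.
        ≡⟨ solve 9 (λ a₁ a₂ a₃ b₁ b₂ b₃ c₁ c₂ c₃ → (a₁ :+ a₂ :+ a₃) :+ (b₁ :+ b₂ :+ b₃) :+ (c₁ :+ c₂ :+ c₃)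
             := (a₁ :+ b₁ :+ (a₂ :+ b₂ :+ c₂)) :+ (c₁ :+ a₃ :+ b₃) :+ c₃) refl _ _ _ _ _ _ _ _ _ ⟩
      (lhs x (sh F u (y ∷ v)) + lhs y (sh F (x ∷ u) v)
          + (⟪ sh F u (y ∷ v) ⟫ (χ ∘ (x ∷_)) + ⟪ sh F (x ∷ u) v ⟫ (χ ∘ (y ∷_)) + ⟪ x ⋄ y ⟫ (sh F u v) χ))
        + (⟪ x ⋄ y ⟫ (T u v (z ∷ w)) φ + ⟪ x ⋄ z ⟫ (T u (y ∷ v) w) φ + ⟪ y ⋄ z ⟫ (T (x ∷ u) v w) φ)
        + ⟪ x ⋄ y ⋄ z ⟫ (T u v w) φ
        ≡⟨ cong (λ p → p + (⟪ x ⋄ y ⟫ (T u v (z ∷ w)) φ + ⟪ x ⋄ z ⟫ (T u (y ∷ v) w) φ + ⟪ y ⋄ z ⟫ (T (x ∷ u) v w) φ)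
             + ⟪ x ⋄ y ⋄ z ⟫ (T u v w) φ) (cong₂ _+_
             (cong₂ _+_ (sym (⟪T⟫ u (y ∷ v) (z ∷ w) _)) (sym (⟪T⟫ (x ∷ u) v (z ∷ w) _)))
             (trans (sym (⟪sh-step⟫ x u y v χ)) (sym (⟪T⟫ (x ∷ u) (y ∷ v) w _)))) ⟩
      _ ∎
      where
      χ : W → Carrier
      χ t = ⟪ sh F t w ⟫ (φ ∘ (z ∷_))
      lhs : Letter′ → L → Carrier
      lhs p x = ⟪ x ⟫ (λ t → ⟪ sh F t (z ∷ w) ⟫ (φ ∘ (p ∷_)))
      single : ∀ p x → ⟪ x ⟫ (λ t → ⟪ sh F (p ∷ t) (z ∷ w) ⟫ φ) ≡
               lhs p x + ⟪ x ⟫ (χ ∘ (p ∷_)) + ⟪ p ⋄ z ⟫ (lin F (λ t → sh F t w) x) φ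
      single p x = begin
        ⟪ x ⟫ (λ t → ⟪ sh F (p ∷ t) (z ∷ w) ⟫ φ)
          ≡⟨ ⟪⟫-cong x (λ t → ⟪sh-step⟫ p t z w φ) ⟩
        ⟪ x ⟫ (λ t → ⟪ sh F t (z ∷ w) ⟫ (φ ∘ (p ∷_)) + χ (p ∷ t) + ⟪ p ⋄ z ⟫ (sh F t w) φ)
          ≡⟨ trans (⟪⟫-+ x _ _) (cong₂ _+_ (⟪⟫-+ x _ _) (⟪⟫-D x (pw p) (pw z) λ i j t → act (sh F t w) j (φ ∘ (merge p z i ∷_)))) ⟩
        lhs p x + ⟪ x ⟫ (χ ∘ (p ∷_)) + D (pw p) (pw z) (λ i j → ⟪ x ⟫ (λ t → act (sh F t w) j (φ ∘ (merge p z i ∷_))))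
          ≡⟨ cong (lhs p x + ⟪ x ⟫ (χ ∘ (p ∷_)) +_) (D-cong (pw p) (pw z) λ i j → act-lin x w j (φ ∘ (merge p z i ∷_))) ⟩
        lhs p x + ⟪ x ⟫ (χ ∘ (p ∷_)) + ⟪ p ⋄ z ⟫ (lin F (λ t → sh F t w) x) φ ∎
      merged : D (pw x) (pw y) (λ i j → act (sh F u v) j (λ t → ⟪ sh F (merge x y i ∷ t) (z ∷ w) ⟫ φ)) ≡
               ⟪ x ⋄ y ⟫ (T u v (z ∷ w)) φ + ⟪ x ⋄ y ⟫ (sh F u v) χ + ⟪ x ⋄ y ⋄ z ⟫ (T u v w) φ
      merged = begin
        D (pw x) (pw y) (λ i j → act (sh F u v) j (λ t → ⟪ sh F (merge x y i ∷ t) (z ∷ w) ⟫ φ))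
          ≡⟨ D-cong (pw x) (pw y) (λ i j → trans (act-cong (sh F u v) j (λ t → ⟪sh-step⟫ (merge x y i) t z w φ))
               (trans (act-+ (sh F u v) j (λ t → p i t + q i t) (r i)) (cong (_+ act (sh F u v) j (r i)) (act-+ (sh F u v) j (p i) (q i))))) ⟩
        D (pw x) (pw y) (λ i j → act (sh F u v) j (p i) + act (sh F u v) j (q i) + act (sh F u v) j (r i))
          ≡⟨ trans (D-+ (pw x) (pw y) (λ i j → act (sh F u v) j (p i) + act (sh F u v) j (q i)) (λ i j → act (sh F u v) j (r i)))
               (cong (_+ D (pw x) (pw y) (λ i j → act (sh F u v) j (r i)))
                 (D-+ (pw x) (pw y) (λ i j → act (sh F u v) j (p i)) (λ i j → act (sh F u v) j (q i)))) ⟩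
        D (pw x) (pw y) (λ i j → act (sh F u v) j (p i)) + ⟪ x ⋄ y ⟫ (sh F u v) χ + D (pw x) (pw y) (λ i j → act (sh F u v) j (r i))
          ≡⟨ cong₂ (λ a b → a + ⟪ x ⋄ y ⟫ (sh F u v) χ + b)
               (D-cong (pw x) (pw y) (λ i j → act-sh u v (z ∷ w)
                 (subst (ℕ._< n) (cong suc (sym (ℕ.+-suc (length u ℕ.+ length v) (length w)))) small) j (φ ∘ (merge x y i ∷_))))
               (⋄⋄-expand x u y v z w small φ) ⟩
        ⟪ x ⋄ y ⟫ (T u v (z ∷ w)) φ + ⟪ x ⋄ y ⟫ (sh F u v) χ + ⟪ x ⋄ y ⋄ z ⟫ (T u v w) φ ∎
        where
        p q r : ℕ → W → Carrier
        p i t = ⟪ sh F t (z ∷ w) ⟫ (φ ∘ (merge x y i ∷_))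
        q i t = χ (merge x y i ∷ t)
        r i t = ⟪ merge x y i ⋄ z ⟫ (sh F t w) φ

  assoc-from-cyclic : ∀ u v w → T u v w ∼ T v w u → ∀ φ →
    ⟪ sh F u v ⟫ (λ t → ⟪ sh F t w ⟫ φ) ≡ ⟪ sh F v w ⟫ (λ t → ⟪ sh F u t ⟫ φ)
  assoc-from-cyclic u v w cyclic φ = trans (sym (⟪T⟫ u v w φ)) (trans (cyclic φ) (trans (⟪T⟫ v w u φ)
    (⟪⟫-cong (sh F v w) λ t → sh-comm t u φ)))

  -- In the induction step every T inside the three groups of `T-expand` is shorter. The
  -- associativity needed for `Expansion` comes from rotation at the smaller bound, through
  -- `assoc-from-cyclic`.
  T-cyclic : ∀ n u v w → length u ℕ.+ length v ℕ.+ length w ℕ.< n → T u v w ∼ T v w u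
  T-cyclic n [] v w _ φ = trans (⟪T⟫ [] v w φ) (trans (⟪sh-[]ˡ⟫ v (λ t → ⟪ sh F t w ⟫ φ))
    (sym (trans (⟪T⟫ v w [] φ) (⟪⟫-cong (sh F v w) λ t → ⟪sh-[]ʳ⟫ t φ))))
  T-cyclic n u@(_ ∷ _) [] w _ φ = trans (⟪T⟫ u [] w φ) (trans (⟪sh-[]ʳ⟫ u (λ t → ⟪ sh F t w ⟫ φ)) (trans (sh-comm u w φ)
    (sym (trans (⟪T⟫ [] w u φ) (⟪sh-[]ˡ⟫ w (λ t → ⟪ sh F t u ⟫ φ))))))
  T-cyclic n u@(_ ∷ _) v@(_ ∷ _) [] _ φ = trans (⟪T⟫ u v [] φ) (trans (⟪⟫-cong (sh F u v) λ t → ⟪sh-[]ʳ⟫ t φ)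
    (trans (sh-comm u v φ) (sym (trans (⟪T⟫ v [] u φ) (⟪sh-[]ʳ⟫ v (λ t → ⟪ sh F t u ⟫ φ))))))
  T-cyclic (suc n) (x ∷ u) (y ∷ v) (z ∷ w) (s≤s below) φ = begin
    ⟪ T (x ∷ u) (y ∷ v) (z ∷ w) ⟫ φ
      ≡⟨ T-expand x u y v z w (at≤ 3 ℕ.≤-refl refl) φ ⟩
    (⟪ T u (y ∷ v) (z ∷ w) ⟫ (φ ∘ (x ∷_)) + ⟪ T (x ∷ u) v (z ∷ w) ⟫ (φ ∘ (y ∷_)) + ⟪ T (x ∷ u) (y ∷ v) w ⟫ (φ ∘ (z ∷_)))
      + (⟪ x ⋄ y ⟫ (T u v (z ∷ w)) φ + ⟪ x ⋄ z ⟫ (T u (y ∷ v) w) φ + ⟪ y ⋄ z ⟫ (T (x ∷ u) v w) φ)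
      + ⟪ x ⋄ y ⋄ z ⟫ (T u v w) φ
      ≡⟨ cong₂ _+_ (cong₂ _+_
           -- The term beginning with x moves to the end, since `T-expand` for y, z, x lists it
           -- last.
           (trans (+-assoc _ _ _) (trans (+-comm _ _) (cong₂ _+_
             (cong₂ _+_
               (T-cyclic n (x ∷ u) v (z ∷ w) (at≤ 3 ℕ.≤-refl (solveℕ 3 (λ a b c → con 1 :+ₙ (con 1 :+ₙ a :+ₙ b :+ₙ (con 1 :+ₙ c)) :=ₙ con 3 :+ₙ (a :+ₙ b :+ₙ c)) refl a b c)) _)
               (T-cyclic n (x ∷ u) (y ∷ v) w (at≤ 3 ℕ.≤-refl (solveℕ 3 (λ a b c → con 1 :+ₙ (con 1 :+ₙ a :+ₙ (con 1 :+ₙ b) :+ₙ c) :=ₙ con 3 :+ₙ (a :+ₙ b :+ₙ c)) refl a b c)) _))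
             (T-cyclic n u (y ∷ v) (z ∷ w) (at≤ 3 ℕ.≤-refl (solveℕ 3 (λ a b c → con 1 :+ₙ (a :+ₙ (con 1 :+ₙ b) :+ₙ (con 1 :+ₙ c)) :=ₙ con 3 :+ₙ (a :+ₙ b :+ₙ c)) refl a b c)) _))))
           (trans (+-comm _ _) (trans (cong₂ _+_
             (⋄-∼ y z (T (x ∷ u) v w) (T v w (x ∷ u))
               (T-cyclic n (x ∷ u) v w (at≤ 2 two≤3 (solveℕ 3 (λ a b c → con 1 :+ₙ (con 1 :+ₙ a :+ₙ b :+ₙ c) :=ₙ con 2 :+ₙ (a :+ₙ b :+ₙ c)) refl a b c))) φ)
             (cong₂ _+_
               (trans (⋄-∼ x y (T u v (z ∷ w)) (T v (z ∷ w) u)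
                 (T-cyclic n u v (z ∷ w) (at≤ 2 two≤3 (solveℕ 3 (λ a b c → con 1 :+ₙ (a :+ₙ b :+ₙ (con 1 :+ₙ c)) :=ₙ con 2 :+ₙ (a :+ₙ b :+ₙ c)) refl a b c))) φ)
                 (⋄-sym x y (T v (z ∷ w) u) φ))
               (trans (⋄-∼ x z (T u (y ∷ v) w) (T (y ∷ v) w u)
                 (T-cyclic n u (y ∷ v) w (at≤ 2 two≤3 (solveℕ 3 (λ a b c → con 1 :+ₙ (a :+ₙ (con 1 :+ₙ b) :+ₙ c) :=ₙ con 2 :+ₙ (a :+ₙ b :+ₙ c)) refl a b c))) φ)
                 (⋄-sym x z (T (y ∷ v) w u) φ))))
             (sym (+-assoc _ _ _)))))
           (⋄⋄-rotate x y z (T u v w) (T v w u)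
             (T-cyclic n u v w (at≤ 1 (s≤s z≤n) refl)) φ) ⟩
    (⟪ T v (z ∷ w) (x ∷ u) ⟫ (φ ∘ (y ∷_)) + ⟪ T (y ∷ v) w (x ∷ u) ⟫ (φ ∘ (z ∷_)) + ⟪ T (y ∷ v) (z ∷ w) u ⟫ (φ ∘ (x ∷_)))
      + (⟪ y ⋄ z ⟫ (T v w (x ∷ u)) φ + ⟪ y ⋄ x ⟫ (T v (z ∷ w) u) φ + ⟪ z ⋄ x ⟫ (T (y ∷ v) w u) φ)
      + ⟪ y ⋄ z ⋄ x ⟫ (T v w u) φ
      ≡⟨ T-expand y v z w x u (at≤ 3 ℕ.≤-refl (solveℕ 3 (λ a b c → con 3 :+ₙ (b :+ₙ c :+ₙ a) :=ₙ con 3 :+ₙ (a :+ₙ b :+ₙ c)) refl a b c)) φ ⟨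
    ⟪ T (y ∷ v) (z ∷ w) (x ∷ u) ⟫ φ ∎
    where
    open Data.Nat.Solver.+-*-Solver using (con) renaming (solve to solveℕ; _:+_ to _:+ₙ_; _:=_ to _:=ₙ_)
    open Expansion n (λ u v w p → assoc-from-cyclic u v w (T-cyclic n u v w p))
    a = length u
    b = length v
    c = length w
    two≤3 : 2 ℕ.≤ 3
    two≤3 = s≤s (s≤s z≤n)
    total : 3 ℕ.+ (a ℕ.+ b ℕ.+ c) ℕ.≤ n
    total = subst (ℕ._≤ n) (solveℕ 3 (λ a b c → con 1 :+ₙ a :+ₙ (con 1 :+ₙ b) :+ₙ (con 1 :+ₙ c) :=ₙ con 3 :+ₙ (a :+ₙ b :+ₙ c)) refl a b c) below
    at≤ : ∀ k → k ℕ.≤ 3 → ∀ {m} → m ≡ k ℕ.+ (a ℕ.+ b ℕ.+ c) → m ℕ.≤ n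
    at≤ k k≤3 refl = ℕ.≤-trans (ℕ.+-monoˡ-≤ (a ℕ.+ b ℕ.+ c) k≤3) total

  sh-assoc : ∀ u v w φ → ⟪ sh F u v ⟫ (λ t → ⟪ sh F t w ⟫ φ) ≡ ⟪ sh F v w ⟫ (λ t → ⟪ sh F u t ⟫ φ)
  sh-assoc u v w = assoc-from-cyclic u v w (T-cyclic _ u v w (ℕ.n<1+n _))

  -- The diamond retains only the group in which all three first letters merge. Associativity of ⧢,
  -- known by now in every length, is still used on the inner letters.
  dia-expand : ∀ x u y v z w φ →
    ⟪ dia F (x ∷ u) (y ∷ v) ⟫ (λ t → ⟪ dia F t (z ∷ w) ⟫ φ) ≡ ⟪ x ⋄ y ⋄ z ⟫ (T u v w) φ
  dia-expand x u y v z w φ = trans (⟪dia-step⟫ x u y v _) (trans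
    (D-cong (pw x) (pw y) λ i j → act-cong (sh F u v) j λ t → ⟪dia-step⟫ (merge x y i) t z w φ)
    (Expansion.⋄⋄-expand _ (λ u v w _ → sh-assoc u v w) x u y v z w (ℕ.n<1+n _) φ))

  dia-cyclic : ∀ u v w φ → ⟪ dia F u v ⟫ (λ t → ⟪ dia F t w ⟫ φ) ≡ ⟪ dia F v w ⟫ (λ t → ⟪ dia F t u ⟫ φ)
  dia-cyclic []        v         w         φ = trans (⟪word⟫ v (λ t → ⟪ dia F t w ⟫ φ)) (⟪⟫-cong (dia F v w) λ t → sym (⟪dia-[]ʳ⟫ t φ))
  dia-cyclic u@(_ ∷ _) []        w         φ = trans (⟪dia-[]ʳ⟫ u (λ t → ⟪ dia F t w ⟫ φ)) (trans (dia-comm u w φ) (sym (⟪word⟫ w (λ t → ⟪ dia F t u ⟫ φ))))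
  dia-cyclic u@(_ ∷ _) v@(_ ∷ _) []        φ = trans (⟪⟫-cong (dia F u v) λ t → ⟪dia-[]ʳ⟫ t φ)
    (trans (dia-comm u v φ) (sym (⟪dia-[]ʳ⟫ v (λ t → ⟪ dia F t u ⟫ φ))))
  dia-cyclic (x ∷ u)   (y ∷ v)   (z ∷ w)   φ = trans (dia-expand x u y v z w φ) (trans
    (⋄⋄-rotate x y z (T u v w) (T v w u) (T-cyclic _ u v w (ℕ.n<1+n _)) φ)
    (sym (dia-expand y v z w x u φ)))

  dia-assoc : ∀ u v w φ → ⟪ dia F u v ⟫ (λ t → ⟪ dia F t w ⟫ φ) ≡ ⟪ dia F v w ⟫ (λ t → ⟪ dia F u t ⟫ φ)
  dia-assoc u v w φ = trans (dia-cyclic u v w φ) (⟪⟫-cong (dia F v w) λ t → dia-comm t u φ)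

  dia-isCommAlgebra : IsCommAlgebra F (bilin F (dia F))
  dia-isCommAlgebra = isCommAlgebra (dia F) ⟪word⟫ dia-comm dia-assoc

  sh-isCommAlgebra : IsCommAlgebra F (bilin F (sh F))
  sh-isCommAlgebra = isCommAlgebra (sh F) ⟪word⟫ sh-comm sh-assoc

open import Defs
open ≡ using (refl; sym; trans)

theorem5p9 : (q : ℕ) → IsPrimePower q → (F : FiniteField q)
    → IsCommAlgebra F (_⋄_ F) × IsCommAlgebra F (_⧢_ F)
-- The main case has q = d + 2, where `q ∸ 1` in `Δ` computes to `suc d`. A field with 0 ≠ 1 has at
-- least two elements, which excludes the smaller q.
theorem5p9 zero _ F with Inverse.to (FiniteField.card F) (FiniteField.0# F)
... | ()
theorem5p9 (suc zero) _ F = ⊥-elim (FiniteField.1≢0 F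
  (trans (sym (Inverse.strictlyInverseʳ card 1#)) (trans (cong (Inverse.from card) (unique _ _)) (Inverse.strictlyInverseʳ card 0#))))
  where
  open FiniteField F using (card; 0#; 1#)
  unique : ∀ (i j : Fin 1) → i ≡ j
  unique Fin.zero Fin.zero = refl
theorem5p9 (suc (suc d)) _ F = dia-isCommAlgebra , sh-isCommAlgebra
  where open WordProducts F
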